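{- Let $n,k,\lambda$ be integers with $n\ge k\ge 3$ and $\lambda=\left\lfloor\frac{kn-2k-1}{k^2-2k-1}\right\rfloor+1$. Then ${\rm ex}_{\mathcal{OP}}(n,C_k)=f(n,k)$, where $$f(n,k)=\begin{cases} 2n-\lambda+2\left\lfloor\frac{\lambda}{k}\right\rfloor-3 & \text{if } k\mid\lambda,\\[2pt] 2n-\lambda+2\left\lfloor\frac{\lambda}{k}\right\rfloor-2 & \text{otherwise.}\end{cases}$$
   Context: All graphs are finite, undirected and simple. $C_k$ denotes the cycle on $k$ vertices. A graph is $H$-free if it contains no (not necessarily induced) subgraph isomorphic to $H$. A graph is outerplanar if it can be embedded in the plane so that all vertices lie on the boundary of the outer face. The outerplanar Turán number ${\rm ex}_{\mathcal{OP}}(n,H)$ is the maximum number of edges in an $H$-free outerplanar graph on $n$ vertices. -}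

module Defs where

open import Data.Bool.Base using (if_then_else_)
open import Data.Fin.Base using (Fin; toℕ)
import Data.Fin.Properties as Finₚ
open import Data.Fin.Subset using (Subset; _∈_)
open import Data.Integer.Base as ℤ using (ℤ; +_)
open import Data.List.Base using (length; filter; allFin; cartesianProduct)
open import Data.Nat.Base
open import Data.Nat.DivMod using (_/_; _%_; m<n⇒m%n≡m; n%n≡0)
open import Data.Nat.Divisibility using (_∣?_)
open import Data.Nat.Properties
open import Data.Product.Base using (Σ-syntax; ∃-syntax; _×_; _,_; proj₁)
open import Data.Sum.Base using (_⊎_; inj₁; inj₂; swap)
open import Function.Base using (_on_)
open import Function.Bundles using (_⇔_)
open import Function.Definitions using (Injective; StrictlySurjective)
open import Level using (0ℓ)
open import Relation.Binary.Core using (Rel)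
open import Relation.Binary.Construct.Closure.ReflexiveTransitive using (Star)
open import Relation.Binary.Definitions using (Decidable; Symmetric; Irreflexive)
open import Relation.Binary.PropositionalEquality
  using (_≡_; refl; sym; trans; subst)
open import Relation.Nullary using (¬_; contradiction)
open import Relation.Nullary.Decidable using (does; _×-dec_; _⊎-dec_; ¬?)

------------------------------------------------------------------------
-- Graphs

record Graph (n : ℕ) : Set₁ where
  field
    E      : Rel (Fin n) 0ℓ
    E?     : Decidable E
    E-sym  : Symmetric E
    E-irr  : Irreflexive _≡_ E

  Connected : Rel (Fin n) 0ℓ
  Connected = Star E

  Isolated : Fin n → Set
  Isolated u = ∀ v → ¬ E u v

  #edges : ℕ
  #edges = length (filter (λ (u , v) → (u Finₚ.<? v) ×-dec E? u v)
                          (cartesianProduct (allFin n) (allFin n)))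

  #isolated : ℕ
  #isolated = length (filter (λ u → Finₚ.all? (λ v → ¬? (E? u v))) (allFin n))

  Dart : Set
  Dart = Σ[ (u , v) ∈ Fin n × Fin n ] E u v

-- A (not necessarily induced) subgraph of G isomorphic to H.
Contains : ∀ {m n} → Graph m → Graph n → Set
Contains {m} {n} H G = Σ[ h ∈ (Fin m → Fin n) ]
  Injective _≡_ _≡_ h × (∀ {i j} → Graph.E H i j → Graph.E G (h i) (h j))

Free : ∀ {m n} → Graph m → Graph n → Set
Free H G = ¬ Contains H G

private
  suc%≢ : ∀ {k} .{{_ : NonZero k}} → 3 ≤ k → ∀ {i} → i < k → ¬ (suc i % k ≡ i)
  suc%≢ {k} 3≤k {i} i<k eq with m≤n⇒m<n∨m≡n i<k
  ... | inj₁ 1+i<k = 1+n≢n (trans (sym (m<n⇒m%n≡m 1+i<k)) eq)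
  ... | inj₂ refl  = contradiction
    (subst (λ j → 3 ≤ suc j) (trans (sym eq) (n%n≡0 k)) 3≤k) λ { (s≤s ()) }

-- C_k: i and j are adjacent iff they differ by 1 modulo k.
cycle : ∀ k → 3 ≤ k → Graph k
cycle k@(suc _) 3≤k = record
  { E     = λ i j → suc (toℕ i) % k ≡ toℕ j ⊎ suc (toℕ j) % k ≡ toℕ i
  ; E?    = λ i j → (suc (toℕ i) % k ≟ toℕ j) ⊎-dec (suc (toℕ j) % k ≟ toℕ i)
  ; E-sym = swap
  ; E-irr = λ { {i} refl (inj₁ eq) → suc%≢ 3≤k (Finₚ.toℕ<n i) eq
              ; {i} refl (inj₂ eq) → suc%≢ 3≤k (Finₚ.toℕ<n i) eq }
  }

------------------------------------------------------------------------
-- Plane embeddings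

-- The equivalence relation _~_ has exactly m classes, numbered by `class`.
record Classes {A : Set} (_~_ : Rel A 0ℓ) (m : ℕ) : Set where
  field
    class : A → Fin m
    onto  : StrictlySurjective _≡_ class
    exact : ∀ {a b} → class a ≡ class b ⇔ a ~ b

-- An embedding in the plane, up to homeomorphism, is given combinatorially
-- by its rotation system: `rot u` permutes the neighbours of u cyclically,
-- in the order in which the edges leave u.
record RotationSystem {n} (G : Graph n) : Set where
  open Graph G
  field
    rot    : Fin n → Fin n → Fin n
    closed : ∀ {u v} → E u v → E u (rot u v)
    cyclic : ∀ {u v w} → E u v → E u w → Star (λ x y → rot u x ≡ y) v w

  -- Walking along a face boundary: having traversed u → v, leave v along
  -- the edge following vu in the rotation at v.
  next : Fin n × Fin n → Fin n × Fin n
  next (u , v) = v , rot v u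

  -- Darts on the same facial walk, i.e. in the same orbit of `next`.  As
  -- `next` permutes the finitely many darts, this is an equivalence.
  SameFace : Rel Dart 0ℓ
  SameFace = Star (λ d e → next d ≡ e) on proj₁

-- Genus 0 is expressed by Euler's formula V - E + F = 2C.  Faces are counted
-- separately for each component (each component drawn in a sphere of its
-- own), and an isolated vertex has one face, without darts.  Every component
-- contributes at most 2 to V - E + F, so equality makes all of them planar.
record PlaneEmbedding {n} (G : Graph n) : Set where
  open Graph G
  field
    rotation : RotationSystem G
  open RotationSystem rotation public
  field
    {#faces #components} : ℕ
    faces      : Classes SameFace #faces
    components : Classes Connected #components
    euler      : n + (#faces + #isolated) ≡ #edges + 2 * #components

  face : Dart → Fin #faces
  face = Classes.class faces

-- The boundary of the outer face of a plane graph consists of facial walks,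
-- collected in `outer`.  If every vertex is on that boundary, no component
-- lies inside an inner face of another one, so each component with an edge
-- contributes exactly one facial walk, and conversely any such choice of
-- walks is realised by drawing the components side by side.  An isolated
-- vertex is then automatically on the boundary of the outer face.
record OuterplanarEmbedding {n} (G : Graph n) : Set where
  open Graph G
  field
    embedding : PlaneEmbedding G
  open PlaneEmbedding embedding public
  field
    outer    : Subset #faces
    unique   : ∀ {u v u′ v′} (d : E u v) (d′ : E u′ v′) → Connected u u′ →
               face ((u , v) , d) ∈ outer → face ((u′ , v′) , d′) ∈ outer →
               face ((u , v) , d) ≡ face ((u′ , v′) , d′)
    incident : ∀ u → Isolated u ⊎
               (∃[ v ] Σ[ d ∈ E u v ] face ((u , v) , d) ∈ outer)

Outerplanar : ∀ {n} → Graph n → Set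
Outerplanar = OuterplanarEmbedding

------------------------------------------------------------------------
-- The outerplanar Turán number

-- ex_OP(n , H) = m
record IsExOP {h} (n : ℕ) (H : Graph h) (m : ℕ) : Set₁ where
  field
    attained : ∃[ G ] Outerplanar {n} G × Free H G × Graph.#edges G ≡ m
    maximal  : ∀ (G : Graph n) → Outerplanar G → Free H G → Graph.#edges G ≤ m

------------------------------------------------------------------------
-- The formula

private
  denominator>0 : ∀ {k} → 3 ≤ k → 0 < k * k ∸ (2 * k + 1)
  denominator>0 {k} 3≤k = m<n⇒0<n∸m (begin-strict
    2 * k + 1  <⟨ +-monoʳ-< (2 * k) (≤-trans (s≤s (s≤s z≤n)) 3≤k) ⟩
    2 * k + k  ≡⟨ +-comm (2 * k) k ⟩
    3 * k      ≤⟨ *-monoˡ-≤ k 3≤k ⟩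
    k * k      ∎)
    where open ≤-Reasoning

-- λ.  For n ≥ k ≥ 3 both truncated subtractions are genuine ones.
lam : (n k : ℕ) → 3 ≤ k → ℕ
lam n k 3≤k = (k * n ∸ (2 * k + 1)) / (k * k ∸ (2 * k + 1)) + 1
  where instance _ = >-nonZero (denominator>0 {k} 3≤k)

f : (n k : ℕ) → 3 ≤ k → ℤ
f n k 3≤k =
  if does (k ∣? λ′)
  then + (2 * n) ℤ.- + λ′ ℤ.+ + (2 * (λ′ / k)) ℤ.- + 3
  else + (2 * n) ℤ.- + λ′ ℤ.+ + (2 * (λ′ / k)) ℤ.- + 2
  where
  λ′ = lam n k 3≤k
  instance _ = >-nonZero (≤-trans (s≤s z≤n) 3≤k)

{-# OPTIONS --safe #-}
module Submission where

-- Put t = k − 2 and let the loss of a graph on n vertices be ℓ = 2 (n − 1) − e.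
--
-- Upper bound.  The order in which the outer face visits the vertices makes the edges
-- noncrossing.  This rests on Euler's formula: gluing darts one edge at a time, V − E + F − 2C
-- never increases, and two crossing edges would force a decrease.  A noncrossing graph is a
-- tree of faces, and an inner face with w + 2 edges has weight w.  Connected sets of faces of
-- total weight w bound cycles of length w + 2, so t is not such a weight.  Hence at most t − 1
-- triangles are connected, a face of weight at least t + 1 costs a loss of at least t, and
-- induction on the tree gives n − 1 ≤ t ℓ + (2 t − 1) h for some h with t h + 1 ≤ ℓ.
--
-- Lower bound.  Equality needs h faces with k + 1 edges, each surrounded by fans of t − 1
-- triangles which also link these faces to each other, and ℓ − t h blocks in a row.  Other
-- values of n are reached by shortening one or two fans.

open import Defs
open import Data.Bool.Base using (Bool; if_then_else_)
open import Data.Empty using (⊥)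
open import Data.Fin.Base
  using (Fin; zero; suc; toℕ; fromℕ<; inject₁; punchIn; punchOut; _↑ˡ_; _↑ʳ_; splitAt; combine; remQuot)
import Data.Fin.Properties as Finₚ
open import Data.Fin.Patterns using (1F; 2F; 3F)
open import Data.Fin.Subset using (⁅_⁆) renaming (_∈_ to _∈ˢ_)
open import Data.Fin.Subset.Properties using (x∈⁅x⁆; x∈⁅y⁆⇒x≡y)
open import Data.Integer.Base as ℤ using (+_)
import Data.Integer.Tactic.RingSolver as ℤSolver
open import Data.List.Base
  using (List; []; _∷_; [_]; length; map; _++_; allFin; filter; cartesianProduct; lookup)
open import Data.List.Membership.Propositional using (_∈_; _∉_)
open import Data.List.Membership.Propositional.Properties
open import Data.List.Properties using (length-++; length-map; length-tabulate; filter-none)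
open import Data.List.Relation.Binary.Permutation.Propositional
  using (_↭_; ↭-trans; ↭-sym; prep; ↭⇒↭ₛ)
open import Data.List.Relation.Binary.Permutation.Propositional.Properties
  using (shift; ∈-resp-↭; ↭-length)
import Data.List.Relation.Binary.Permutation.Setoid.Properties as PermS
open import Data.List.Relation.Unary.All as All using (All)
open import Data.List.Relation.Unary.AllPairs using ([]; _∷_)
open import Data.List.Relation.Unary.Any using (here; there; index)
open import Data.List.Relation.Unary.Any.Properties using (lookup-index)
open import Data.List.Relation.Unary.Unique.Propositional using (Unique)
import Data.List.Relation.Unary.Unique.Propositional.Properties as Uniqueₚ
open import Data.Maybe.Base using (Maybe; just; nothing)
open import Data.Nat.Base
open import Data.Nat.DivMod
open import Data.Nat.Divisibility using (_∣?_; divides; divides-refl; n∣m⇒m%n≡0)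
open import Data.Nat.Properties as ℕₚ hiding (_≟_)
open import Data.Nat.Tactic.RingSolver using (solve-∀)
open import Data.Product.Base using (Σ; ∃; ∃₂; _×_; _,_; proj₁; proj₂; uncurry)
open import Data.Product.Properties using (≡-dec)
open import Data.Sum.Base using (_⊎_; inj₁; inj₂; [_,_]′; swap)
open import Data.Unit.Base using (⊤; tt)
open import Function.Base using (_∘_; id)
open import Function.Bundles using (Equivalence; mk⇔)
open import Function.Definitions using (Injective; StrictlySurjective)
open import Level using (0ℓ)
open import Relation.Binary.Construct.Closure.Equivalence as Eq using (EqClosure)
open import Relation.Binary.Construct.Closure.ReflexiveTransitive
  using (Star; ε; _◅_; _◅◅_; reverse)
open import Relation.Binary.Core using (Rel)
open import Relation.Binary.Definitions using (DecidableEquality; tri<; tri≈; tri>)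
open import Relation.Binary.PropositionalEquality hiding (resp; [_])
open import Relation.Nullary
open import Relation.Nullary.Decidable using (_×-dec_; _⊎-dec_; ¬?; dec-true; dec-false)
open import Relation.Unary using (Decidable)

-- The outer face may pass a cut vertex several times, and an isolated vertex has no dart at all. So
-- every vertex gets one stub, placed in a corner of the outer face, and first visits to the stubs
-- define the linear order. As for the numbers, let `c = 2 t − 1`. Only `n − 1 ≤ t ℓ + c h` and
-- `t h + 1 ≤ ℓ` decide which losses are possible. A further `h` becomes affordable after each `t`
-- units of loss, and together they buy `t · t + c = k² − 2 k − 1` vertices: this is the denominator
-- of λ. At the loss `t (q + 1) + 1` the new face comes in, so that this loss lasts for `3 t − 1`
-- values of `n` instead of `t`. There λ is one of `k (q + 1) − 1`, `k (q + 1)`, `k (q + 1) + 1`,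
-- and the case `k ∣ λ` of the formula makes all of them give the same loss.

Onto : {A : Set} {m : ℕ} → (A → Fin m) → Set
Onto = StrictlySurjective _≡_

-- Counting equivalence classes

module _ {m} {i j : Fin (suc m)} (i≢j : i ≢ j) where

  redirect : Fin (suc m) → Σ (Fin (suc m)) (i ≢_)
  redirect l with i Finₚ.≟ l
  ... | yes _  = j , i≢j
  ... | no i≢l = l , i≢l

  collapse : Fin (suc m) → Fin m
  collapse l = punchOut (proj₂ (redirect l))

  collapse-≡ : collapse i ≡ collapse j
  collapse-≡ with i Finₚ.≟ i | i Finₚ.≟ j
  ... | no i≢i | _ = contradiction refl i≢i
  ... | yes _  | yes i≡j = contradiction i≡j i≢j
  ... | yes _  | no _ = Finₚ.punchOut-cong i refl

  collapse-onto : Onto collapse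
  collapse-onto k = punchIn i k , helper
    where
    helper : collapse (punchIn i k) ≡ k
    helper with i Finₚ.≟ punchIn i k
    ... | yes eq = contradiction (sym eq) (Finₚ.punchInᵢ≢i i k)
    ... | no _ = trans (Finₚ.punchOut-cong i refl) (Finₚ.punchOut-punchIn i)

  collapse-ker : ∀ {l l′} → collapse l ≡ collapse l′ →
                 l ≡ l′ ⊎ (l ≡ i × l′ ≡ j) ⊎ (l ≡ j × l′ ≡ i)
  collapse-ker {l} {l′} eq with i Finₚ.≟ l | i Finₚ.≟ l′
  ... | yes refl | yes refl = inj₁ refl
  ... | yes refl | no i≢l′ = inj₂ (inj₁ (refl , sym (Finₚ.punchOut-injective i≢j i≢l′ eq)))
  ... | no i≢l | yes refl = inj₂ (inj₂ (Finₚ.punchOut-injective i≢l i≢j eq , refl))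
  ... | no i≢l | no i≢l′ = inj₁ (Finₚ.punchOut-injective i≢l i≢l′ eq)

onto⇒≤ : ∀ {m n} {f : Fin m → Fin n} → Onto f → n ≤ m
onto⇒≤ {f = f} onto = Finₚ.injective⇒≤ {f = λ k → proj₁ (onto k)}
  λ {k} {k′} eq → trans (sym (proj₂ (onto k))) (trans (cong f eq) (proj₂ (onto k′)))

collision : ∀ {m n} {f : Fin (suc m) → Fin n} → Onto f →
            ∀ {i j} → i ≢ j → f i ≡ f j → Onto (f ∘ punchIn i)
collision {f = f} onto {i} {j} i≢j fi≡fj k with onto k
... | l , fl≡k with i Finₚ.≟ l
...   | yes refl = punchOut i≢j , trans (cong f (Finₚ.punchIn-punchOut i≢j)) (trans (sym fi≡fj) fl≡k)
...   | no i≢l = punchOut i≢l , trans (cong f (Finₚ.punchIn-punchOut i≢l)) fl≡k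

module _ {B : Set} where

  -- `complete` makes `m` the exact number of classes of the equivalence generated by `R`; an onto
  -- invariant without it only bounds this number from below (`count-≤`).
  record Quot (R : Rel B 0ℓ) (m : ℕ) : Set where
    field
      cls      : B → Fin m
      onto     : Onto cls
      resp     : ∀ {d e} → R d e → cls d ≡ cls e
      complete : ∀ {d e} → cls d ≡ cls e → EqClosure R d e

  invariant : ∀ {R : Rel B 0ℓ} {A : Set} {g : B → A} → (∀ {d e} → R d e → g d ≡ g e) →
              ∀ {d e} → EqClosure R d e → g d ≡ g e
  invariant {g = g} r = Eq.gfold isEquivalence g r

  factor-onto : ∀ {R : Rel B 0ℓ} {m n} (Q : Quot R m) {g : B → Fin n} → Onto g →
                (∀ {d e} → R d e → g d ≡ g e) →
                Σ (Fin m → Fin n) λ f → Onto f × (∀ d → f (Quot.cls Q d) ≡ g d)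
  factor-onto Q {g} g-onto r = (λ i → g (proj₁ (onto i))) , f-onto , f-cls
    where
    open Quot Q
    f-cls : ∀ d → g (proj₁ (onto (cls d))) ≡ g d
    f-cls d = invariant r (complete (proj₂ (onto (cls d))))
    f-onto : Onto (λ i → g (proj₁ (onto i)))
    f-onto k = cls (proj₁ (g-onto k)) , trans (f-cls _) (proj₂ (g-onto k))

  count-≤ : ∀ {R : Rel B 0ℓ} {m n} → Quot R m → {g : B → Fin n} → Onto g →
            (∀ {d e} → R d e → g d ≡ g e) → n ≤ m
  count-≤ Q g-onto r = onto⇒≤ (proj₁ (proj₂ (factor-onto Q g-onto r)))

  mapQuot : ∀ {R R′ : Rel B 0ℓ} {m} → (∀ {d e} → R d e → R′ d e) →
            (∀ {d e} → R′ d e → R d e) → Quot R m → Quot R′ m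
  mapQuot to from Q = record
    { cls = cls ; onto = onto ; resp = resp ∘ from ; complete = Eq.map to ∘ complete }
    where open Quot Q

  addPair : ∀ {R : Rel B 0ℓ} {m} (x y : B) → Quot R m →
            ∃ (Quot (λ d e → (d ≡ x × e ≡ y) ⊎ R d e))
  addPair {R} {m} x y Q with Quot.cls Q x Finₚ.≟ Quot.cls Q y
  ... | yes eq = m , record
    { cls = cls ; onto = onto
    ; resp = λ { (inj₁ (refl , refl)) → eq ; (inj₂ r) → resp r }
    ; complete = Eq.map inj₂ ∘ complete }
    where open Quot Q
  addPair {R} {zero} x y Q | no _ with Quot.cls Q x
  ... | ()
  addPair {R} {suc m} x y Q | no x≢y = m , record
    { cls = collapse x≢y ∘ cls
    ; onto = λ k → let l , p = collapse-onto x≢y k ; d , q = onto l in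
                   d , trans (cong (collapse x≢y) q) p
    ; resp = λ { (inj₁ (refl , refl)) → collapse-≡ x≢y ; (inj₂ r) → cong (collapse x≢y) (resp r) }
    ; complete = λ eq → comp (collapse-ker x≢y eq) }
    where
    open Quot Q
    R′ : Rel B 0ℓ
    R′ d e = (d ≡ x × e ≡ y) ⊎ R d e
    lift′ : ∀ {d e} → cls d ≡ cls e → EqClosure R′ d e
    lift′ = Eq.map inj₂ ∘ complete
    xy : EqClosure R′ x y
    xy = Eq.return (inj₁ (refl , refl))
    comp : ∀ {d e} → cls d ≡ cls e ⊎ (cls d ≡ cls x × cls e ≡ cls y) ⊎ (cls d ≡ cls y × cls e ≡ cls x) →
           EqClosure R′ d e
    comp (inj₁ eq) = lift′ eq
    comp (inj₂ (inj₁ (p , q))) = Eq.transitive _ (lift′ p) (Eq.transitive _ xy (lift′ (sym q)))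
    comp (inj₂ (inj₂ (p , q))) = Eq.transitive _ (lift′ p) (Eq.transitive _ (Eq.symmetric _ xy) (lift′ (sym q)))

-- Permutations of pairs of vertices, and how gluing changes the number of orbits

module _ {n : ℕ} where
  private
    B : Set
    B = Fin n × Fin n

    enc : B → Fin (n * n)
    enc = uncurry combine

    dec : Fin (n * n) → B
    dec = remQuot n

    dec-enc : ∀ d → dec (enc d) ≡ d
    dec-enc (u , v) = Finₚ.remQuot-combine u v

    N = n * n

  enc-inj : ∀ {d e} → enc d ≡ enc e → d ≡ e
  enc-inj eq = trans (sym (dec-enc _)) (trans (cong dec eq) (dec-enc _))

  _≟ᵈ_ : DecidableEquality B
  _≟ᵈ_ = ≡-dec Finₚ._≟_ Finₚ._≟_

  iter : (B → B) → ℕ → B → B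
  iter ψ zero d = d
  iter ψ (suc j) d = ψ (iter ψ j d)

  iter-+ : ∀ ψ i j d → iter ψ (i + j) d ≡ iter ψ i (iter ψ j d)
  iter-+ ψ zero j d = refl
  iter-+ ψ (suc i) j d = cong ψ (iter-+ ψ i j d)

  iter-inj : ∀ {ψ} → Injective _≡_ _≡_ ψ → ∀ j {d e} → iter ψ j d ≡ iter ψ j e → d ≡ e
  iter-inj inj zero eq = eq
  iter-inj inj (suc j) eq = iter-inj inj j (inj eq)

  period : ∀ {ψ} → Injective _≡_ _≡_ ψ → ∀ d → ∃ λ p → iter ψ (suc p) d ≡ d
  period {ψ} inj d with Finₚ.pigeonhole (n<1+n N) (λ i → enc (iter ψ (toℕ i) d))
  ... | i , j , i<j , eq with m≤n⇒∃[o]m+o≡n i<j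
  ...   | p , eq′ = p , sym (iter-inj inj (toℕ i) (trans (enc-inj eq) (trans
          (cong (λ l → iter ψ l d) (trans (sym eq′) (sym (+-suc (toℕ i) p)))) (iter-+ ψ (toℕ i) (suc p) d))))

  Pairs : List (B × B) → Rel B 0ℓ
  Pairs ps d e = (d , e) ∈ ps

  -- Adding the pairs one at a time to the discrete partition counts the classes without a decision
  -- procedure for the generated equivalence.
  pairsQuot : ∀ ps → ∃ (Quot (Pairs ps))
  pairsQuot [] = N , record
    { cls = enc ; onto = λ i → dec i , Finₚ.combine-remQuot {n} n i ; resp = λ () 
    ; complete = λ eq → subst (EqClosure _ _) (enc-inj eq) (Eq.reflexive _) }
  pairsQuot ((x , y) ∷ ps) with addPair x y (proj₂ (pairsQuot ps))
  ... | m , Q = m , mapQuot to from Q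
    where
    to : ∀ {d e} → (d ≡ x × e ≡ y) ⊎ Pairs ps d e → Pairs ((x , y) ∷ ps) d e
    to (inj₁ (refl , refl)) = here refl
    to (inj₂ p) = there p
    from : ∀ {d e} → Pairs ((x , y) ∷ ps) d e → (d ≡ x × e ≡ y) ⊎ Pairs ps d e
    from (here refl) = inj₁ (refl , refl)
    from (there p) = inj₂ p

  -- `base` will tie each pair that is neither a dart nor a stub to the stub of its tail, so that
  -- such pairs form no classes of their own.
  Steps : (B → B) → (B → B) → Rel B 0ℓ
  Steps base ψ d e = base d ≡ e ⊎ ψ d ≡ e

  graphOf : (B → B) → List (B × B)
  graphOf f = map (λ i → dec i , f (dec i)) (allFin N)

  ∈-graph⁺ : ∀ {f d e} → f d ≡ e → (d , e) ∈ graphOf f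
  ∈-graph⁺ {f} {d} refl = subst (λ d → (d , f d) ∈ graphOf f) (dec-enc d) (∈-map⁺ _ (∈-allFin (enc d)))

  ∈-graph⁻ : ∀ {f d e} → (d , e) ∈ graphOf f → f d ≡ e
  ∈-graph⁻ p with ∈-map⁻ _ p
  ... | _ , _ , refl = refl

  stepsQuot : ∀ base ψ → ∃ (Quot (Steps base ψ))
  stepsQuot base ψ with pairsQuot (graphOf base ++ graphOf ψ)
  ... | m , Q = m , mapQuot ([ inj₁ ∘ ∈-graph⁻ , inj₂ ∘ ∈-graph⁻ ]′ ∘ ∈-++⁻ (graphOf base))
                            [ ∈-++⁺ˡ ∘ ∈-graph⁺ , ∈-++⁺ʳ (graphOf base) ∘ ∈-graph⁺ ]′ Q

  abstract
    swp : B → B → B → B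
    swp x y d with d ≟ᵈ x | d ≟ᵈ y
    ... | yes _ | _ = y
    ... | no _ | yes _ = x
    ... | no _ | no _ = d

    swp-x : ∀ x y → swp x y x ≡ y
    swp-x x y with x ≟ᵈ x
    ... | yes _ = refl
    ... | no x≢x = contradiction refl x≢x

    swp-y : ∀ x y → swp x y y ≡ x
    swp-y x y with y ≟ᵈ x | y ≟ᵈ y
    ... | yes y≡x | _ = y≡x
    ... | no _ | yes _ = refl
    ... | no _ | no y≢y = contradiction refl y≢y

    swp-≢ : ∀ {x y d} → d ≢ x → d ≢ y → swp x y d ≡ d
    swp-≢ {x} {y} {d} d≢x d≢y with d ≟ᵈ x | d ≟ᵈ y
    ... | yes eq | _ = contradiction eq d≢x
    ... | no _ | yes eq = contradiction eq d≢y
    ... | no _ | no _ = refl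

    swp-invol : ∀ x y d → swp x y (swp x y d) ≡ d
    swp-invol x y d with d ≟ᵈ x | d ≟ᵈ y
    ... | yes refl | _ = swp-y d y
    ... | no _ | yes refl = swp-x x d
    ... | no d≢x | no d≢y = swp-≢ d≢x d≢y

    swp-inj : ∀ x y → Injective _≡_ _≡_ (swp x y)
    swp-inj x y eq = trans (sym (swp-invol x y _)) (trans (cong (swp x y) eq) (swp-invol x y _))

    swp-cls : ∀ {A : Set} (g : B → A) {x y} → g x ≡ g y → ∀ d → g (swp x y d) ≡ g d
    swp-cls g {x} {y} eq d with d ≟ᵈ x | d ≟ᵈ y
    ... | yes refl | _ = sym eq
    ... | no _ | yes refl = eq
    ... | no _ | no _ = refl

  module _ {base ψ : B → B} (ψ-inj : Injective _≡_ _≡_ ψ) (x y : B) {z z′ : ℕ}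
           (Q : Quot (Steps base ψ) z) (Q′ : Quot (Steps base (ψ ∘ swp x y)) z′) where
    private
      module Q = Quot Q
      module Q′ = Quot Q′

    -- The swap is an involution, and a labelling that agrees on `x` and `y` does not see it; so
    -- invariance under `ψ ∘ swp x y` carries over to `ψ`.
    coarser : ∀ {A : Set} (g : B → A) → g x ≡ g y → (∀ d → g (base d) ≡ g d) →
              (∀ d → g (ψ (swp x y d)) ≡ g d) → ∀ {d e} → Steps base ψ d e → g d ≡ g e
    coarser g xy b s (inj₁ refl) = sym (b _)
    coarser g xy b s {d} (inj₂ refl) = trans (sym (swp-cls g xy d))
      (trans (sym (s (swp x y d))) (cong (g ∘ ψ) (swp-invol x y d)))

    -- Identifying the classes of `x` and `y` costs at most one class and leaves a labelling to
    -- which `coarser` applies.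
    swap-≤ : z′ ≤ suc z
    swap-≤ with Q′.cls x Finₚ.≟ Q′.cls y
    ... | yes eq = m≤n⇒m≤1+n (count-≤ Q Q′.onto
                     (coarser Q′.cls eq (λ d → sym (Q′.resp (inj₁ refl))) (λ d → sym (Q′.resp (inj₂ refl)))))
    swap-≤ | no x≢y = lem Q′ x≢y
      where
      lem : ∀ {z′} (Q′ : Quot (Steps base (ψ ∘ swp x y)) z′) → Quot.cls Q′ x ≢ Quot.cls Q′ y → z′ ≤ suc z
      lem {zero} Q′ _ = z≤n
      lem {suc z′} Q′ x≢y = s≤s (count-≤ Q {g = collapse x≢y ∘ cls}
        (λ k → let l , p = collapse-onto x≢y k ; d , q = onto l in d , trans (cong (collapse x≢y) q) p)
        (coarser (collapse x≢y ∘ cls) (collapse-≡ x≢y) (λ d → cong (collapse x≢y) (sym (resp (inj₁ refl))))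
                 (λ d → cong (collapse x≢y) (sym (resp (inj₂ refl))))))
        where open Quot Q′

    module _ {A : Set} (κ : B → A) (κ-ψ : ∀ d → κ (ψ d) ≡ κ d) (κ-base : ∀ d → κ (base d) ≡ κ d) (κ≢ : κ x ≢ κ y) where

      -- As `κ` separates `x` from `y`, the new orbit of `y` runs through the whole old orbit of
      -- `x`: it enters at `ψ x`, does not meet `y` on the way, and after one period arrives at `x`.
      swap-joins : Q′.cls x ≡ Q′.cls y
      swap-joins with period ψ-inj x
      ... | p , eq = [ id , (λ q → trans (cong Q′.cls (sym eq)) q) ]′ (walk p)
        where
        κ-iter : ∀ j → κ (iter ψ j x) ≡ κ x
        κ-iter zero = refl
        κ-iter (suc j) = trans (κ-ψ _) (κ-iter j)
        walk : ∀ j → Q′.cls x ≡ Q′.cls y ⊎ Q′.cls (iter ψ (suc j) x) ≡ Q′.cls y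
        walk zero = inj₂ (trans (cong (Q′.cls ∘ ψ) (sym (swp-y x y))) (sym (Q′.resp (inj₂ refl))))
        walk (suc j) with walk j
        ... | inj₁ q = inj₁ q
        ... | inj₂ q with iter ψ (suc j) x ≟ᵈ x
        ...   | yes r = inj₁ (trans (cong Q′.cls (sym r)) q)
        ...   | no r = inj₂ (trans (cong (Q′.cls ∘ ψ) (sym (swp-≢ r r′))) (trans (sym (Q′.resp (inj₂ refl))) q))
          where
          r′ : iter ψ (suc j) x ≢ y
          r′ s = κ≢ (trans (sym (κ-iter (suc j))) (cong κ s))

      swap-< : suc z′ ≤ z
      swap-< = lem Q (λ eq → κ≢ (invariant (λ { (inj₁ refl) → sym (κ-base _) ; (inj₂ refl) → sym (κ-ψ _) }) (Q.complete eq)))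
        where
        lem : ∀ {z} (Q : Quot (Steps base ψ) z) → Quot.cls Q x ≢ Quot.cls Q y → suc z′ ≤ z
        lem {zero} Q _ with Quot.cls Q x
        ... | ()
        lem {suc z} Q x≢y = s≤s (let f , f-onto , f-cls = factor-onto Q Q′.onto
                                       (coarser Q′.cls swap-joins (λ d → sym (Q′.resp (inj₁ refl))) (λ d → sym (Q′.resp (inj₂ refl))))
                                 in onto⇒≤ (collision f-onto x≢y (trans (f-cls x) (trans swap-joins (sym (f-cls y))))))

  glue : (B → B) → List (B × B) → B → B
  glue ψ [] = ψ
  glue ψ ((x , y) ∷ l) = glue (ψ ∘ swp x y) l

  -- An invariant labelling rather than the orbits themselves, as one component is to contain many
  -- orbits of `ψ`. `gluing` keeps it invariant by merging two labels whenever it joins two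
  -- components.
  record Components (base ψ : B → B) (c : ℕ) : Set where
    field
      comp      : B → Fin c
      comp-onto : Onto comp
      comp-base : ∀ d → comp (base d) ≡ comp d
      comp-ψ    : ∀ d → comp (ψ d) ≡ comp d

  mergeComponents : ∀ {base ψ c} (K : Components base ψ (suc c)) x y →
    Components.comp K x ≢ Components.comp K y → Components base (ψ ∘ swp x y) c
  mergeComponents {base} {ψ} K x y x≢y = record
    { comp = collapse x≢y ∘ comp
    ; comp-onto = λ k → let l , p = collapse-onto x≢y k ; d , q = comp-onto l in d , trans (cong (collapse x≢y) q) p
    ; comp-base = λ d → cong (collapse x≢y) (comp-base d)
    ; comp-ψ = λ d → trans (cong (collapse x≢y) (comp-ψ _)) (swp-cls (collapse x≢y ∘ comp) (collapse-≡ x≢y) d) }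
    where open Components K

  record Glued {base ψ c} (z : ℕ) (K : Components base ψ c) (l : List (B × B)) : Set where
    field
      {c′} : ℕ
      K′ : Components base (glue ψ l) c′
    open Components K
    open Components K′ renaming (comp to comp′)
    field
      coarse : ∀ {d e} → comp d ≡ comp e → comp′ d ≡ comp′ e
      genus  : ∀ {z′} → Quot (Steps base (glue ψ l)) z′ → z′ + 2 * c ≤ z + 2 * c′ + length l

  -- Gluing two darts of one component splits at most one orbit, gluing two
  -- components joins two orbits: hence z − 2c − (number of gluings) cannot increase.
  gluing : ∀ {base ψ c z} → Injective _≡_ _≡_ ψ → Quot (Steps base ψ) z →
           (K : Components base ψ c) → ∀ l → Glued z K l
  gluing {base} {ψ} {c} {z} ψ-inj Q K [] = record
    { K′ = K ; coarse = id
    ; genus = λ Q′ → ≤-trans (+-monoˡ-≤ (2 * c) (count-≤ Q (Quot.onto Q′) (Quot.resp Q′))) (≤-reflexive (sym (+-identityʳ _))) }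
  gluing {base} {ψ} {c} {z} ψ-inj Q K ((x , y) ∷ l) with Components.comp K x Finₚ.≟ Components.comp K y
  ... | yes eq = record
    { K′ = G.K′ ; coarse = G.coarse
    ; genus = λ {z′} Q′ → ≤-trans (G.genus Q′) (begin
        z₁ + 2 * G.c′ + length l ≤⟨ +-monoˡ-≤ _ (+-monoˡ-≤ _ (swap-≤ ψ-inj x y Q (proj₂ q))) ⟩
        suc z + 2 * G.c′ + length l ≡⟨ arith z (2 * G.c′) (length l) ⟩
        z + 2 * G.c′ + suc (length l) ∎) }
    where
    open ≤-Reasoning
    open Components K
    q = stepsQuot base (ψ ∘ swp x y)
    z₁ = proj₁ q
    K₁ : Components base (ψ ∘ swp x y) c
    K₁ = record { comp = comp ; comp-onto = comp-onto ; comp-base = comp-base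
                ; comp-ψ = λ d → trans (comp-ψ _) (swp-cls comp eq d) }
    module G = Glued (gluing (swp-inj x y ∘ ψ-inj) (proj₂ q) K₁ l)
    arith : ∀ a b c → suc a + b + c ≡ a + b + suc c
    arith = solve-∀
  gluing {base} {ψ} {zero} ψ-inj Q K ((x , y) ∷ l) | no _ with Components.comp K x
  ... | ()
  gluing {base} {ψ} {suc c} {z} ψ-inj Q K ((x , y) ∷ l) | no x≢y = record
    { K′ = G.K′ ; coarse = G.coarse ∘ cong (collapse x≢y)
    ; genus = λ {z′} Q′ → begin
        z′ + 2 * suc c              ≡⟨ arith z′ c ⟩
        2 + (z′ + 2 * c)            ≤⟨ +-monoʳ-≤ 2 (G.genus Q′) ⟩
        2 + (z₁ + 2 * G.c′ + length l) ≡⟨ arith′ z₁ (2 * G.c′) (length l) ⟩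
        suc z₁ + 2 * G.c′ + suc (length l) ≤⟨ +-monoˡ-≤ _ (+-monoˡ-≤ _ (swap-< ψ-inj x y Q (proj₂ q) comp comp-ψ comp-base x≢y)) ⟩
        z + 2 * G.c′ + suc (length l) ∎ }
    where
    open ≤-Reasoning
    open Components K
    q = stepsQuot base (ψ ∘ swp x y)
    z₁ = proj₁ q
    module G = Glued (gluing (swp-inj x y ∘ ψ-inj) (proj₂ q) (mergeComponents K x y x≢y) l)
    arith : ∀ a b → a + 2 * suc b ≡ 2 + (a + 2 * b)
    arith = solve-∀
    arith′ : ∀ a b c → 2 + (a + b + c) ≡ suc a + b + suc c
    arith′ = solve-∀

-- Orbits of permutations

least : ∀ {P : ℕ → Set} → Decidable P → ∀ L →
        (∃ λ j → P j × (∀ {i} → i < j → ¬ P i)) ⊎ (∀ {j} → j < L → ¬ P j)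
least P? zero = inj₂ λ ()
least P? (suc L) with least P? L
... | inj₁ found = inj₁ found
... | inj₂ none with P? L
...   | yes p = inj₁ (L , p , none)
...   | no ¬p = inj₂ λ j<1+L → [ none , (λ { refl → ¬p }) ]′ (m<1+n⇒m<n∨m≡n j<1+L)

module _ {n : ℕ} where
  private
    B : Set
    B = Fin n × Fin n

  Reaches : (B → B) → B → B → Set
  Reaches ψ d e = ∃ λ j → iter ψ j d ≡ e

  reach-trans : ∀ {ψ d e f} → Reaches ψ d e → Reaches ψ e f → Reaches ψ d f
  reach-trans {ψ} {d} (i , p) (j , q) = j + i , trans (iter-+ ψ j i d) (trans (cong (iter ψ j) p) q)

  -- On a finite set a step of an injective map is undone by going on around the orbit.
  reach-sym : ∀ {ψ} → Injective _≡_ _≡_ ψ → ∀ {d e} → Reaches ψ d e → Reaches ψ e d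
  reach-sym {ψ} inj {d} (zero , refl) = 0 , refl
  reach-sym {ψ} inj {d} (suc j , refl) = reach-trans back (reach-sym inj (j , refl))
    where
    back : Reaches ψ (iter ψ (suc j) d) (iter ψ j d)
    back with period inj (iter ψ j d)
    ... | p , eq = p , trans (sym (iter-+ ψ p 1 (iter ψ j d)))
                       (trans (cong (λ i → iter ψ i (iter ψ j d)) (+-comm p 1)) eq)

  module FirstVisit {Φ : B → B} (Φ-inj : Injective _≡_ _≡_ Φ) (o : B) where

    -- The first visit gives each point of a cyclic orbit a unique time, which turns cyclic order
    -- into the order of numbers.
    At : B → ℕ → Set
    At d j = iter Φ j o ≡ d × (∀ {i} → i < j → iter Φ i o ≢ d)

    At-unique : ∀ {d i j} → At d i → At d j → i ≡ j
    At-unique {i = i} {j} (p , least-i) (q , least-j) =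
      ≤-antisym (≮⇒≥ λ j<i → least-i j<i q) (≮⇒≥ λ i<j → least-j i<j p)

    locate : ∀ d → ∃ (At d) ⊎ ¬ Reaches Φ o d
    locate d with least (λ j → iter Φ j o ≟ᵈ d) (suc (proj₁ (period Φ-inj o)))
    ... | inj₁ found = inj₁ found
    ... | inj₂ none = inj₂ λ { (j , eq) → never j eq }
      where
      p = proj₁ (period Φ-inj o)
      reduce : ∀ j → ∃ λ i → i < suc p × iter Φ i o ≡ iter Φ j o
      reduce zero = 0 , z<s , refl
      reduce (suc j) with reduce j
      ... | i , i<1+p , eq with m<1+n⇒m<n∨m≡n i<1+p
      ...   | inj₁ i<p = suc i , s<s i<p , cong Φ eq
      ...   | inj₂ refl = 0 , z<s , trans (sym (proj₂ (period Φ-inj o))) (cong Φ eq)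
      never : ∀ j → iter Φ j o ≢ d
      never j eq with reduce j
      ... | i , i<1+p , eq′ = none i<1+p (trans eq′ eq)

    reached : ∀ {d} → Reaches Φ o d → ∃ (At d)
    reached {d} r with locate d
    ... | inj₁ found = found
    ... | inj₂ none = contradiction r none

    At-next : ∀ {d j} → At d j → Φ d ≡ o ⊎ At (Φ d) (suc j)
    At-next {d} {j} (p , first) with Φ d ≟ᵈ o
    ... | yes eq = inj₁ eq
    ... | no neq = inj₂ (cong Φ p , λ { {zero} _ eq → neq (sym eq)
                                      ; {suc i} 1+i<1+j eq → first (≤-pred 1+i<1+j) (Φ-inj eq) })

  -- `ρ` throws each of the four marked points back to the cyclically preceding one, so the orbit of
  -- `a` falls into four closed arcs. The first arc keeps its label and the others get three new
  -- ones. By `dich` the pairs that `base` moves are fixed by `Φ` and do not interfere.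
  module Split {base Φ ρ : B → B} (Φ-inj : Injective _≡_ _≡_ Φ)
    (base-idem : ∀ d → base (base d) ≡ base d)
    (dich : ∀ d → (base d ≡ d × base (Φ d) ≡ Φ d) ⊎ (Φ d ≡ d × base d ≢ d))
    {m : ℕ} (g : B → Fin m) (g-onto : Onto g) (g-base : ∀ d → g (base d) ≡ g d) (g-Φ : ∀ d → g (Φ d) ≡ g d)
    {a b c d : B} (base-a : base a ≡ a)
    {i₁ i₂ i₃ : ℕ} (0<i₁ : 0 < i₁) (i₁<i₂ : i₁ < i₂) (i₂<i₃ : i₂ < i₃)
    (at-b : FirstVisit.At Φ-inj a b i₁) (at-c : FirstVisit.At Φ-inj a c i₂) (at-d : FirstVisit.At Φ-inj a d i₃)
    (ρ-a : ρ a ≡ d) (ρ-b : ρ b ≡ a) (ρ-c : ρ c ≡ b) (ρ-d : ρ d ≡ c)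
    (ρ-other : ∀ {e} → e ≢ a → e ≢ b → e ≢ c → e ≢ d → ρ e ≡ e)
    where

    open FirstVisit Φ-inj a

    at-a : At a 0
    at-a = refl , λ ()

    base-iter : ∀ j → base (iter Φ j a) ≡ iter Φ j a
    base-iter zero = base-a
    base-iter (suc j) with dich (iter Φ j a)
    ... | inj₁ (_ , eq) = eq
    ... | inj₂ (_ , neq) = contradiction (base-iter j) neq

    At-base : ∀ {e j} → At e j → base e ≡ e
    At-base {j = j} (refl , _) = base-iter j

    arc : ℕ → Fin (m + 3)
    arc j with j <? i₁ | j <? i₂ | j <? i₃
    ... | yes _ | _ | _ = g a ↑ˡ 3
    ... | no _ | yes _ | _ = m ↑ʳ zero
    ... | no _ | no _ | yes _ = m ↑ʳ 1F
    ... | no _ | no _ | no _ = m ↑ʳ 2F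

    arc₀ : ∀ {j} → j < i₁ → arc j ≡ g a ↑ˡ 3
    arc₀ {j} p with j <? i₁ | j <? i₂ | j <? i₃
    ... | yes _ | _ | _ = refl
    ... | no ¬p | _ | _ = contradiction p ¬p
    arc₁ : ∀ {j} → i₁ ≤ j → j < i₂ → arc j ≡ m ↑ʳ zero
    arc₁ {j} q p with j <? i₁ | j <? i₂ | j <? i₃
    ... | yes q′ | _ | _ = contradiction q (<⇒≱ q′)
    ... | no _ | yes _ | _ = refl
    ... | no _ | no ¬p | _ = contradiction p ¬p
    arc₂ : ∀ {j} → i₂ ≤ j → j < i₃ → arc j ≡ m ↑ʳ 1F
    arc₂ {j} q p with j <? i₁ | j <? i₂ | j <? i₃
    ... | yes q′ | _ | _ = contradiction (<⇒≤ (<-≤-trans i₁<i₂ q)) (<⇒≱ q′)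
    ... | no _ | yes q′ | _ = contradiction q (<⇒≱ q′)
    ... | no _ | no _ | yes _ = refl
    ... | no _ | no _ | no ¬p = contradiction p ¬p
    arc₃ : ∀ {j} → i₃ ≤ j → arc j ≡ m ↑ʳ 2F
    arc₃ {j} q with j <? i₁ | j <? i₂ | j <? i₃
    ... | yes q′ | _ | _ = contradiction (<⇒≤ (<-trans i₁<i₂ (<-≤-trans i₂<i₃ q))) (<⇒≱ q′)
    ... | no _ | yes q′ | _ = contradiction (<⇒≤ (<-≤-trans i₂<i₃ q)) (<⇒≱ q′)
    ... | no _ | no _ | yes q′ = contradiction q (<⇒≱ q′)
    ... | no _ | no _ | no _ = refl

    arc-suc : ∀ {j} → suc j ≢ i₁ → suc j ≢ i₂ → suc j ≢ i₃ → arc (suc j) ≡ arc j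
    arc-suc {j} n₁ n₂ n₃ with suc j <? i₁ | suc j <? i₂ | suc j <? i₃
    ... | yes p | _ | _ = sym (arc₀ (<-trans (n<1+n j) p))
    ... | no p | yes q | _ = sym (arc₁ (≤-pred (≤∧≢⇒< (≮⇒≥ p) (n₁ ∘ sym))) (<-trans (n<1+n j) q))
    ... | no p | no q | yes r = sym (arc₂ (≤-pred (≤∧≢⇒< (≮⇒≥ q) (n₂ ∘ sym))) (<-trans (n<1+n j) r))
    ... | no p | no q | no r = sym (arc₃ (≤-pred (≤∧≢⇒< (≮⇒≥ r) (n₃ ∘ sym))))

    ĝ : B → Fin (m + 3)
    ĝ e with locate e
    ... | inj₁ (j , _) = arc j
    ... | inj₂ _ = g e ↑ˡ 3

    ĝ-at : ∀ {e j} → At e j → ĝ e ≡ arc j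
    ĝ-at {e} {j} at with locate e
    ... | inj₁ (_ , at′) = cong arc (At-unique at′ at)
    ... | inj₂ none = contradiction (j , proj₁ at) none

    ĝ-out : ∀ {e} → ¬ Reaches Φ a e → ĝ e ≡ g e ↑ˡ 3
    ĝ-out {e} none with locate e
    ... | inj₁ (j , at) = contradiction (j , proj₁ at) none
    ... | inj₂ _ = refl

    ĝ-ρΦ : ∀ e → ĝ (ρ (Φ e)) ≡ ĝ e
    ĝ-ρΦ e with locate e
    ... | inj₂ none = trans (cong ĝ (ρ-other
            (λ eq → out (0 , sym eq)) (λ eq → out (i₁ , trans (proj₁ at-b) (sym eq)))
            (λ eq → out (i₂ , trans (proj₁ at-c) (sym eq))) (λ eq → out (i₃ , trans (proj₁ at-d) (sym eq)))))
            (trans (ĝ-out out) (cong (_↑ˡ 3) (g-Φ e)))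
      where
      out : ¬ Reaches Φ a (Φ e)
      out r = none (reach-trans r (reach-sym Φ-inj (1 , refl)))
    ... | inj₁ (j , at) with At-next at
    ...   | inj₁ eq = trans (cong ĝ (trans (cong ρ eq) ρ-a)) (trans (ĝ-at at-d) (trans (arc₃ ≤-refl) (sym (arc₃ late))))
      where
      late : i₃ ≤ j
      -- If the orbit closed at time `suc j ≤ i₃`, then `d` would be visited already at time
      -- `i₃ ∸ suc j`.
      late = ≮⇒≥ λ j<i₃ → let o , eq′ = m≤n⇒∃[o]m+o≡n j<i₃ in
        proj₂ at-d {o} (subst (o <_) eq′ (m<n+m o z<s))
          (trans (cong (iter Φ o) (sym (trans (cong Φ (proj₁ at)) eq)))
          (trans (sym (iter-+ Φ o (suc j) a)) (trans (cong (λ i → iter Φ i a) (trans (+-comm o (suc j)) eq′)) (proj₁ at-d))))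
    ...   | inj₂ at′ with suc j ℕₚ.≟ i₁ | suc j ℕₚ.≟ i₂ | suc j ℕₚ.≟ i₃
    ...     | yes refl | _ | _ = trans (cong ĝ (trans (cong ρ (trans (sym (proj₁ at′)) (proj₁ at-b))) ρ-b))
                                 (trans (ĝ-at at-a) (trans (arc₀ 0<i₁) (sym (arc₀ ≤-refl))))
    ...     | no _ | yes refl | _ = trans (cong ĝ (trans (cong ρ (trans (sym (proj₁ at′)) (proj₁ at-c))) ρ-c))
                                 (trans (ĝ-at at-b) (trans (arc₁ ≤-refl i₁<i₂) (sym (arc₁ (≤-pred i₁<i₂) ≤-refl))))
    ...     | no _ | no _ | yes refl = trans (cong ĝ (trans (cong ρ (trans (sym (proj₁ at′)) (proj₁ at-d))) ρ-d))
                                 (trans (ĝ-at at-c) (trans (arc₂ ≤-refl i₂<i₃) (sym (arc₂ (≤-pred i₂<i₃) ≤-refl))))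
    ...     | no n₁ | no n₂ | no n₃ = trans (cong ĝ (ρ-other
                (λ eq → 0≢1+n (At-unique (subst (λ e → At e 0) (sym eq) at-a) at′))
                (λ eq → n₁ (At-unique at′ (subst (λ e → At e i₁) (sym eq) at-b)))
                (λ eq → n₂ (At-unique at′ (subst (λ e → At e i₂) (sym eq) at-c)))
                (λ eq → n₃ (At-unique at′ (subst (λ e → At e i₃) (sym eq) at-d)))))
              (trans (ĝ-at at′) (arc-suc n₁ n₂ n₃))

    ρ-fix : ∀ {e} → base e ≢ e → ρ e ≡ e
    ρ-fix neq = ρ-other (λ { refl → neq base-a }) (λ { refl → neq (At-base at-b) })
                        (λ { refl → neq (At-base at-c) }) (λ { refl → neq (At-base at-d) })

    base-ρ : ∀ {e} → base e ≡ e → base (ρ e) ≡ ρ e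
    base-ρ {e} eq with e ≟ᵈ a | e ≟ᵈ b | e ≟ᵈ c | e ≟ᵈ d
    ... | yes refl | _ | _ | _ = subst (λ e → base e ≡ e) (sym ρ-a) (At-base at-d)
    ... | no _ | yes refl | _ | _ = subst (λ e → base e ≡ e) (sym ρ-b) base-a
    ... | no _ | no _ | yes refl | _ = subst (λ e → base e ≡ e) (sym ρ-c) (At-base at-b)
    ... | no _ | no _ | no _ | yes refl = subst (λ e → base e ≡ e) (sym ρ-d) (At-base at-c)
    ... | no p | no q | no r | no s = subst (λ e → base e ≡ e) (sym (ρ-other p q r s)) eq

    split-g : B → Fin (m + 3)
    split-g = ĝ ∘ base

    split-base : ∀ e → split-g (base e) ≡ split-g e
    split-base e = cong ĝ (base-idem e)

    split-ρΦ : ∀ e → split-g (ρ (Φ e)) ≡ split-g e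
    split-ρΦ e with dich e
    ... | inj₁ (p , q) = trans (cong ĝ (base-ρ q)) (trans (ĝ-ρΦ e) (cong ĝ (sym p)))
    ... | inj₂ (p , q) = cong split-g (trans (cong ρ p) (ρ-fix q))

    split-at : ∀ {e j} → At e j → split-g e ≡ arc j
    split-at at = trans (cong ĝ (At-base at)) (ĝ-at at)

    split-onto : Onto split-g
    split-onto k with splitAt m k in eq
    ... | inj₂ zero = b , trans (split-at at-b) (trans (arc₁ ≤-refl i₁<i₂) (Finₚ.splitAt⁻¹-↑ʳ eq))
    ... | inj₂ 1F = c , trans (split-at at-c) (trans (arc₂ ≤-refl i₂<i₃) (Finₚ.splitAt⁻¹-↑ʳ eq))
    ... | inj₂ 2F = d , trans (split-at at-d) (trans (arc₃ ≤-refl) (Finₚ.splitAt⁻¹-↑ʳ eq))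
    ... | inj₁ i with g a Finₚ.≟ i
    ...   | yes refl = a , trans (split-at at-a) (trans (arc₀ 0<i₁) (Finₚ.splitAt⁻¹-↑ˡ eq))
    ...   | no neq with g-onto i
    ...     | e , refl = e , trans (ĝ-out out) (trans (cong (_↑ˡ 3) (g-base e)) (Finₚ.splitAt⁻¹-↑ˡ eq))
      where
      g-iter : ∀ j → g (iter Φ j a) ≡ g a
      g-iter zero = refl
      g-iter (suc j) = trans (g-Φ _) (g-iter j)
      out : ¬ Reaches Φ a (base e)
      out (j , eq′) = neq (trans (sym (g-iter j)) (trans (cong g eq′) (g-base e)))

    split : Σ (B → Fin (m + 3)) λ g′ → Onto g′ × (∀ e → g′ (base e) ≡ g′ e) × (∀ e → g′ (ρ (Φ e)) ≡ g′ e)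
    split = split-g , split-onto , split-base , split-ρΦ

  -- Here `x i` is the stub of the `i`-th of four vertices, `p i` its dart of one of two edges, `op`
  -- exchanges the ends of an edge and `pr` is the action of `ρ`. From `x i` the map `ψ` runs to
  -- `p i`, crosses the edge, continues behind `p (op i)` up to the stub there and is thrown to
  -- `x (pr (op i))`. For crossing edges `i ↦ pr (op i)` is a 4-cycle, whence `pr-op`: all four
  -- vertices end up in one class.
  module Join {σ ρ : B → B} (σ-inj : Injective _≡_ _≡_ σ)
    {V : Set} (tail : B → V) (tail-σ : ∀ d → tail (σ d) ≡ tail d)
    (x p : Fin 4 → B) (pr op : Fin 4 → Fin 4)
    (pr-op : ∀ {A : Set} (C : Fin 4 → A) → (∀ i → C i ≡ C (pr (op i))) → ∀ i j → C i ≡ C j)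
    (tails : ∀ i → tail (x i) ≡ tail (p i)) (tails-inj : ∀ {i j} → tail (p i) ≡ tail (p j) → i ≡ j)
    (x≢p : ∀ i → x i ≢ p i)
    (reach : ∀ i → Reaches σ (x i) (p i))
    (ρ-x : ∀ i → ρ (x i) ≡ x (pr i)) (ρ-other : ∀ {e} → (∀ i → e ≢ x i) → ρ e ≡ e)
    {ψ : B → B} (ψ-p : ∀ i → ψ (p i) ≡ ρ (σ (p (op i)))) (ψ-other : ∀ {e} → (∀ i → e ≢ p i) → ψ e ≡ ρ (σ e))
    {A : Set} (C : B → A) (C-ψ : ∀ e → C (ψ e) ≡ C e)
    where

    tail-iter : ∀ j d → tail (iter σ j d) ≡ tail d
    tail-iter zero d = refl
    tail-iter (suc j) d = trans (tail-σ _) (tail-iter j d)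

    only-p : ∀ {i e} → tail e ≡ tail (p i) → e ≢ p i → ∀ k → e ≢ p k
    only-p t neq k refl with tails-inj t
    ... | refl = neq refl

    only-x : ∀ {i e} → tail e ≡ tail (p i) → e ≢ x i → ∀ k → e ≢ x k
    only-x t neq k refl with tails-inj (trans (sym (tails k)) t)
    ... | refl = neq refl

    step : ∀ {i e} → tail e ≡ tail (p i) → e ≢ p i → σ e ≢ x i → C (σ e) ≡ C e
    step {i} {e} t e≢p σe≢x = trans (cong C (sym (trans (ψ-other (only-p t e≢p)) (ρ-other (only-x (trans (tail-σ e) t) σe≢x))))) (C-ψ e)

    C-xp : ∀ i → C (p i) ≡ C (x i)
    C-xp i = let j , eq = reach i in [ id , (λ q → trans (cong C (sym eq)) q) ]′ (walk j)
      where
      walk : ∀ j → C (p i) ≡ C (x i) ⊎ C (iter σ j (x i)) ≡ C (x i)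
      walk zero = inj₂ refl
      walk (suc j) with walk j
      ... | inj₁ q = inj₁ q
      ... | inj₂ q with iter σ j (x i) ≟ᵈ p i | iter σ (suc j) (x i) ≟ᵈ x i
      ...   | yes r | _ = inj₁ (trans (cong C (sym r)) q)
      ...   | no _ | yes r = inj₂ (cong C r)
      ...   | no r | no s = inj₂ (trans (step (trans (tail-iter j (x i)) (tails i)) r s) q)

    C-ρσp : ∀ i → C (ρ (σ (p i))) ≡ C (x (pr i))
    C-ρσp i with σ (p i) ≟ᵈ x i
    ... | yes q = cong C (trans (cong ρ q) (ρ-x i))
    ... | no q = final (reach-sym σ-inj (reach i))
      where
      fix : ρ (σ (p i)) ≡ σ (p i)
      fix = ρ-other (only-x (tail-σ (p i)) q)
      walk : ∀ j → C (ρ (σ (p i))) ≡ C (x (pr i)) ⊎ (iter σ (suc j) (p i) ≢ x i × C (iter σ (suc j) (p i)) ≡ C (ρ (σ (p i))))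
      walk zero = inj₂ (q , cong C (sym fix))
      walk (suc j) with walk j
      ... | inj₁ r = inj₁ r
      ... | inj₂ (r , r′) with iter σ (suc j) (p i) ≟ᵈ p i | iter σ (suc (suc j)) (p i) ≟ᵈ x i
      ...   | yes s | _ = inj₂ ((λ u → q (trans (cong σ (sym s)) u)) , trans (cong (C ∘ σ) s) (cong C (sym fix)))
      ...   | no s | yes u = inj₁ (trans (sym r′) (trans (sym (C-ψ _))
                (cong C (trans (ψ-other (only-p (tail-iter (suc j) (p i)) s)) (trans (cong ρ u) (ρ-x i))))))
      ...   | no s | no u = inj₂ (u , trans (step (tail-iter (suc j) (p i)) s u) r′)
      final : Reaches σ (p i) (x i) → C (ρ (σ (p i))) ≡ C (x (pr i))
      final (zero , eq) = contradiction (sym eq) (x≢p i)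
      final (suc j , eq) = [ id , (λ { (r , _) → contradiction eq r }) ]′ (walk j)

    C-x : ∀ i j → C (x i) ≡ C (x j)
    C-x = pr-op (C ∘ x) λ i → trans (sym (C-xp i)) (trans (sym (C-ψ (p i))) (trans (cong C (ψ-p i)) (C-ρσp (op i))))

    C-ρ : ∀ e → C (ρ e) ≡ C e
    C-ρ e with Finₚ.any? (λ i → e ≟ᵈ x i)
    ... | yes (i , refl) = trans (cong C (ρ-x i)) (C-x (pr i) i)
    ... | no none = cong C (ρ-other λ i eq → none (i , eq))

    C-σ : ∀ e → C (σ e) ≡ C e
    C-σ e with Finₚ.any? (λ i → e ≟ᵈ p i)
    ... | yes (i , refl) = trans (sym (C-ρ (σ (p i)))) (trans (C-ρσp i) (trans (C-x (pr i) i) (sym (C-xp i))))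
    ... | no none = trans (sym (C-ρ (σ e))) (trans (cong C (sym (ψ-other λ i eq → none (i , eq)))) (C-ψ e))

    join : (∀ i j → C (x i) ≡ C (x j)) × (∀ e → C (σ e) ≡ C e)
    join = C-x , C-σ

-- Outerplanar embeddings are noncrossing

onto⇒injective : ∀ {n} {f : Fin n → Fin n} → Onto f → Injective _≡_ _≡_ f
onto⇒injective {zero} onto {()}
onto⇒injective {suc n} onto {i} {j} eq with i Finₚ.≟ j
... | yes i≡j = i≡j
... | no i≢j = contradiction (onto⇒≤ (collision onto i≢j eq)) (<⇒≱ (n<1+n n))

lookup-injective : ∀ {A : Set} {xs : List A} → Unique xs → ∀ {i j} → lookup xs i ≡ lookup xs j → i ≡ j
lookup-injective (_ ∷ _) {zero} {zero} _ = refl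
lookup-injective (x∉ ∷ _) {zero} {suc j} eq = contradiction eq (All.lookup x∉ (∈-lookup j))
lookup-injective (x∉ ∷ _) {suc i} {zero} eq = contradiction (sym eq) (All.lookup x∉ (∈-lookup i))
lookup-injective (_ ∷ u) {suc i} {suc j} eq = cong suc (lookup-injective u eq)

extract : ∀ {A : Set} {x : A} {xs} → x ∈ xs → ∃ λ ys → xs ↭ x ∷ ys
extract x∈ with ∈-∃++ x∈
... | ys , zs , refl = ys ++ zs , shift _ ys zs

Unique-resp-↭ : ∀ {A : Set} {xs ys : List A} → xs ↭ ys → Unique xs → Unique ys
Unique-resp-↭ p = PermS.Unique-resp-↭ (setoid _) (↭⇒↭ₛ p)

edgeList : ∀ {n} → Graph n → List (Fin n × Fin n)
edgeList {n} G = filter (λ (u , v) → (u Finₚ.<? v) ×-dec Graph.E? G u v) (cartesianProduct (allFin n) (allFin n))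

module _ {n} (G : Graph n) where
  open Graph G

  edgeList-unique : Unique (edgeList G)
  edgeList-unique = Uniqueₚ.filter⁺ _ (Uniqueₚ.cartesianProduct⁺ (Uniqueₚ.allFin⁺ n) (Uniqueₚ.allFin⁺ n))

  ∈-edgeList⁺ : ∀ {u v} → toℕ u < toℕ v → E u v → (u , v) ∈ edgeList G
  ∈-edgeList⁺ {u} {v} u<v e = ∈-filter⁺ _ (∈-cartesianProduct⁺ (∈-allFin u) (∈-allFin v)) (u<v , e)

  ∈-edgeList⁻ : ∀ {u v} → (u , v) ∈ edgeList G → toℕ u < toℕ v × E u v
  ∈-edgeList⁻ p = proj₂ (∈-filter⁻ _ {xs = cartesianProduct (allFin n) (allFin n)} p)

-- A section of `h` that chooses `a` in the class of `a` misses `b`, `c` and `d`.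
collisions : ∀ {n z} {h : Fin n → Fin z} → Onto h → ∀ {a b c d} → a ≢ b → a ≢ c → a ≢ d → b ≢ c → b ≢ d → c ≢ d →
             h b ≡ h a → h c ≡ h a → h d ≡ h a → 3 + z ≤ n
collisions {n} {z} {h} onto {a} {b} {c} {d} a≢b a≢c a≢d b≢c b≢d c≢d hb hc hd = Finₚ.injective⇒≤ {f = e} e-inj
  where
  sec : ∀ k → ∃ λ v → h v ≡ k × (k ≡ h a → v ≡ a)
  sec k with k Finₚ.≟ h a
  ... | yes eq = a , sym eq , λ _ → refl
  ... | no neq = proj₁ (onto k) , proj₂ (onto k) , λ eq → contradiction eq neq
  s : Fin z → Fin n
  s k = proj₁ (sec k)
  s≢ : ∀ k {y} → h y ≡ h a → a ≢ y → s k ≢ y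
  s≢ k {y} hy a≢y eq = a≢y (trans (sym (proj₂ (proj₂ (sec k))
    (trans (sym (proj₁ (proj₂ (sec k)))) (trans (cong h eq) hy)))) eq)
  e : Fin (3 + z) → Fin n
  e zero = b
  e 1F = c
  e 2F = d
  e (suc (suc (suc k))) = s k
  e-inj : Injective _≡_ _≡_ e
  e-inj {zero} {zero} eq = refl
  e-inj {zero} {1F} eq = contradiction eq b≢c
  e-inj {zero} {2F} eq = contradiction eq b≢d
  e-inj {zero} {suc (suc (suc k))} eq = contradiction (sym eq) (s≢ k hb a≢b)
  e-inj {1F} {zero} eq = contradiction (sym eq) b≢c
  e-inj {1F} {1F} eq = refl
  e-inj {1F} {2F} eq = contradiction eq c≢d
  e-inj {1F} {suc (suc (suc k))} eq = contradiction (sym eq) (s≢ k hc a≢c)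
  e-inj {2F} {zero} eq = contradiction (sym eq) b≢d
  e-inj {2F} {1F} eq = contradiction (sym eq) c≢d
  e-inj {2F} {2F} eq = refl
  e-inj {2F} {suc (suc (suc k))} eq = contradiction (sym eq) (s≢ k hd a≢d)
  e-inj {suc (suc (suc k))} {zero} eq = contradiction eq (s≢ k hb a≢b)
  e-inj {suc (suc (suc k))} {1F} eq = contradiction eq (s≢ k hc a≢c)
  e-inj {suc (suc (suc k))} {2F} eq = contradiction eq (s≢ k hd a≢d)
  e-inj {suc (suc (suc k))} {suc (suc (suc l))} eq =
    cong (λ i → suc (suc (suc i))) (trans (sym (proj₁ (proj₂ (sec k)))) (trans (cong h eq) (proj₁ (proj₂ (sec l)))))

identify : ∀ {n m} (f : Fin n → Fin m) → Onto f → ∀ x y →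
           ∃ λ m′ → Σ (Fin m → Fin m′) λ g → Onto (g ∘ f) × g (f x) ≡ g (f y) × m ≤ suc m′
identify {m = zero} f onto x y with f x
... | ()
identify {m = suc m} f onto x y with f x Finₚ.≟ f y
... | yes eq = suc m , id , onto , eq , n≤1+n (suc m)
... | no neq = m , collapse neq , (λ k → let l , p = collapse-onto neq k ; d , q = onto l in d , trans (cong (collapse neq) q) p)
             , collapse-≡ neq , ≤-refl

identify₄ : ∀ {n} (a b c d : Fin n) → ∃ λ m → Σ (Fin n → Fin m) λ κ →
            Onto κ × κ b ≡ κ a × κ c ≡ κ a × κ d ≡ κ a × n ≤ 3 + m
identify₄ a b c d with identify id (λ k → k , refl) b a
... | m₁ , g₁ , on₁ , e₁ , le₁ with identify g₁ on₁ c a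
...   | m₂ , g₂ , on₂ , e₂ , le₂ with identify (g₂ ∘ g₁) on₂ d a
...     | m₃ , g₃ , on₃ , e₃ , le₃ = m₃ , g₃ ∘ g₂ ∘ g₁ , on₃ , cong (g₃ ∘ g₂) e₁ , cong g₃ e₂ , e₃ ,
          ≤-trans le₁ (s≤s (≤-trans le₂ (s≤s le₃)))

module _ {n : ℕ} {G : Graph n} (R : RotationSystem G) where
  open Graph G
  open RotationSystem R

  -- By `cyclic` there is a path from `rot u x` back to `x`, and its last step shows that `x` is a
  -- value of the rotation. Extended by the identity off the neighbours, the rotation is thus onto
  -- on a finite set, hence injective.
  rot-injective : ∀ {u v w} → E u v → E u w → rot u v ≡ rot u w → v ≡ w
  rot-injective {u} {v} {w} ev ew eq = onto⇒injective {f = r} r-onto (trans (r-E ev) (trans eq (sym (r-E ew))))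
    where
    r : Fin n → Fin n
    r x with E? u x
    ... | yes _ = rot u x
    ... | no _ = x
    r-E : ∀ {x} → E u x → r x ≡ rot u x
    r-E {x} e with E? u x
    ... | yes _ = refl
    ... | no ¬e = contradiction e ¬e
    preimage : ∀ {x y} → E u x → Star (λ x y → rot u x ≡ y) x y → (∃ λ z → E u z × rot u z ≡ y) ⊎ x ≡ y
    preimage ex ε = inj₂ refl
    preimage {x} ex (refl ◅ path) with preimage (closed ex) path
    ... | inj₁ found = inj₁ found
    ... | inj₂ refl = inj₁ (x , ex , refl)
    r-onto : Onto r
    r-onto x with E? u x in eqx
    ... | no ¬e = x , lem
      where
      lem : r x ≡ x
      lem with E? u x
      ... | yes e = contradiction e ¬e
      ... | no _ = refl
    ... | yes e with preimage (closed e) (cyclic (closed e) e)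
    ...   | inj₁ (z , ez , eqz) = z , trans (r-E ez) eqz
    ...   | inj₂ eqz = x , trans (r-E e) eqz

module _ {n : ℕ} where
  ends : Fin n × Fin n → (Fin n × Fin n) × (Fin n × Fin n)
  ends (u , v) = (u , v) , (v , u)

  Increasing : List (Fin n × Fin n) → Set
  Increasing = All (λ (u , v) → toℕ u < toℕ v)

  glue-other : ∀ {ψ ps u v} → (u , v) ∉ ps → (v , u) ∉ ps → glue ψ (map ends ps) (u , v) ≡ ψ (u , v)
  glue-other {ps = []} _ _ = refl
  glue-other {ψ} {ps = (x , y) ∷ ps} p q = trans (glue-other {ps = ps} (p ∘ there) (q ∘ there))
    (cong ψ (swp-≢ (λ { refl → p (here refl) }) (λ { refl → q (here refl) })))

  -- A list of increasing pairs without repetition moves each dart in exactly one swap, so gluing it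
  -- amounts to composing with the involution that reverses the listed edges.
  glue-edge : ∀ {ψ ps u v} → Unique ps → Increasing ps → (u , v) ∈ ps →
              glue ψ (map ends ps) (u , v) ≡ ψ (v , u) × glue ψ (map ends ps) (v , u) ≡ ψ (u , v)
  glue-edge {ψ} {ps = (u , v) ∷ ps} (u∉ ∷ _) (u<v All.∷ inc) (here refl) =
      trans (glue-other {ps = ps} uv∉ vu∉) (cong ψ (swp-x (u , v) (v , u)))
    , trans (glue-other {ps = ps} vu∉ uv∉) (cong ψ (swp-y (u , v) (v , u)))
    where
    uv∉ : (u , v) ∉ ps
    uv∉ p = All.lookup u∉ p refl
    vu∉ : (v , u) ∉ ps
    vu∉ p = <-asym u<v (All.lookup inc p)
  glue-edge {ψ} {ps = (x , y) ∷ ps} {u} {v} (x∉ ∷ uniq) (x<y All.∷ inc) (there p) =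
    let q , r = glue-edge {ps = ps} uniq inc p in
      trans q (cong ψ (swp-≢ (λ { refl → <-asym x<y (All.lookup inc p) }) (λ { refl → All.lookup x∉ p refl })))
    , trans r (cong ψ (swp-≢ (λ { refl → All.lookup x∉ p refl }) (λ { refl → <-asym x<y (All.lookup inc p) })))

-- The face permutation of an outerplanar embedding

module Plane {n : ℕ} {G : Graph n} (emb : OuterplanarEmbedding G) where
  open Graph G
  open OuterplanarEmbedding emb

  B : Set
  B = Fin n × Fin n

  s : Fin n → Fin n
  s u = [ (λ _ → u) , proj₁ ]′ (incident u)

  s-spec : ∀ u → (Isolated u × s u ≡ u) ⊎ (Σ (E u (s u)) λ d → face ((u , s u) , d) ∈ˢ outer)
  s-spec u with incident u
  ... | inj₁ iso = inj₁ (iso , refl)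
  ... | inj₂ (v , d , out) = inj₂ (d , out)

  -- The pairs are darts, stubs (u , u), inserted into the rotation at u in front of the
  -- dart (u , s u) of the outer face, and nondarts, which are fixed.  With the stubs,
  -- isolated vertices are no exception: Φ has one orbit per face or isolated vertex.
  data Kind : B → Set where
    stub    : ∀ u → Kind (u , u)
    dart    : ∀ {u v} → u ≢ v → E u v → Kind (u , v)
    nondart : ∀ {u v} → u ≢ v → ¬ E u v → Kind (u , v)

  kind : ∀ d → Kind d
  kind (u , v) with u Finₚ.≟ v | E? u v
  ... | yes refl | _ = stub u
  ... | no u≢v | yes e = dart u≢v e
  ... | no u≢v | no ¬e = nondart u≢v ¬e

  turn : Fin n → Fin n → B
  turn u w with w Finₚ.≟ s u
  ... | yes _ = u , u
  ... | no _ = u , w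

  turn-s : ∀ u → turn u (s u) ≡ (u , u)
  turn-s u with s u Finₚ.≟ s u
  ... | yes _ = refl
  ... | no neq = contradiction refl neq

  turn-≢ : ∀ {u w} → w ≢ s u → turn u w ≡ (u , w)
  turn-≢ {u} {w} neq with w Finₚ.≟ s u
  ... | yes eq = contradiction eq neq
  ... | no _ = refl

  σᵏ : ∀ {d} → Kind d → B
  σᵏ (stub u) = u , s u
  σᵏ (dart {u} {v} _ _) = turn u (rot u v)
  σᵏ (nondart {u} {v} _ _) = u , v

  αᵏ : ∀ {d} → Kind d → B
  αᵏ (stub u) = u , u
  αᵏ (dart {u} {v} _ _) = v , u
  αᵏ (nondart {u} {v} _ _) = u , v

  baseᵏ : ∀ {d} → Kind d → B
  baseᵏ (stub u) = u , u
  baseᵏ (dart {u} {v} _ _) = u , v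
  baseᵏ (nondart {u} {v} _ _) = u , u

  σ α base Φ : B → B
  σ d = σᵏ (kind d)
  α d = αᵏ (kind d)
  base d = baseᵏ (kind d)
  Φ d = σ (α d)

  tail : B → Fin n
  tail = proj₁

  E⇒≢ : ∀ {u v} → E u v → u ≢ v
  E⇒≢ e refl = E-irr refl e

  module _ {A : Set} (f : ∀ {d} → Kind d → A)
           (f-dart : ∀ {u v} {p q : u ≢ v} {e e′ : E u v} → f (dart p e) ≡ f (dart q e′)) where

    at-stub : ∀ u → f (kind (u , u)) ≡ f (stub u)
    at-stub u with u Finₚ.≟ u | E? u u
    ... | yes refl | _ = refl
    ... | no neq | _ = contradiction refl neq

    at-dart : ∀ {u v} (e : E u v) → f (kind (u , v)) ≡ f (dart (E⇒≢ e) e)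
    at-dart {u} {v} e with u Finₚ.≟ v | E? u v
    ... | yes refl | _ = contradiction e (E-irr refl)
    ... | no _ | yes _ = f-dart
    ... | no _ | no ¬e = contradiction e ¬e

  σ-stub : ∀ u → σ (u , u) ≡ (u , s u)
  σ-stub = at-stub σᵏ refl
  σ-dart : ∀ {u v} → E u v → σ (u , v) ≡ turn u (rot u v)
  σ-dart = at-dart σᵏ refl
  α-stub : ∀ u → α (u , u) ≡ (u , u)
  α-stub = at-stub αᵏ refl
  α-dart : ∀ {u v} → E u v → α (u , v) ≡ (v , u)
  α-dart = at-dart αᵏ refl
  base-stub : ∀ u → base (u , u) ≡ (u , u)
  base-stub = at-stub baseᵏ refl
  base-dart : ∀ {u v} → E u v → base (u , v) ≡ (u , v)
  base-dart = at-dart baseᵏ refl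

  tail-σ : ∀ d → tail (σ d) ≡ tail d
  tail-σ d with kind d
  ... | stub u = refl
  ... | nondart _ _ = refl
  ... | dart {u} {v} _ _ with rot u v Finₚ.≟ s u
  ...   | yes _ = refl
  ...   | no _ = refl

  tail-base : ∀ d → tail (base d) ≡ tail d
  tail-base d with kind d
  ... | stub u = refl
  ... | dart _ _ = refl
  ... | nondart _ _ = refl

  ¬E-s : ∀ {u v} → u ≢ v → ¬ E u v → v ≢ s u
  ¬E-s {u} u≢v ¬e refl with s-spec u
  ... | inj₁ (_ , eq) = u≢v (sym eq)
  ... | inj₂ (e , _) = ¬e e

  E-s : ∀ {u v} → E u v → E u (s u)
  E-s {u} {v} e with s-spec u
  ... | inj₁ (iso , _) = contradiction e (iso v)
  ... | inj₂ (e′ , _) = e′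

  σ-inj : Injective _≡_ _≡_ σ
  σ-inj {d} {e} eq with trans (sym (tail-σ d)) (trans (cong tail eq) (tail-σ e))
  ... | refl with kind d | kind e
  ...   | stub u | stub .u = refl
  ...   | stub u | dart {v = v} u≢v e with rot u v Finₚ.≟ s u
  ...     | yes _ = contradiction (sym (cong proj₂ eq)) (E⇒≢ (E-s e))
  ...     | no neq = contradiction (sym (cong proj₂ eq)) neq
  σ-inj {d} {e} eq | refl | stub u | nondart u≢v ¬e = contradiction (sym (cong proj₂ eq)) (¬E-s u≢v ¬e)
  σ-inj {d} {e} eq | refl | dart {u} {v} u≢v e₁ | stub .u with rot u v Finₚ.≟ s u
  ...     | yes _ = contradiction (cong proj₂ eq) (E⇒≢ (E-s e₁))
  ...     | no neq = contradiction (cong proj₂ eq) neq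
  σ-inj {d} {e} eq | refl | dart {u} {v} u≢v e₁ | dart {v = w} u≢w e₂ with rot u v Finₚ.≟ s u | rot u w Finₚ.≟ s u
  ...     | yes p | yes q = cong (u ,_) (rot-injective rotation e₁ e₂ (trans p (sym q)))
  ...     | yes p | no q = contradiction (cong proj₂ eq) (E⇒≢ (closed e₂))
  ...     | no p | yes q = contradiction (sym (cong proj₂ eq)) (E⇒≢ (closed e₁))
  ...     | no p | no q = cong (u ,_) (rot-injective rotation e₁ e₂ (cong proj₂ eq))
  σ-inj {d} {e} eq | refl | dart {u} {v} u≢v e₁ | nondart {v = w} u≢w ¬e with rot u v Finₚ.≟ s u
  ...     | yes p = contradiction (cong proj₂ eq) u≢w
  ...     | no p = contradiction (subst (E u) (cong proj₂ eq) (closed e₁)) ¬e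
  σ-inj {d} {e} eq | refl | nondart u≢v ¬e | stub u = contradiction (cong proj₂ eq) (¬E-s u≢v ¬e)
  σ-inj {d} {e} eq | refl | nondart {u} {v} u≢v ¬e | dart {v = w} u≢w e₂ with rot u w Finₚ.≟ s u
  ...     | yes p = contradiction (sym (cong proj₂ eq)) u≢v
  ...     | no p = contradiction (subst (E u) (sym (cong proj₂ eq)) (closed e₂)) ¬e
  σ-inj {d} {e} eq | refl | nondart _ _ | nondart _ _ = eq

  α-invol : ∀ d → α (α d) ≡ d
  α-invol d with kind d in eq
  ... | stub u = α-stub u
  ... | dart _ e = α-dart (E-sym e)
  ... | nondart _ _ = cong αᵏ eq

  Φ-inj : Injective _≡_ _≡_ Φ
  Φ-inj {d} {e} eq = trans (sym (α-invol d)) (trans (cong α (σ-inj eq)) (α-invol e))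

  Φ-stub : ∀ u → Φ (u , u) ≡ (u , s u)
  Φ-stub u = trans (cong σ (α-stub u)) (σ-stub u)

  Φ-dart : ∀ {u v} → E u v → Φ (u , v) ≡ turn v (rot v u)
  Φ-dart e = trans (cong σ (α-dart e)) (σ-dart (E-sym e))

  base-turn : ∀ {u w} → E u w → base (turn u w) ≡ turn u w
  base-turn {u} {w} e with w Finₚ.≟ s u
  ... | yes _ = base-stub u
  ... | no _ = base-dart e

  base-s : ∀ u → base (u , s u) ≡ (u , s u)
  base-s u with s-spec u
  ... | inj₁ (_ , eq) = subst (λ v → base (u , v) ≡ (u , v)) (sym eq) (base-stub u)
  ... | inj₂ (e , _) = base-dart e

  base-idem : ∀ d → base (base d) ≡ base d
  base-idem d with kind d
  ... | stub u = base-stub u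
  ... | dart _ e = base-dart e
  ... | nondart {u} _ _ = base-stub u

  dich : ∀ d → (base d ≡ d × base (Φ d) ≡ Φ d) ⊎ (Φ d ≡ d × base d ≢ d)
  dich d with kind d in eq
  ... | stub u = inj₁ (refl , subst (λ e → base e ≡ e) (sym (σ-stub u)) (base-s u))
  ... | dart _ e = inj₁ (refl , subst (λ e → base e ≡ e) (sym (σ-dart (E-sym e))) (base-turn (closed (E-sym e))))
  ... | nondart u≢v _ = inj₂ (cong σᵏ eq , u≢v ∘ cong proj₂)

  reach-σ : ∀ {u v} → E u v → Reaches σ (u , u) (u , v)
  reach-σ {u} {v} e = walk first (E-s e) (cyclic (E-s e) e)
    where
    first : Reaches σ (u , u) (u , s u)
    first = 1 , σ-stub u
    walk : ∀ {x y} → Reaches σ (u , u) (u , x) → E u x → Star (λ x y → rot u x ≡ y) x y → Reaches σ (u , u) (u , y)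
    walk r ex ε = r
    walk {x} r ex (refl ◅ path) with rot u x Finₚ.≟ s u
    ... | yes eq = walk (subst (λ y → Reaches σ (u , u) (u , y)) (sym eq) first) (closed ex) path
    ... | no neq = walk (reach-trans r (1 , trans (σ-dart ex) (turn-≢ neq))) (closed ex) path

  -- The stub and the darts at a vertex form one orbit of `σ` by `cyclic`, and `base` brings in the
  -- remaining pairs with this tail.
  σ-invariant : ∀ {A : Set} (C : B → A) → (∀ d → C (σ d) ≡ C d) → (∀ d → C (base d) ≡ C d) →
                ∀ d → C d ≡ C (tail d , tail d)
  σ-invariant C C-σ C-base d with kind d in eq
  ... | stub u = refl
  ... | nondart {u} {v} _ _ = trans (sym (C-base (u , v))) (cong (C ∘ baseᵏ) eq)
  ... | dart {u} {v} _ e = let j , p = reach-σ e in trans (cong C (sym p)) (C-iter j)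
    where
    C-iter : ∀ j → C (iter σ j (u , u)) ≡ C (u , u)
    C-iter zero = refl
    C-iter (suc j) = trans (C-σ _) (C-iter j)

  -- `Φ` follows the facial walk but makes an extra stop where the walk passes a stub.
  reach-next : ∀ {o d} → E (proj₁ d) (proj₂ d) → Reaches Φ o d → Reaches Φ o (next d)
  reach-next {o} {u , v} e r with rot v u Finₚ.≟ s v
  ... | no neq = reach-trans r (1 , trans (Φ-dart e) (turn-≢ neq))
  ... | yes eq = reach-trans r (2 , trans (cong Φ (trans (Φ-dart e) (trans (cong (turn v) eq) (turn-s v))))
                                    (trans (Φ-stub v) (cong (v ,_) (sym eq))))

  reach-walk : ∀ {o d e} → E (proj₁ d) (proj₂ d) → Reaches Φ o d → Star (λ d e → next d ≡ e) d e → Reaches Φ o e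
  reach-walk e r ε = r
  reach-walk {d = u , v} e r (refl ◅ path) = reach-walk (closed (E-sym e)) (reach-next e r) path

  connected-isolated : ∀ {u v} → Isolated u → Connected u v → u ≡ v
  connected-isolated iso ε = refl
  connected-isolated iso (e ◅ _) = contradiction e (iso _)

  -- Here outerplanarity enters. The face in `outer` is unique in a component and contains, for each
  -- of its nonisolated vertices, the dart that follows the stub. Hence a single orbit of `Φ` meets
  -- all stubs of the component.
  reach-stub : ∀ {r u} → Connected r u → Reaches Φ (r , r) (u , u)
  reach-stub {r} {u} con with s-spec r | s-spec u
  ... | inj₁ (iso , _) | _ = 0 , cong (λ v → v , v) (connected-isolated iso con)
  ... | inj₂ _ | inj₁ (iso , _) = 0 , cong (λ v → v , v) (sym (connected-isolated iso (reverse E-sym con)))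
  ... | inj₂ (d , out) | inj₂ (d′ , out′) = reach-trans
          (reach-walk d (1 , Φ-stub r) (Equivalence.to (Classes.exact faces) (unique d d′ con out out′)))
          (reach-sym Φ-inj (1 , Φ-stub u))

  isolated? : ∀ u → Dec (Isolated u)
  isolated? u = Finₚ.all? (λ v → ¬? (E? u v))

  isolatedList : List (Fin n)
  isolatedList = filter isolated? (allFin n)

  isolatedList-unique : Unique isolatedList
  isolatedList-unique = Uniqueₚ.filter⁺ isolated? (Uniqueₚ.allFin⁺ n)

  faceOf : ∀ {u v} → E u v → Fin (#faces + #isolated)
  faceOf {u} {v} e = face ((u , v) , e) ↑ˡ #isolated

  stubFace : Fin n → Fin (#faces + #isolated)
  stubFace u with s-spec u
  ... | inj₁ (iso , _) = #faces ↑ʳ index (∈-filter⁺ isolated? (∈-allFin u) iso)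
  ... | inj₂ (e , _) = faceOf e

  faceᵏ : ∀ {d} → Kind d → Fin (#faces + #isolated)
  faceᵏ (stub u) = stubFace u
  faceᵏ (dart _ e) = faceOf e
  faceᵏ (nondart {u} _ _) = stubFace u

  facial : B → Fin (#faces + #isolated)
  facial d = faceᵏ (kind d)

  faceOf-irr : ∀ {u v} {e e′ : E u v} → faceOf e ≡ faceOf e′
  faceOf-irr = cong (_↑ˡ #isolated) (Equivalence.from (Classes.exact faces) ε)

  facial-stub : ∀ u → facial (u , u) ≡ stubFace u
  facial-stub = at-stub faceᵏ faceOf-irr

  facial-dart : ∀ {u v} (e : E u v) → facial (u , v) ≡ faceOf e
  facial-dart = at-dart faceᵏ faceOf-irr

  faceOf-next : ∀ {u v} (e : E u v) (e′ : E v (rot v u)) → faceOf e ≡ faceOf e′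
  faceOf-next e e′ = cong (_↑ˡ #isolated) (Equivalence.from (Classes.exact faces) (refl ◅ ε))

  stubFace-s : ∀ {u} (e : E u (s u)) → stubFace u ≡ faceOf e
  stubFace-s {u} e with s-spec u
  ... | inj₁ (iso , _) = contradiction e (iso _)
  ... | inj₂ _ = faceOf-irr

  facial-s : ∀ u → facial (u , s u) ≡ stubFace u
  facial-s u = go (s-spec u)
    where
    go : (Isolated u × s u ≡ u) ⊎ (Σ (E u (s u)) λ d → face ((u , s u) , d) ∈ˢ outer) → facial (u , s u) ≡ stubFace u
    go (inj₁ (_ , eq)) = trans (cong (λ v → facial (u , v)) eq) (facial-stub u)
    go (inj₂ (e , _)) = trans (facial-dart e) (sym (stubFace-s e))

  facial-turn : ∀ {u w} (e : E u w) → facial (turn u w) ≡ faceOf e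
  facial-turn {u} {w} e with w Finₚ.≟ s u
  ... | yes refl = trans (facial-stub u) (stubFace-s e)
  ... | no _ = facial-dart e

  facial-base : ∀ d → facial (base d) ≡ facial d
  facial-base d with kind d
  ... | stub u = facial-stub u
  ... | dart _ e = facial-dart e
  ... | nondart {u} _ _ = facial-stub u

  facial-Φ : ∀ d → facial (Φ d) ≡ facial d
  facial-Φ d with kind d in eq
  ... | stub u = trans (cong facial (σ-stub u)) (facial-s u)
  ... | dart _ e = trans (cong facial (σ-dart (E-sym e))) (trans (facial-turn (closed (E-sym e))) (sym (faceOf-next e _)))
  ... | nondart {u} {v} _ _ = trans (cong facial (cong σᵏ eq)) (cong faceᵏ eq)

  facial-onto : Onto facial
  facial-onto k with splitAt #faces k in eq
  ... | inj₁ i = let ((u , v) , e) , p = Classes.onto faces i in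
                 (u , v) , trans (facial-dart e) (trans (cong (_↑ˡ #isolated) p) (Finₚ.splitAt⁻¹-↑ˡ eq))
  ... | inj₂ i = (u , u) , trans (facial-stub u) (trans (go refl) (Finₚ.splitAt⁻¹-↑ʳ eq))
    where
    u = lookup isolatedList i
    go : u ≡ lookup isolatedList i → stubFace u ≡ #faces ↑ʳ i
    go eq′ with s-spec u
    ... | inj₁ (iso , _) = cong (#faces ↑ʳ_) (lookup-injective isolatedList-unique
            (trans (sym (lookup-index (∈-filter⁺ isolated? (∈-allFin u) iso))) eq′))
    ... | inj₂ (e , _) = contradiction e (proj₂ (∈-filter⁻ isolated? {xs = allFin n} (∈-lookup {xs = isolatedList} i)) _)

  connected-step : ∀ {A : Set} (h : Fin n → A) → (∀ {u v} → E u v → h u ≡ h v) → ∀ {u v} → Connected u v → h u ≡ h v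
  connected-step h step ε = refl
  connected-step h step (e ◅ es) = trans (step e) (connected-step h step es)

  oriented : ∀ {u v} → E u v → ∃ λ p → p ∈ edgeList G × (p ≡ (u , v) ⊎ p ≡ (v , u))
  oriented {u} {v} e with Finₚ.<-cmp u v
  ... | tri< u<v _ _ = (u , v) , ∈-edgeList⁺ G u<v e , inj₁ refl
  ... | tri≈ _ u≡v _ = contradiction e (E-irr u≡v)
  ... | tri> _ _ v<u = (v , u) , ∈-edgeList⁺ G v<u (E-sym e) , inj₂ refl

  flip-at : B → B → B
  flip-at p = swp (proj₁ (ends p)) (proj₂ (ends p))

  flip-1 : ∀ {p u v} → p ≡ (u , v) ⊎ p ≡ (v , u) → flip-at p (u , v) ≡ (v , u)
  flip-1 {u = u} {v} (inj₁ refl) = swp-x (u , v) (v , u)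
  flip-1 {u = u} {v} (inj₂ refl) = swp-y (v , u) (u , v)

  flip-2 : ∀ {p u v} → p ≡ (u , v) ⊎ p ≡ (v , u) → flip-at p (v , u) ≡ (u , v)
  flip-2 {u = u} {v} (inj₁ refl) = swp-y (u , v) (v , u)
  flip-2 {u = u} {v} (inj₂ refl) = swp-x (v , u) (u , v)

  flip-≢ : ∀ {p u v d} → p ≡ (u , v) ⊎ p ≡ (v , u) → d ≢ (u , v) → d ≢ (v , u) → flip-at p d ≡ d
  flip-≢ (inj₁ refl) n₁ n₂ = swp-≢ n₁ n₂
  flip-≢ (inj₂ refl) n₁ n₂ = swp-≢ n₂ n₁

  flip-inj : ∀ p → Injective _≡_ _≡_ (flip-at p)
  flip-inj p = swp-inj (proj₁ (ends p)) (proj₂ (ends p))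

  -- Joining the stubs of a, b, c, d inside the outer face splits this face into four and
  -- identifies the four vertices.  If ac and bd are glued first, then the second of them
  -- has its ends in different orbits of one component, which raises the genus.
  module Crossing {a b c d : Fin n} {i₁ i₂ i₃ : ℕ}
    (0<i₁ : 0 < i₁) (i₁<i₂ : i₁ < i₂) (i₂<i₃ : i₂ < i₃)
    (at-b : FirstVisit.At Φ-inj (a , a) (b , b) i₁)
    (at-c : FirstVisit.At Φ-inj (a , a) (c , c) i₂) (at-d : FirstVisit.At Φ-inj (a , a) (d , d) i₃)
    (ac : E a c) (bd : E b d)
    (e₁ e₂ : B) (orient₁ : e₁ ≡ (a , c) ⊎ e₁ ≡ (c , a)) (orient₂ : e₂ ≡ (b , d) ⊎ e₂ ≡ (d , b))
    (e₁∈ : e₁ ∈ edgeList G) (e₂∈ : e₂ ∈ edgeList G)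
    where

    open FirstVisit Φ-inj (a , a)

    vertex : Fin 4 → Fin n
    vertex zero = a
    vertex 1F = b
    vertex 2F = c
    vertex 3F = d

    time : Fin 4 → ℕ
    time zero = 0
    time 1F = i₁
    time 2F = i₂
    time 3F = i₃

    at-vertex : ∀ i → At (vertex i , vertex i) (time i)
    at-vertex zero = refl , λ ()
    at-vertex 1F = at-b
    at-vertex 2F = at-c
    at-vertex 3F = at-d

    i₁<i₃ = <-trans i₁<i₂ i₂<i₃
    0<i₂ = <-trans 0<i₁ i₁<i₂
    0<i₃ = <-trans 0<i₂ i₂<i₃

    time-inj : ∀ i j → time i ≡ time j → i ≡ j
    time-inj zero zero eq = refl
    time-inj zero 1F eq = contradiction eq (<⇒≢ 0<i₁)
    time-inj zero 2F eq = contradiction eq (<⇒≢ 0<i₂)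
    time-inj zero 3F eq = contradiction eq (<⇒≢ 0<i₃)
    time-inj 1F zero eq = contradiction (sym eq) (<⇒≢ 0<i₁)
    time-inj 1F 1F eq = refl
    time-inj 1F 2F eq = contradiction eq (<⇒≢ i₁<i₂)
    time-inj 1F 3F eq = contradiction eq (<⇒≢ i₁<i₃)
    time-inj 2F zero eq = contradiction (sym eq) (<⇒≢ 0<i₂)
    time-inj 2F 1F eq = contradiction (sym eq) (<⇒≢ i₁<i₂)
    time-inj 2F 2F eq = refl
    time-inj 2F 3F eq = contradiction eq (<⇒≢ i₂<i₃)
    time-inj 3F zero eq = contradiction (sym eq) (<⇒≢ 0<i₃)
    time-inj 3F 1F eq = contradiction (sym eq) (<⇒≢ i₁<i₃)
    time-inj 3F 2F eq = contradiction (sym eq) (<⇒≢ i₂<i₃)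
    time-inj 3F 3F eq = refl

    vertex-inj : ∀ {i j} → vertex i ≡ vertex j → i ≡ j
    vertex-inj {i} {j} eq = time-inj i j (At-unique (at-vertex i)
      (subst (λ v → At (v , v) (time j)) (sym eq) (at-vertex j)))

    vertex-≢ : ∀ {i j} → i ≢ j → vertex i ≢ vertex j
    vertex-≢ i≢j = i≢j ∘ vertex-inj

    x p : Fin 4 → B
    x i = vertex i , vertex i
    p zero = a , c
    p 1F = b , d
    p 2F = c , a
    p 3F = d , b

    pr op : Fin 4 → Fin 4
    pr zero = 3F
    pr 1F = zero
    pr 2F = 1F
    pr 3F = 2F
    op zero = 2F
    op 1F = 3F
    op 2F = zero
    op 3F = 1F

    pr-op : ∀ {A : Set} (C : Fin 4 → A) → (∀ i → C i ≡ C (pr (op i))) → ∀ i j → C i ≡ C j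
    pr-op C eq i j = trans (to-zero i) (sym (to-zero j))
      where
      to-zero : ∀ i → C i ≡ C zero
      to-zero zero = refl
      to-zero 1F = sym (eq zero)
      to-zero 2F = trans (eq 2F) (eq 3F)
      to-zero 3F = eq 3F

    tails : ∀ i → tail (x i) ≡ tail (p i)
    tails zero = refl
    tails 1F = refl
    tails 2F = refl
    tails 3F = refl

    p-E : ∀ i → E (tail (p i)) (proj₂ (p i))
    p-E zero = ac
    p-E 1F = bd
    p-E 2F = E-sym ac
    p-E 3F = E-sym bd

    tails-inj : ∀ {i j} → tail (p i) ≡ tail (p j) → i ≡ j
    tails-inj {i} {j} eq = vertex-inj (trans (tails i) (trans eq (sym (tails j))))

    x≢p : ∀ i → x i ≢ p i
    x≢p i eq = E-irr (trans (sym (cong proj₁ eq)) (cong proj₂ eq)) (p-E i)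

    x-inj : ∀ {i j} → x i ≡ x j → i ≡ j
    x-inj = vertex-inj ∘ cong proj₁

    reach : ∀ i → Reaches σ (x i) (p i)
    reach i = subst (λ v → Reaches σ (v , v) (p i)) (sym (tails i)) (reach-σ (p-E i))

    -- The 4-cycle of the stubs is written as three transpositions, so that injectivity and the
    -- effect on labellings follow from those of `swp`.
    ρ : B → B
    ρ e = swp (c , c) (d , d) (swp (b , b) (c , c) (swp (a , a) (b , b) e))

    ρ-inj : Injective _≡_ _≡_ ρ
    ρ-inj eq = swp-inj (a , a) (b , b) (swp-inj (b , b) (c , c) (swp-inj (c , c) (d , d) eq))

    x≢ : ∀ {i j} → i ≢ j → x i ≢ x j
    x≢ i≢j = i≢j ∘ x-inj

    ρ-x : ∀ i → ρ (x i) ≡ x (pr i)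
    ρ-x zero = trans (cong (swp _ _ ∘ swp _ _) (swp-x (a , a) (b , b)))
                     (trans (cong (swp _ _) (swp-x (b , b) (c , c))) (swp-x (c , c) (d , d)))
    ρ-x 1F = trans (cong (swp _ _ ∘ swp _ _) (swp-y (a , a) (b , b)))
                     (trans (cong (swp _ _) (swp-≢ (x≢ {zero} {1F} λ ()) (x≢ {zero} {2F} λ ())))
                            (swp-≢ (x≢ {zero} {2F} λ ()) (x≢ {zero} {3F} λ ())))
    ρ-x 2F = trans (cong (swp _ _ ∘ swp _ _) (swp-≢ (x≢ {2F} {zero} λ ()) (x≢ {2F} {1F} λ ())))
                     (trans (cong (swp _ _) (swp-y (b , b) (c , c)))
                            (swp-≢ (x≢ {1F} {2F} λ ()) (x≢ {1F} {3F} λ ())))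
    ρ-x 3F = trans (cong (swp _ _ ∘ swp _ _) (swp-≢ (x≢ {3F} {zero} λ ()) (x≢ {3F} {1F} λ ())))
                     (trans (cong (swp _ _) (swp-≢ (x≢ {3F} {1F} λ ()) (x≢ {3F} {2F} λ ())))
                            (swp-y (c , c) (d , d)))

    ρ-other : ∀ {e} → e ≢ x zero → e ≢ x 1F → e ≢ x 2F → e ≢ x 3F → ρ e ≡ e
    ρ-other na nb nc nd = trans (cong (swp _ _ ∘ swp _ _) (swp-≢ na nb))
                          (trans (cong (swp _ _) (swp-≢ nb nc)) (swp-≢ nc nd))

    ρ-tail : ∀ {A : Set} (h : Fin n → A) → (∀ i → h (vertex i) ≡ h a) → ∀ e → h (tail (ρ e)) ≡ h (tail e)
    ρ-tail h eq e = trans (swp-cls (h ∘ tail) (trans (eq 2F) (sym (eq 3F))) _)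
      (trans (swp-cls (h ∘ tail) (trans (eq 1F) (sym (eq 2F))) _)
             (swp-cls (h ∘ tail) (sym (eq 1F)) e))

    e₂≢e₁ : e₂ ≢ e₁
    e₂≢e₁ eq = differ orient₁ orient₂
      where
      differ : e₁ ≡ p zero ⊎ e₁ ≡ p 2F → e₂ ≡ p 1F ⊎ e₂ ≡ p 3F → ⊥
      differ (inj₁ r) (inj₁ s) = contradiction (tails-inj {1F} {zero} (cong proj₁ (trans (sym s) (trans eq r)))) λ ()
      differ (inj₁ r) (inj₂ s) = contradiction (tails-inj {3F} {zero} (cong proj₁ (trans (sym s) (trans eq r)))) λ ()
      differ (inj₂ r) (inj₁ s) = contradiction (tails-inj {1F} {2F} (cong proj₁ (trans (sym s) (trans eq r)))) λ ()
      differ (inj₂ r) (inj₂ s) = contradiction (tails-inj {3F} {2F} (cong proj₁ (trans (sym s) (trans eq r)))) λ ()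

    others : ∃ λ rest → edgeList G ↭ e₁ ∷ e₂ ∷ rest
    others with extract e₁∈
    ... | ys , p with ∈-resp-↭ p e₂∈
    ...   | here eq = contradiction eq e₂≢e₁
    ...   | there m with extract m
    ...     | zs , q = zs , ↭-trans p (prep e₁ q)

    module Glueing (rest : List B) (order : edgeList G ↭ e₁ ∷ e₂ ∷ rest) where
      edges = e₁ ∷ e₂ ∷ rest

      edges-unique : Unique edges
      edges-unique = Unique-resp-↭ order (edgeList-unique G)

      edges-increasing : Increasing edges
      edges-increasing = All.tabulate λ m → proj₁ (∈-edgeList⁻ G (∈-resp-↭ (↭-sym order) m))

      -- This is `glue (ρ ∘ σ)` after its first two pairs, so that `ψ` is by definition the gluing
      -- of all of `edges`.
      ψ₀ : B → B
      ψ₀ = ρ ∘ σ ∘ flip-at e₁ ∘ flip-at e₂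

      ψ₀-inj : Injective _≡_ _≡_ ψ₀
      ψ₀-inj {x} {y} eq = flip-inj e₂ (flip-inj e₁ {flip-at e₂ x} {flip-at e₂ y}
        (σ-inj (ρ-inj {σ (flip-at e₁ (flip-at e₂ x))} {σ (flip-at e₁ (flip-at e₂ y))} eq)))

      ψ : B → B
      ψ = glue ψ₀ (map ends rest)

      from-edges : ∀ {u v} → (u , v) ∈ edges → E u v
      from-edges m = proj₂ (∈-edgeList⁻ G (∈-resp-↭ (↭-sym order) m))

      ψ-kind : ∀ {e} (k : Kind e) → ψ e ≡ ρ (σ (αᵏ k))
      ψ-kind (stub u) = glue-other {ψ = ρ ∘ σ} {ps = edges} (E-irr refl ∘ from-edges) (E-irr refl ∘ from-edges)
      ψ-kind (nondart _ ¬e) = glue-other {ψ = ρ ∘ σ} {ps = edges} (¬e ∘ from-edges) (¬e ∘ E-sym ∘ from-edges)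
      ψ-kind (dart {u} {v} u≢v e) with Finₚ.<-cmp u v
      ... | tri< u<v _ _ = proj₁ (glue-edge {ψ = ρ ∘ σ} {ps = edges} edges-unique edges-increasing (∈-resp-↭ order (∈-edgeList⁺ G u<v e)))
      ... | tri≈ _ u≡v _ = contradiction u≡v u≢v
      ... | tri> _ _ v<u = proj₂ (glue-edge {ψ = ρ ∘ σ} {ps = edges} edges-unique edges-increasing (∈-resp-↭ order (∈-edgeList⁺ G v<u (E-sym e))))

      ψ≗ρΦ : ∀ e → ψ e ≡ ρ (Φ e)
      ψ≗ρΦ e = ψ-kind (kind e)

      flips-p : ∀ i → flip-at e₁ (flip-at e₂ (p i)) ≡ p (op i)
      flips-p zero = trans (cong (flip-at e₁) (flip-≢ orient₂
        (vertex-≢ {zero} {1F} (λ ()) ∘ cong proj₁) (vertex-≢ {zero} {3F} (λ ()) ∘ cong proj₁)))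
        (flip-1 orient₁)
      flips-p 1F = trans (cong (flip-at e₁) (flip-1 orient₂)) (flip-≢ orient₁
        (vertex-≢ {3F} {zero} (λ ()) ∘ cong proj₁) (vertex-≢ {3F} {2F} (λ ()) ∘ cong proj₁))
      flips-p 2F = trans (cong (flip-at e₁) (flip-≢ orient₂
        (vertex-≢ {2F} {1F} (λ ()) ∘ cong proj₁) (vertex-≢ {2F} {3F} (λ ()) ∘ cong proj₁)))
        (flip-2 orient₁)
      flips-p 3F = trans (cong (flip-at e₁) (flip-2 orient₂)) (flip-≢ orient₁
        (vertex-≢ {1F} {zero} (λ ()) ∘ cong proj₁) (vertex-≢ {1F} {2F} (λ ()) ∘ cong proj₁))

      flips-other : ∀ {e} → (∀ i → e ≢ p i) → flip-at e₁ (flip-at e₂ e) ≡ e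
      flips-other ne = trans (cong (flip-at e₁) (flip-≢ orient₂ (ne 1F) (ne 3F)))
                             (flip-≢ orient₁ (ne zero) (ne 2F))

      module _ {z₀ : ℕ} (Q₀ : Quot (Steps base ψ₀) z₀) where
        open Quot Q₀
        joined : (∀ i j → cls (x i) ≡ cls (x j)) × (∀ e → cls (σ e) ≡ cls e)
        joined = Join.join σ-inj tail tail-σ x p pr op pr-op tails tails-inj x≢p reach ρ-x
          (λ ne → ρ-other (ne zero) (ne 1F) (ne 2F) (ne 3F))
          {ψ₀} (λ i → cong (ρ ∘ σ) (flips-p i)) (λ ne → cong (ρ ∘ σ) (flips-other ne))
          cls (λ e → sym (resp (inj₂ refl)))
        C-x = proj₁ joined
        C-σ = proj₂ joined

        -- The classes are the vertices, except that `Join` puts `a`, `b`, `c` and `d` into a single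
        -- one.
        start-≤ : 3 + z₀ ≤ n
        start-≤ = collisions {h = λ v → cls (v , v)}
          (λ k → let e , eq = onto k in tail e , trans (sym (σ-invariant cls C-σ (λ e → sym (resp (inj₁ refl))) e)) eq)
          (vertex-≢ {zero} {1F} λ ()) (vertex-≢ {zero} {2F} λ ()) (vertex-≢ {zero} {3F} λ ())
          (vertex-≢ {1F} {2F} λ ()) (vertex-≢ {1F} {3F} λ ())
          (vertex-≢ {2F} {3F} λ ())
          (C-x 1F zero) (C-x 2F zero) (C-x 3F zero)

      -- At the start there are at most `n − 3` orbits, and `κ` has at least `n − 3` labels. Gluing
      -- the other `#edges − 2` edges leads to at least `#faces + #isolated + 3` orbits by `Split`
      -- and at most `#components` labels. The inequality of `gluing` then puts
      -- `n + #faces + #isolated` below `#edges + 2 * #components` by 2, the price of one handle,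
      -- against `euler`.
      crossing-impossible : ⊥
      crossing-impossible with identify₄ a b c d | stepsQuot base ψ₀ | stepsQuot base ψ
      ... | c₀ , κ , κ-onto , κb , κc , κd , n≤ | z₀ , Q₀ | z , Q = <-irrefl refl contra
        where
        κ-vertex : ∀ i → κ (vertex i) ≡ κ a
        κ-vertex zero = refl
        κ-vertex 1F = κb
        κ-vertex 2F = κc
        κ-vertex 3F = κd
        κ-flips : ∀ e → κ (tail (flip-at e₁ (flip-at e₂ e))) ≡ κ (tail e)
        κ-flips e with Finₚ.any? (λ i → e ≟ᵈ p i)
        ... | no none = cong (κ ∘ tail) (flips-other λ i eq → none (i , eq))
        ... | yes (i , refl) = trans (cong (κ ∘ tail) (flips-p i)) (trans (p-κ (op i)) (sym (p-κ i)))
          where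
          p-κ : ∀ i → κ (tail (p i)) ≡ κ a
          p-κ i = trans (cong κ (sym (tails i))) (κ-vertex i)
        K₀ : Components base ψ₀ c₀
        K₀ = record
          { comp = κ ∘ tail
          ; comp-onto = λ k → let v , eq = κ-onto k in (v , v) , eq
          ; comp-base = λ e → cong κ (tail-base e)
          ; comp-ψ = λ e → trans (ρ-tail κ κ-vertex _) (trans (cong κ (tail-σ _)) (κ-flips e)) }
        open Glued (gluing ψ₀-inj Q₀ K₀ (map ends rest))
        open Components K′
        comp-tail : ∀ {e e′} → tail e ≡ tail e′ → comp e ≡ comp e′
        comp-tail eq = coarse (cong κ eq)
        comp-E : ∀ {u v} → E u v → comp (u , u) ≡ comp (v , v)
        comp-E {u} {v} e = begin
          comp (u , u)       ≡⟨ comp-tail refl ⟩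
          comp (u , v)       ≡⟨ comp-ψ (u , v) ⟨
          comp (ψ (u , v))   ≡⟨ cong comp (ψ≗ρΦ (u , v)) ⟩
          comp (ρ (Φ (u , v))) ≡⟨ coarse (ρ-tail κ κ-vertex (Φ (u , v))) ⟩
          comp (σ (α (u , v))) ≡⟨ comp-tail (trans (tail-σ (α (u , v))) (cong tail (α-dart e))) ⟩
          comp (v , v)       ∎
          where open ≡-Reasoning
        c′≤ : c′ ≤ #components
        c′≤ = onto⇒≤ {f = λ i → comp (let r = proj₁ (Classes.onto components i) in r , r)} λ k →
          let e , eq = comp-onto k
              u = tail e
              r , eq′ = Classes.onto components (Classes.class components u)
          in Classes.class components u , trans (connected-step (λ v → comp (v , v)) comp-E
               (Equivalence.to (Classes.exact components) eq′)) (trans (comp-tail refl) eq)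
        halves : Σ (B → Fin (#faces + #isolated + 3)) λ g → Onto g × (∀ e → g (base e) ≡ g e) × (∀ e → g (ρ (Φ e)) ≡ g e)
        halves = Split.split Φ-inj base-idem dich facial facial-onto facial-base facial-Φ (base-stub a)
          0<i₁ i₁<i₂ i₂<i₃ at-b at-c at-d (ρ-x zero) (ρ-x 1F) (ρ-x 2F) (ρ-x 3F) ρ-other
        z≥ : #faces + #isolated + 3 ≤ z
        z≥ = let g , g-onto , g-base , g-ρΦ = halves in count-≤ Q g-onto λ
               { (inj₁ refl) → sym (g-base _) ; (inj₂ refl) → trans (sym (g-ρΦ _)) (cong g (sym (ψ≗ρΦ _))) }
        m = length (map ends rest)
        #edges≡ : #edges ≡ 2 + m
        #edges≡ = trans (↭-length order) (cong (λ k → 2 + k) (sym (length-map ends rest)))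
        FI = #faces + #isolated
        open ≤-Reasoning
        contra : suc (2 * n + FI + 8) ≤ 2 * n + FI + 8
        contra = begin
          suc (2 * n + FI + 8) ≡⟨ ar₁ n FI ⟩
          FI + 3 + 2 * n + 6 ≤⟨ +-monoˡ-≤ 6 (+-mono-≤ z≥ (*-monoʳ-≤ 2 n≤)) ⟩
          z + 2 * (3 + c₀) + 6 ≡⟨ ar₂ z c₀ ⟩
          z + 2 * c₀ + 12 ≤⟨ +-monoˡ-≤ 12 (genus Q) ⟩
          z₀ + 2 * c′ + m + 12 ≤⟨ +-monoˡ-≤ 12 (+-monoˡ-≤ m (+-monoʳ-≤ z₀ (*-monoʳ-≤ 2 c′≤))) ⟩
          z₀ + 2 * #components + m + 12 ≡⟨ ar₃ z₀ (2 * #components) m ⟩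
          (3 + z₀) + (2 + m + 2 * #components) + 7 ≤⟨ +-monoˡ-≤ 7 (+-monoˡ-≤ _ (start-≤ Q₀)) ⟩
          n + (2 + m + 2 * #components) + 7 ≡⟨ cong (λ k → n + (k + 2 * #components) + 7) (sym #edges≡) ⟩
          n + (#edges + 2 * #components) + 7 ≡⟨ cong (λ k → n + k + 7) (sym euler) ⟩
          n + (n + FI) + 7 ≤⟨ n≤1+n _ ⟩
          suc (n + (n + FI) + 7) ≡⟨ ar₄ n FI ⟩
          2 * n + FI + 8 ∎
          where
          ar₁ : ∀ a b → suc (2 * a + b + 8) ≡ b + 3 + 2 * a + 6
          ar₁ = solve-∀
          ar₂ : ∀ a b → a + 2 * (3 + b) + 6 ≡ a + 2 * b + 12
          ar₂ = solve-∀
          ar₃ : ∀ a b c → a + b + c + 12 ≡ (3 + a) + (2 + c + b) + 7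
          ar₃ = solve-∀
          ar₄ : ∀ a b → suc (a + (a + b) + 7) ≡ 2 * a + b + 8
          ar₄ = solve-∀


    crossing-⊥ : ⊥
    crossing-⊥ = let rest , order = others in Glueing.crossing-impossible rest order

  max-bound : ∀ {m} (h : Fin m → ℕ) → ∃ λ M → ∀ i → h i < M
  max-bound {zero} h = 0 , λ ()
  max-bound {suc m} h = let M , lt = max-bound (h ∘ suc) in
    suc (h zero) ⊔ M , λ { zero → m≤m⊔n _ M ; (suc i) → <-≤-trans (lt i) (m≤n⊔m _ M) }

  root : Fin n → Fin n
  root u = proj₁ (Classes.onto components (Classes.class components u))

  root-connected : ∀ u → Connected (root u) u
  root-connected u = Equivalence.to (Classes.exact components) (proj₂ (Classes.onto components (Classes.class components u)))

  abstract
    visit : ∀ u → ∃ (FirstVisit.At Φ-inj (root u , root u) (u , u))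
    visit u = FirstVisit.reached Φ-inj _ (reach-stub (root-connected u))

  position : Fin n → ℕ
  position u = proj₁ (visit u)

  bound : ℕ
  bound = proj₁ (max-bound position)

  -- A lexicographic order: the components follow each other without interleaving, so every vertex
  -- between two adjacent ones belongs to their component.
  key : Fin n → ℕ
  key u = toℕ (Classes.class components u) * bound + position u

  class-mono : ∀ {u v} → key u ≤ key v → toℕ (Classes.class components u) ≤ toℕ (Classes.class components v)
  class-mono {u} {v} le = ≮⇒≥ λ v<u → <-irrefl refl (begin-strict
    key u                   ≤⟨ le ⟩
    toℕ (Classes.class components v) * bound + position v <⟨ +-monoʳ-< _ (proj₂ (max-bound position) v) ⟩
    toℕ (Classes.class components v) * bound + bound ≡⟨ +-comm _ bound ⟩
    suc (toℕ (Classes.class components v)) * bound ≤⟨ *-monoˡ-≤ bound v<u ⟩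
    toℕ (Classes.class components u) * bound ≤⟨ m≤m+n _ _ ⟩
    key u ∎)
    where open ≤-Reasoning

  class-E : ∀ {u v} → E u v → Classes.class components u ≡ Classes.class components v
  class-E e = Equivalence.from (Classes.exact components) (e ◅ ε)

  module _ {u v} (same : Classes.class components u ≡ Classes.class components v) where

    At-root : FirstVisit.At Φ-inj (root u , root u) (v , v) (position v)
    At-root = subst (λ i → let r = proj₁ (Classes.onto components i) in FirstVisit.At Φ-inj (r , r) (v , v) (position v))
                    (sym same) (proj₂ (visit v))

    position-< : key u < key v → position u < position v
    position-< lt = +-cancelˡ-< (toℕ (Classes.class components u) * bound) _ _
      (subst (λ i → key u < toℕ i * bound + position v) (sym same) lt)

    -- `Crossing` counts its times from the stub of `a`; moving the start of the orbit from the root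
    -- to `u` only subtracts the position of `u`.
    At-shift : key u < key v → FirstVisit.At Φ-inj (u , u) (v , v) (position v ∸ position u)
    At-shift lt = shift-eq , λ {i} i<k eq → proj₂ At-root {i + position u}
        (subst (i + position u <_) (m∸n+n≡m (<⇒≤ (position-< lt))) (+-monoˡ-< (position u) i<k))
        (trans (iter-+ Φ i (position u) _) (trans (cong (iter Φ i) (proj₁ (proj₂ (visit u)))) eq))
      where
      shift-eq : iter Φ (position v ∸ position u) (u , u) ≡ (v , v)
      shift-eq = trans (cong (iter Φ (position v ∸ position u)) (sym (proj₁ (proj₂ (visit u)))))
        (trans (sym (iter-+ Φ (position v ∸ position u) (position u) _))
        (trans (cong (λ k → iter Φ k _) (m∸n+n≡m (<⇒≤ (position-< lt)))) (proj₁ At-root)))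

  key-injective : Injective _≡_ _≡_ key
  key-injective {u} {v} eq = cong proj₁ (trans (sym (proj₁ (proj₂ (visit u))))
      (trans (cong (λ k → iter Φ k _) same-pos) (proj₁ (At-root same))))
    where
    same : Classes.class components u ≡ Classes.class components v
    same = Finₚ.toℕ-injective (≤-antisym (class-mono {u} {v} (≤-reflexive eq)) (class-mono {v} {u} (≤-reflexive (sym eq))))
    same-pos : position u ≡ position v
    same-pos = +-cancelˡ-≡ (toℕ (Classes.class components u) * bound) _ _
      (trans eq (cong (λ i → toℕ i * bound + position v) (sym same)))

  noncrossing : ∀ {a b c d} → key a < key b → key b < key c → key c < key d → E a c → E b d → ⊥
  noncrossing {a} {b} {c} {d} a<b b<c c<d ac bd =
    let e₁ , e₁∈ , o₁ = oriented ac ; e₂ , e₂∈ , o₂ = oriented bd in Crossing.crossing-⊥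
      (m<n⇒0<n∸m pa<pb) (∸-monoˡ-< pb<pc (<⇒≤ pa<pb)) (∸-monoˡ-< pc<pd (<⇒≤ (<-trans pa<pb pb<pc)))
      (At-shift same-ab a<b) (At-shift same-ac (<-trans a<b b<c)) (At-shift same-ad (<-trans a<b (<-trans b<c c<d))) ac bd
      e₁ e₂ o₁ o₂ e₁∈ e₂∈
    where
    same-ac : Classes.class components a ≡ Classes.class components c
    same-ac = class-E ac
    same-ab : Classes.class components a ≡ Classes.class components b
    same-ab = Finₚ.toℕ-injective (≤-antisym (class-mono {a} {b} (<⇒≤ a<b))
                (≤-trans (class-mono {b} {c} (<⇒≤ b<c)) (≤-reflexive (cong toℕ (sym same-ac)))))
    same-ad : Classes.class components a ≡ Classes.class components d
    same-ad = trans same-ab (class-E bd)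
    pa<pb = position-< same-ab a<b
    pb<pc = position-< (trans (sym same-ab) same-ac) b<c
    pc<pd = position-< (trans (sym same-ac) same-ad) c<d

≤-by : ∀ {A B X Y} c → A ≤ B → A ≡ X + c → B ≡ Y + c → X ≤ Y
≤-by c A≤B refl refl = +-cancelʳ-≤ c _ _ A≤B

≤-split : ∀ {q} u {v} → q ≤ u + v → ∃₂ λ q₁ q₂ → q₁ ≤ u × q₂ ≤ v × q ≡ q₁ + q₂
≤-split {q} u {v} q≤ with ≤-total q u
... | inj₁ q≤u = q , 0 , q≤u , z≤n , sym (+-identityʳ q)
... | inj₂ u≤q = u , q ∸ u , ≤-refl , m≤n+o⇒m∸n≤o q u q≤ , sym (m+[n∸m]≡n u≤q)

-- The upper bound for noncrossing graphs

-- Paths increase and so repeat no vertex: for `q ≥ 2`, a path with `q` edges from `i` to `j` and an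
-- edge between `i` and `j` form a cycle of length `q + 1`.
data Path (P : ℕ → ℕ → Set) : ℕ → ℕ → ℕ → Set where
  []   : ∀ {i} → Path P i i 0
  step : ∀ {i m j q} → i < m → P i m → Path P m j q → Path P i j (suc q)

_⊕_ : ∀ {P i m j p q} → Path P i m p → Path P m j q → Path P i j (p + q)
[] ⊕ ys = ys
step lt e xs ⊕ ys = step lt e (xs ⊕ ys)

path-≤ : ∀ {P x y q} → Path P x y q → x + q ≤ y
path-≤ [] = ≤-reflexive (+-identityʳ _)
path-≤ {x = x} {q = suc q} (step lt _ path) = ≤-trans (≤-reflexive (+-suc x q)) (≤-trans (+-monoˡ-≤ q lt) (path-≤ path))

Noncrossing : (ℕ → ℕ → Set) → Set
Noncrossing P = ∀ {a b c d} → a < b → b < c → c < d → P a c → P b d → ⊥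

farthest : ∀ {Q : ℕ → Set} → Decidable Q → ∀ i w →
           (∃₂ λ x y → suc x + y ≡ w × Q (suc (i + x)) × (∀ {b} → suc (i + x) < b → b ≤ i + w → ¬ Q b))
           ⊎ (∀ {b} → i < b → b ≤ i + w → ¬ Q b)
farthest Q? i zero = inj₂ λ i<b b≤ → contradiction (subst (_ ≤_) (+-identityʳ i) b≤) (<⇒≱ i<b)
farthest {Q} Q? i (suc w) with Q? (suc (i + w))
... | yes q = inj₁ (w , 0 , +-identityʳ _ , q , λ {b} lt le → contradiction (subst (b ≤_) (+-suc i w) le) (<⇒≱ lt))
... | no ¬q with farthest Q? i w
...   | inj₁ (x , y , eq , q , max) = inj₁ (x , suc y , trans (+-suc (suc x) y) (cong suc eq) , q , λ {b} lt le →
          [ (λ b<  → max lt (≤-pred (subst (b <_) (+-suc i w) b<))) , (λ { refl → subst (¬_ ∘ Q) (sym (+-suc i w)) ¬q }) ]′ (m≤n⇒m<n∨m≡n le))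
...   | inj₂ none = inj₂ λ {b} lt le →
          [ (λ b<  → none lt (≤-pred (subst (b <_) (+-suc i w) b<))) , (λ { refl → subst (¬_ ∘ Q) (sym (+-suc i w)) ¬q }) ]′ (m≤n⇒m<n∨m≡n le)

module UpperBound (P : ℕ → ℕ → Set) (P? : ∀ i j → Dec (P i j)) (nc : Noncrossing P) (t′ : ℕ)
                  (acyclic : ∀ {i j} → P i j → Path P i j (2 + t′) → ⊥) where

  private
    t c : ℕ
    t = suc t′
    -- Closing a heavy face adds `t` to the left side of `size` and, the loss being one smaller,
    -- takes `t` from the right, where 1 is to spare. This asks for `2 t − 1` per heavy face.
    c = t + t′

  Covers : (ℕ → ℕ → Set) → ℕ → ℕ → List (ℕ × ℕ) → Set
  Covers P i j ys = ∀ {a b} → i ≤ a → a < b → b ≤ j → P a b → (a , b) ∈ ys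

  -- The part of the graph below an edge from i to i + w.  ℓ is the loss 2 w − #edges
  -- and h the number of inner faces with more than k edges.  The u triangles that are
  -- connected to the edge can be bypassed one by one, which gives the paths.
  record Edge (i w : ℕ) : Set where
    field
      list   : List (ℕ × ℕ)
      covers : Covers P i (i + w) list
      ℓ h u  : ℕ
      count  : length list + ℓ ≡ 2 * w
      u≤     : u ≤ t′
      loss   : t * h + 1 ≤ ℓ
      size   : w + t ≤ t * ℓ + c * h + u + 1
      paths  : ∀ {q} → q ≤ u → Path P i (i + w) (suc q)

  record Common (P′ : ℕ → ℕ → Set) (i w ℓ h : ℕ) : Set where
    field
      list   : List (ℕ × ℕ)
      covers : Covers P′ i (i + w) list
      count  : length list + ℓ ≡ 2 * w

  -- Here `r` edges lead from `i` to `i + w`, and an edge above them closes an inner face with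
  -- `r + 1` edges. The inequalities are sums of those of `Edge`. Bypasses under different edges are
  -- independent, so every length from `r` to `r + U` occurs.
  record Gapless (P′ : ℕ → ℕ → Set) (i w : ℕ) : Set where
    field
      {ℓ h} r U : ℕ
      common : Common P′ i w ℓ h
      U≤     : U ≤ r * t′
      loss   : t * h + r ≤ ℓ
      size   : w + r * t ≤ t * ℓ + c * h + U + r
      paths  : ∀ {q} → q ≤ U → Path P i (i + w) (r + q)
      single : r ≡ 1 → P′ i (i + w)
    open Common common public

    size′ : w ≤ t * ℓ + c * h
    size′ = ≤-by (r * t) (≤-trans size (+-monoˡ-≤ r (+-monoʳ-≤ (t * ℓ + c * h) U≤))) refl (arith (t * ℓ + c * h) r t′)
      where
      arith : ∀ x r t′ → x + r * t′ + r ≡ x + r * suc t′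
      arith = solve-∀

  -- Nothing passes over the gap, so an edge above this chain is a bridge of the part below it. A
  -- gap has width 1 and loss 2, which is the source of the surplus `t′ + t = 2 t − 1` in `size`.
  record Gapped (P′ : ℕ → ℕ → Set) (i w : ℕ) : Set where
    field
      {ℓ h}  : ℕ
      common : Common P′ i w ℓ h
      loss   : t * h + 2 ≤ ℓ
      size   : w + t′ + t ≤ t * ℓ + c * h
    open Common common public

  Chain : (ℕ → ℕ → Set) → ℕ → ℕ → Set
  Chain P′ i w = Gapless P′ i w ⊎ Gapped P′ i w

  path-width-0 : ∀ {Q i w} → Path Q i (i + w) 0 → w ≡ 0
  path-width-0 {i = i} p = lem p refl
    where
    lem : ∀ {Q j w} → Path Q i j 0 → j ≡ i + w → w ≡ 0
    lem {w = w} [] eq = +-cancelˡ-≡ i w 0 (trans (sym eq) (sym (+-identityʳ i)))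

  module Chains (P′ : ℕ → ℕ → Set) (P′? : ∀ i j → Dec (P′ i j)) (P′⇒P : ∀ {i j} → P′ i j → P i j)
                (i₀ j₀ : ℕ) (edge : ∀ {i w} → i₀ ≤ i → i + suc w ≤ j₀ → P′ i (i + suc w) → Edge i (suc w)) where

    cons : ∀ {i x y} → Edge i x → P′ i (i + x) → (∀ {b} → i + x < b → b ≤ i + (x + y) → ¬ P′ i b) →
           Chain P′ (i + x) y → Chain P′ i (x + y)
    cons {i} {x} {y} e p far ch = build ch
      where
      module e = Edge e
      assoc : i + x + y ≡ i + (x + y)
      assoc = +-assoc i x y
      join : ∀ {ℓ h} → Common P′ (i + x) y ℓ h → Common P′ i (x + y) (e.ℓ + ℓ) (e.h + h)
      join {ℓ} {h} ch = record
        { list = e.list ++ ch.list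
        ; covers = cov
        ; count = trans (cong (_+ (e.ℓ + ℓ)) (length-++ e.list)) (trans (arith (length e.list) (length ch.list) e.ℓ ℓ)
                  (trans (cong₂ _+_ e.count ch.count) (sym (*-distribˡ-+ 2 x y)))) }
        where
        module ch = Common ch
        arith : ∀ a b c d → a + b + (c + d) ≡ (a + c) + (b + d)
        arith = solve-∀
        -- No edge passes over `i + x`: one from `i` ends there at the latest by `far`, and one from
        -- a vertex strictly between would cross the edge `p`.
        cov : Covers P′ i (i + (x + y)) (e.list ++ ch.list)
        cov {a} {b} i≤a a<b b≤j q with b ≤? i + x | i + x ≤? a
        ... | yes b≤m | _ = ∈-++⁺ˡ (e.covers i≤a a<b b≤m (P′⇒P q))
        ... | no _ | yes m≤a = ∈-++⁺ʳ e.list (ch.covers m≤a a<b (subst (b ≤_) (sym assoc) b≤j) q)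
        ... | no b≰m | no m≰a with m≤n⇒m<n∨m≡n i≤a
        ...   | inj₁ i<a = contradiction (P′⇒P q) (nc i<a (≰⇒> m≰a) (≰⇒> b≰m) (P′⇒P p))
        ...   | inj₂ refl = contradiction q (far (≰⇒> b≰m) b≤j)
      build : Chain P′ (i + x) y → Chain P′ i (x + y)
      build (inj₁ g) = inj₁ record
        { r = suc g.r ; U = e.u + g.U
        ; common = join g.common
        ; U≤ = +-mono-≤ e.u≤ g.U≤
        ; loss = ≤-by 0 (+-mono-≤ e.loss g.loss) (ar₁ t e.h g.h g.r) (sym (+-identityʳ _))
        ; size = ≤-by 0 (+-mono-≤ e.size g.size) (ar₂ x y t g.r) (ar₃ t c e.ℓ g.ℓ e.h g.h e.u g.U g.r)
        ; paths = λ q≤ → let q₁ , q₂ , q₁≤ , q₂≤ , eq = ≤-split e.u q≤ in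
            subst₂ (Path P i) assoc (trans (ar₄ q₁ g.r q₂) (cong (λ l → suc g.r + l) (sym eq))) (e.paths q₁≤ ⊕ g.paths q₂≤)
        ; single = λ { eq → subst (λ w → P′ i (i + w)) (sym (trans (cong (λ l → x + l) (y≡0 (suc-injective eq))) (+-identityʳ x))) p } }
        where
        module g = Gapless g
        y≡0 : g.r ≡ 0 → y ≡ 0
        y≡0 eq = path-width-0 (subst (Path P (i + x) (i + x + y)) (trans (+-identityʳ g.r) eq) (g.paths z≤n))
        ar₁ : ∀ t h₁ h₂ r → t * h₁ + 1 + (t * h₂ + r) ≡ t * (h₁ + h₂) + suc r + 0
        ar₁ = solve-∀
        ar₂ : ∀ x y t r → x + t + (y + r * t) ≡ x + y + suc r * t + 0
        ar₂ = solve-∀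
        ar₃ : ∀ t c ℓ₁ ℓ₂ h₁ h₂ u U r → t * ℓ₁ + c * h₁ + u + 1 + (t * ℓ₂ + c * h₂ + U + r)
              ≡ t * (ℓ₁ + ℓ₂) + c * (h₁ + h₂) + (u + U) + suc r + 0
        ar₃ = solve-∀
        ar₄ : ∀ a b c → suc a + (b + c) ≡ suc b + (a + c)
        ar₄ = solve-∀
      build (inj₂ g) = inj₂ record
        { common = join g.common
        ; loss = ≤-by 1 (+-mono-≤ e.loss (≤-trans g.loss (n≤1+n _))) (ar₁ t e.h g.h) (ar₀ e.ℓ g.ℓ)
        ; size = ≤-by (suc t′) (+-mono-≤ (≤-trans e.size (+-monoˡ-≤ 1 (+-monoʳ-≤ _ e.u≤))) g.size) (ar₂ x y t′) (ar₃ t′ c e.ℓ g.ℓ e.h g.h) }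
        where
        module g = Gapped g
        ar₀ : ∀ a b → a + suc b ≡ a + b + 1
        ar₀ = solve-∀
        ar₁ : ∀ t h₁ h₂ → t * h₁ + 1 + (t * h₂ + 2) ≡ t * (h₁ + h₂) + 2 + 1
        ar₁ = solve-∀
        ar₂ : ∀ x y t′ → x + suc t′ + (y + t′ + suc t′) ≡ x + y + t′ + suc t′ + suc t′
        ar₂ = solve-∀
        ar₃ : ∀ t′ c ℓ₁ ℓ₂ h₁ h₂ → suc t′ * ℓ₁ + c * h₁ + t′ + 1 + (suc t′ * ℓ₂ + c * h₂)
              ≡ suc t′ * (ℓ₁ + ℓ₂) + c * (h₁ + h₂) + suc t′
        ar₃ = solve-∀

    gap : ∀ {i y} → (∀ {b} → i < b → b ≤ i + suc y → ¬ P′ i b) → Chain P′ (suc i) y → Chain P′ i (suc y)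
    gap {i} {y} none ch = inj₂ (build ch)
      where
      wider : ∀ {ℓ h} → Common P′ (suc i) y ℓ h → Common P′ i (suc y) (2 + ℓ) h
      wider {ℓ} ch = record
        { list = list
        ; covers = λ {a} {b} i≤a a<b b≤j q → [ (λ i<a → covers i<a a<b (subst (b ≤_) (+-suc i y) b≤j) q)
                                     , (λ { refl → contradiction q (none a<b b≤j) }) ]′ (m≤n⇒m<n∨m≡n i≤a)
        ; count = trans (ar₁ (length list) ℓ) (trans (cong (λ k → 2 + k) count) (ar₂ y)) }
        where
        open Common ch
        ar₁ : ∀ a b → a + (2 + b) ≡ 2 + (a + b)
        ar₁ = solve-∀
        ar₂ : ∀ y → 2 + 2 * y ≡ 2 * suc y
        ar₂ = solve-∀
      ar₃ : ∀ t′ ℓ x → suc t′ * ℓ + x + (suc t′ + suc t′) ≡ suc t′ * (2 + ℓ) + x + 0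
      ar₃ = solve-∀
      build : Chain P′ (suc i) y → Gapped P′ i (suc y)
      build (inj₁ g) = record
        { common = wider common
        ; loss = ≤-trans (+-monoˡ-≤ 2 (m+n≤o⇒m≤o _ loss)) (≤-reflexive (+-comm ℓ 2))
        ; size = ≤-by 0 (+-monoˡ-≤ (t + t) size′) (ar y t′) (ar₃ t′ ℓ (c * h)) }
        where
        open Gapless g
        ar : ∀ y t′ → y + (suc t′ + suc t′) ≡ suc y + t′ + suc t′ + 0
        ar = solve-∀
      build (inj₂ g) = record
        { common = wider common
        ; loss = ≤-trans loss (m≤n+m ℓ 2)
        ; size = ≤-by 0 (+-mono-≤ size 1≤2t) (ar y t′) (ar₃ t′ ℓ (c * h)) }
        where
        open Gapped g
        1≤2t : 1 ≤ t + t
        1≤2t = s≤s z≤n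
        ar : ∀ y t′ → y + t′ + suc t′ + 1 ≡ suc y + t′ + suc t′ + 0
        ar = solve-∀

    empty : ∀ i → Chain P′ i 0
    empty i = inj₁ record
      { ℓ = 0 ; h = 0 ; r = 0 ; U = 0
      ; common = record { list = [] ; count = refl
                        ; covers = λ i≤a a<b b≤i _ → contradiction (<-≤-trans (≤-<-trans i≤a a<b) (subst (_ ≤_) (+-identityʳ i) b≤i)) (<-irrefl refl) }
      ; U≤ = z≤n ; loss = ≤-reflexive (trans (+-identityʳ _) (*-zeroʳ t)) ; size = z≤n
      ; paths = λ { z≤n → subst (λ j → Path P i j 0) (sym (+-identityʳ i)) [] }
      ; single = λ () }

    chain : ∀ fuel {i w} → w ≤ fuel → i₀ ≤ i → i + w ≤ j₀ → Chain P′ i w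
    chain _ {i} {zero} _ _ _ = empty i
    chain (suc fuel) {i} {suc w} (s≤s w≤) i₀≤ ≤j₀ with farthest (P′? i) i (suc w)
    ... | inj₂ none = gap none (chain fuel w≤ (m≤n⇒m≤1+n i₀≤) (subst (_≤ j₀) (+-suc i w) ≤j₀))
    ... | inj₁ (x , y , refl , q , far) = cons (edge i₀≤ (≤-trans (+-monoʳ-≤ i (m≤m+n (suc x) y)) ≤j₀) q′) q′
            (λ {b} lt → far (subst (_< b) (+-suc i x) lt))
            (chain fuel (≤-trans (m≤n+m y x) w≤) (m≤n⇒m≤n+o (suc x) i₀≤) (subst (_≤ j₀) (sym (+-assoc i (suc x) y)) ≤j₀))
      where
      q′ : P′ i (i + suc x)
      q′ = subst (P′ i) (sym (+-suc i x)) q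

  module _ {i w : ℕ} (p : P i (i + suc w)) where

    -- The root edge itself is removed, since `farthest` would choose it at once and the face below
    -- it would not be seen.
    Below : ℕ → ℕ → Set
    Below a b = P a b × (a ≢ i ⊎ b ≢ i + suc w)

    Below? : ∀ a b → Dec (Below a b)
    Below? a b = P? a b ×-dec (¬? (a ℕₚ.≟ i) ⊎-dec ¬? (b ℕₚ.≟ i + suc w))

    direct : Path P i (i + suc w) 1
    direct = step (m<m+n i z<s) p []

    add-root : ∀ {ys} → Covers Below i (i + suc w) ys → Covers P i (i + suc w) ((i , i + suc w) ∷ ys)
    add-root cov {a} {b} i≤a a<b b≤j q with a ℕₚ.≟ i | b ℕₚ.≟ i + suc w
    ... | yes refl | yes refl = here refl
    ... | no a≢i | _ = there (cov i≤a a<b b≤j (q , inj₁ a≢i))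
    ... | yes _ | no b≢j = there (cov i≤a a<b b≤j (q , inj₂ b≢j))

    1+1 : ∀ a → a + 2 ≡ a + 1 + 1
    1+1 = solve-∀

    close : Chain Below i (suc w) → Edge i (suc w)
    close (inj₂ g) = from refl
      where
      open Gapped g
      from : ∀ {ℓ₁} → ℓ₁ ≡ ℓ → Edge i (suc w)
      from {zero} refl = contradiction (≤-trans (m≤n+m 2 (t * h)) loss) λ ()
      from {suc ℓ₁} refl = record
        { list = _ ∷ list ; covers = add-root covers ; ℓ = ℓ₁ ; h = h ; u = 0
        ; count = trans (sym (+-suc (length list) ℓ₁)) count ; u≤ = z≤n
        ; loss = ≤-by 1 loss (1+1 (t * h)) (+-comm 1 ℓ₁)
        ; size = ≤-by t′ size (ar₂ w t′) (ar₃ t′ ℓ₁ (c * h))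
        ; paths = λ { z≤n → direct } }
        where
        ar₂ : ∀ w t′ → suc w + t′ + suc t′ ≡ suc w + suc t′ + t′
        ar₂ = solve-∀
        ar₃ : ∀ t′ ℓ x → suc t′ * suc ℓ + x ≡ suc t′ * ℓ + x + 0 + 1 + t′
        ar₃ = solve-∀
    close (inj₁ g) = from refl refl
      where
      open Gapless g
      from : ∀ {ℓ₁ ω} → ℓ₁ ≡ ℓ → ω ≡ r → Edge i (suc w)
      from {ω = 0} _ refl = contradiction (path-width-0 (paths z≤n)) λ ()
      from {ω = 1} _ refl = contradiction (proj₂ (single refl)) [ (λ ne → contradiction refl ne) , (λ ne → contradiction refl ne) ]′
      from {ℓ₁ = zero} {suc (suc ω)} refl refl = contradiction (≤-trans (m≤n+m _ (t * h)) loss) λ ()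
      -- A triangle. Going around it makes every bypass below available and counts as one more. With
      -- more than `t′` of them some path would have `t + 1` edges and close a cycle of length `k`.
      from {suc ℓ₁} {2} refl refl = record
        { list = _ ∷ list ; covers = add-root covers ; ℓ = ℓ₁ ; h = h ; u = suc U
        ; count = trans (sym (+-suc (length list) ℓ₁)) count
        ; u≤ = ≮⇒≥ λ t<  → acyclic p (paths (≤-pred t<))
        ; loss = ≤-by 1 loss (1+1 (t * h)) (+-comm 1 ℓ₁)
        ; size = ≤-by t size (ar₂ w t) (ar₃ t ℓ₁ (c * h) U)
        ; paths = λ { {zero} _ → direct ; {suc q} (s≤s q≤) → paths q≤ } }
        where
        ar₂ : ∀ w t → suc w + 2 * t ≡ suc w + t + t
        ar₂ = solve-∀
        ar₃ : ∀ t ℓ x U → t * suc ℓ + x + U + 2 ≡ t * ℓ + x + suc U + 1 + t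
        ar₃ = solve-∀
      from {suc ℓ₁} {suc (suc (suc ω))} refl refl with <-cmp (2 + ω) t
      ... | tri≈ _ eq _ = contradiction (subst (Path P i (i + suc w)) (trans (+-identityʳ _) (cong suc eq)) (paths z≤n)) (acyclic p)
      -- A heavy face has `r ≥ t + 2` lower edges, and their contribution `r` to the loss pays for
      -- `t * suc h + 1` although the root edge saves 1. No detour through the face is recorded,
      -- hence `u = 0`.
      ... | tri> _ _ t< = record
        { list = _ ∷ list ; covers = add-root covers ; ℓ = ℓ₁ ; h = suc h ; u = 0
        ; count = trans (sym (+-suc (length list) ℓ₁)) count ; u≤ = z≤n
        ; loss = ≤-by 1 (≤-trans (+-monoʳ-≤ (t * h) (s≤s t<)) loss) (ar₁ t h) (+-comm 1 ℓ₁)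
        ; size = ≤-by t (+-monoˡ-≤ (t + t) size′) (ar₂ w t) (ar₃ t′ ℓ₁ h)
        ; paths = λ { z≤n → direct } }
        where
        ar₁ : ∀ t h → t * h + suc (suc t) ≡ t * suc h + 1 + 1
        ar₁ = solve-∀
        ar₂ : ∀ w t → suc w + (t + t) ≡ suc w + t + t
        ar₂ = solve-∀
        ar₃ : ∀ t′ ℓ h → suc t′ * suc ℓ + (suc t′ + t′) * h + (suc t′ + suc t′) ≡ suc t′ * ℓ + (suc t′ + t′) * suc h + 0 + 1 + suc t′
        ar₃ = solve-∀
      -- A face of weight from 2 to `t − 1`. Bypasses lengthen the path along it one by one from `r`
      -- to `r + U`, so `r + U` cannot exceed `t` (`few`). Since `r ≥ 3`, the term `r * t` of `size`
      -- covers the root edge with neither a new `h` nor any `u`.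
      ... | tri< lt _ _ = record
        { list = _ ∷ list ; covers = add-root covers ; ℓ = ℓ₁ ; h = h ; u = 0
        ; count = trans (sym (+-suc (length list) ℓ₁)) count ; u≤ = z≤n
        ; loss = ≤-by 1 (≤-trans (+-monoʳ-≤ (t * h) (s≤s (s≤s (z≤n {suc ω})))) loss) (1+1 (t * h)) (+-comm 1 ℓ₁)
        ; size = ≤-trans (≤-by (t + t) (≤-trans (+-monoʳ-≤ (suc w) (*-monoˡ-≤ t (m≤m+n 3 ω)))
                   (≤-trans size (≤-trans (≤-reflexive (+-assoc (t * suc ℓ₁ + c * h) U r))
                     (+-monoʳ-≤ (t * suc ℓ₁ + c * h) few)))) (ar₂ w t) (ar₃ t ℓ₁ (c * h))) (m≤m+n _ 1)
        ; paths = λ { z≤n → direct } }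
        where
        few : U + r ≤ t
        few = ≮⇒≥ λ t<  → acyclic p (subst (Path P i (i + suc w)) (m+[n∸m]≡n (m≤n⇒m≤1+n lt))
                (paths {suc t ∸ r} (m≤n+o⇒m∸n≤o (suc t) r (subst (suc t ≤_) (+-comm U r) t<))))
        ar₂ : ∀ w t → suc w + 3 * t ≡ suc w + t + (t + t)
        ar₂ = solve-∀
        ar₃ : ∀ t ℓ x → t * suc ℓ + x + t ≡ t * ℓ + x + 0 + (t + t)
        ar₃ = solve-∀

  edge : ∀ fuel {i w} → w < fuel → P i (i + suc w) → Edge i (suc w)
  edge (suc fuel) {i} {w} (s≤s w≤) p = close p (chain (suc w) ≤-refl ≤-refl ≤-refl)
    where
    narrower : ∀ {a v} → i ≤ a → a + suc v ≤ i + suc w → a ≢ i ⊎ a + suc v ≢ i + suc w → v < w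
    narrower {a} {v} i≤a le ne with m≤n⇒m<n∨m≡n i≤a
    ... | inj₁ i<a = ≤-pred (+-cancelˡ-≤ i (suc (suc v)) (suc w)
            (≤-trans (≤-reflexive (+-suc i (suc v))) (≤-trans (+-monoˡ-≤ (suc v) i<a) le)))
    ... | inj₂ refl with m≤n⇒m<n∨m≡n le
    ...   | inj₁ lt = ≤-pred (+-cancelˡ-< i (suc v) (suc w) lt)
    ...   | inj₂ eq = contradiction ne [ (λ n → n refl) , (λ n → n eq) ]′
    inner-edge : ∀ {a v} → i ≤ a → a + suc v ≤ i + suc w → Below p a (a + suc v) → Edge a (suc v)
    inner-edge i≤a a+v≤ (q , ne) = edge fuel (≤-trans (narrower i≤a a+v≤ ne) w≤) q
    open Chains (Below p) (Below? p) proj₁ i (i + suc w) inner-edge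

  record Total (w : ℕ) : Set where
    field
      list   : List (ℕ × ℕ)
      covers : ∀ {a b} → a < b → b ≤ w → P a b → (a , b) ∈ list
      ℓ h    : ℕ
      count  : length list + ℓ ≡ 2 * w
      loss   : t * h + 1 ≤ ℓ
      size   : w ≤ t * ℓ + c * h

  total : ∀ w → Total (suc w)
  total w = from (chain (suc w) ≤-refl z≤n ≤-refl)
    where
    any-edge : ∀ {i v} → 0 ≤ i → i + suc v ≤ suc w → P i (i + suc v) → Edge i (suc v)
    any-edge {v = v} _ _ p = edge (suc v) ≤-refl p
    open Chains P P? id 0 (suc w) any-edge
    from : Chain P 0 (suc w) → Total (suc w)
    from (inj₂ g) = record { list = list ; covers = covers z≤n ; count = count
      ; loss = ≤-trans (+-monoʳ-≤ (t * h) (s≤s z≤n)) loss ; size = m+n≤o⇒m≤o _ (m+n≤o⇒m≤o _ size) }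
      where open Gapped g
    from (inj₁ g) = record { list = list ; covers = covers z≤n ; count = count
      ; loss = ≤-trans (+-monoʳ-≤ (t * h) r≥1) loss ; size = size′ }
      where
      open Gapless g
      r≥1 : 1 ≤ r
      r≥1 = n≢0⇒n>0 λ { refl → contradiction (path-width-0 {P} {0} {suc w} (paths z≤n)) λ () }

-- From noncrossing relations on ranks back to graphs

inject-length : ∀ {A B : Set} (φ : A → B) {xs ys} → Unique xs → (∀ {x} → x ∈ xs → φ x ∈ ys) →
                (∀ {x y} → x ∈ xs → y ∈ xs → φ x ≡ φ y → x ≡ y) → length xs ≤ length ys
inject-length φ {xs} {ys} unique ∈ys inj = Finₚ.injective⇒≤ {f = λ i → index (∈ys (∈-lookup {xs = xs} i))} λ {i} {j} eq →
  lookup-injective unique (inj (∈-lookup i) (∈-lookup j)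
    (trans (lookup-index (∈ys (∈-lookup i))) (trans (cong (lookup ys) eq) (sym (lookup-index (∈ys (∈-lookup j)))))))

sort-∈ : ∀ {ys : List (ℕ × ℕ)} {a b} → a ≢ b → (a < b → (a , b) ∈ ys) → (b < a → (b , a) ∈ ys) → (a ⊓ b , a ⊔ b) ∈ ys
sort-∈ {ys} {a} {b} a≢b p q with <-cmp a b
... | tri< lt _ _ = subst₂ (λ x y → (x , y) ∈ ys) (sym (m≤n⇒m⊓n≡m (<⇒≤ lt))) (sym (m≤n⇒m⊔n≡n (<⇒≤ lt))) (p lt)
... | tri≈ _ eq _ = contradiction eq a≢b
... | tri> _ _ lt = subst₂ (λ x y → (x , y) ∈ ys) (sym (m≥n⇒m⊓n≡n (<⇒≤ lt))) (sym (m≥n⇒m⊔n≡m (<⇒≤ lt))) (q lt)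

unsort : ∀ {a b c d} → a ⊓ b ≡ c ⊓ d → a ⊔ b ≡ c ⊔ d → (a ≡ c × b ≡ d) ⊎ (a ≡ d × b ≡ c)
unsort {a} {b} {c} {d} p q with ≤-total a b | ≤-total c d
... | inj₁ a≤b | inj₁ c≤d rewrite m≤n⇒m⊓n≡m a≤b | m≤n⇒m⊔n≡n a≤b | m≤n⇒m⊓n≡m c≤d | m≤n⇒m⊔n≡n c≤d = inj₁ (p , q)
... | inj₁ a≤b | inj₂ d≤c rewrite m≤n⇒m⊓n≡m a≤b | m≤n⇒m⊔n≡n a≤b | m≥n⇒m⊓n≡n d≤c | m≥n⇒m⊔n≡m d≤c = inj₂ (p , q)
... | inj₂ b≤a | inj₁ c≤d rewrite m≥n⇒m⊓n≡n b≤a | m≥n⇒m⊔n≡m b≤a | m≤n⇒m⊓n≡m c≤d | m≤n⇒m⊔n≡n c≤d = inj₂ (q , p)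
... | inj₂ b≤a | inj₂ d≤c rewrite m≥n⇒m⊓n≡n b≤a | m≥n⇒m⊔n≡m b≤a | m≥n⇒m⊓n≡n d≤c | m≥n⇒m⊔n≡m d≤c = inj₁ (q , p)

module Rank {n : ℕ} (key : Fin n → ℕ) (key-injective : Injective _≡_ _≡_ key) where

  smaller : Fin n → List (Fin n)
  smaller u = filter (λ v → key v <? key u) (allFin n)

  -- Keys have gaps, whereas the widths in `UpperBound` must count vertices; ranks are the positions
  -- 0, ..., n - 1 in the order of the keys.
  rank : Fin n → ℕ
  rank u = length (smaller u)

  self-unique : ∀ u → Unique (u ∷ smaller u)
  self-unique u = All.tabulate (λ v∈ → λ { refl → <-irrefl refl (proj₂ (∈-filter⁻ (λ v → key v <? key u) {xs = allFin n} v∈)) })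
                  ∷ Uniqueₚ.filter⁺ (λ v → key v <? key u) (Uniqueₚ.allFin⁺ n)

  rank-mono : ∀ {u v} → key u < key v → rank u < rank v
  rank-mono {u} {v} u<v = inject-length id (self-unique u)
    (λ { (here refl) → ∈-filter⁺ (λ w → key w <? key v) (∈-allFin u) u<v
       ; (there w∈) → ∈-filter⁺ (λ w → key w <? key v) (∈-allFin _)
                        (<-trans (proj₂ (∈-filter⁻ (λ w → key w <? key u) {xs = allFin n} w∈)) u<v) })
    (λ _ _ eq → eq)

  rank<n : ∀ u → rank u < n
  rank<n u = subst (rank u <_) (length-tabulate {n = n} id) (inject-length id (self-unique u) (λ _ → ∈-allFin _) (λ _ _ eq → eq))

  rank-reflects : ∀ {u v} → rank u < rank v → key u < key v
  rank-reflects {u} {v} lt with <-cmp (key u) (key v)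
  ... | tri< u<v _ _ = u<v
  ... | tri≈ _ eq _ = contradiction (cong rank (key-injective eq)) (<⇒≢ lt)
  ... | tri> _ _ v<u = contradiction (rank-mono v<u) (<-asym lt)

  rank-injective : Injective _≡_ _≡_ rank
  rank-injective {u} {v} eq with <-cmp (key u) (key v)
  ... | tri< u<v _ _ = contradiction eq (<⇒≢ (rank-mono u<v))
  ... | tri≈ _ eq′ _ = key-injective eq′
  ... | tri> _ _ v<u = contradiction (sym eq) (<⇒≢ (rank-mono v<u))

module _ {n : ℕ} (G : Graph n) (rank : Fin n → ℕ) (rank-injective : Injective _≡_ _≡_ rank) where
  open Graph G

  RankAdj : ℕ → ℕ → Set
  RankAdj i j = ∃₂ λ u v → rank u ≡ i × rank v ≡ j × E u v

  RankAdj? : ∀ i j → Dec (RankAdj i j)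
  RankAdj? i j = Finₚ.any? λ u → Finₚ.any? λ v → (rank u ℕₚ.≟ i) ×-dec (rank v ℕₚ.≟ j) ×-dec E? u v

  trace : ∀ {i j q} → Path RankAdj i j q → ∀ u → rank u ≡ i → ∃ λ (h : ℕ → Fin n) →
          h 0 ≡ u × rank (h q) ≡ j × (∀ {x} → x < q → E (h x) (h (suc x)) × rank (h x) < rank (h (suc x)))
  trace [] u eq = (λ _ → u) , refl , eq , λ ()
  trace (step i<m (u′ , v , p , q , e) path) u eq with rank-injective (trans p (sym eq)) | trace path v q
  ... | refl | h , h0 , hq , steps = h′ , refl , hq , λ { {zero} _ → subst (E u′) (sym h0) e ,
                                            subst₂ _<_ (sym p) (sym (trans (cong rank h0) q)) i<m
                                        ; {suc x} lt → steps (≤-pred lt) }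
    where
    h′ : ℕ → Fin n
    h′ zero = u′
    h′ (suc x) = h x

  close-path : ∀ {i j} q (3≤k : 3 ≤ suc q) → RankAdj i j → Path RankAdj i j q → Contains (cycle (suc q) 3≤k) G
  close-path q 3≤k (u , v , p , r , e) path with trace path u p
  ... | h , h0 , hq , steps = h ∘ toℕ , (λ eq → Finₚ.toℕ-injective (inj (≤-pred (Finₚ.toℕ<n _)) (≤-pred (Finₚ.toℕ<n _)) eq))
                            , λ { {i} {j} (inj₁ eq) → adj i j eq ; {i} {j} (inj₂ eq) → E-sym (adj j i eq) }
    where
    mono : ∀ {x y} → x < y → y ≤ q → rank (h x) < rank (h y)
    mono {x} {suc y} x<1+y y<q with m<1+n⇒m<n∨m≡n x<1+y
    ... | inj₁ x<y = <-trans (mono x<y (<⇒≤ y<q)) (proj₂ (steps y<q))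
    ... | inj₂ refl = proj₂ (steps y<q)
    inj : ∀ {x y} → x ≤ q → y ≤ q → h x ≡ h y → x ≡ y
    inj {x} {y} x≤ y≤ eq with <-cmp x y
    ... | tri< x<y _ _ = contradiction (cong rank eq) (<⇒≢ (mono x<y y≤))
    ... | tri≈ _ x≡y _ = x≡y
    ... | tri> _ _ y<x = contradiction (cong rank (sym eq)) (<⇒≢ (mono y<x x≤))
    adj : ∀ (i j : Fin (suc q)) → suc (toℕ i) % suc q ≡ toℕ j → E (h (toℕ i)) (h (toℕ j))
    adj i j eq with m≤n⇒m<n∨m≡n (≤-pred (Finₚ.toℕ<n i))
    ... | inj₁ i<q = subst (λ x → E (h (toℕ i)) (h x)) (trans (sym (m<n⇒m%n≡m (s≤s i<q))) eq) (proj₁ (steps i<q))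
    ... | inj₂ i≡q = subst₂ E (sym (trans (cong h i≡q) (rank-injective (trans hq (sym r)))))
                       (trans (sym h0) (cong h (trans (sym (n%n≡0 (suc q))) (trans (cong (λ x → suc x % suc q) (sym i≡q)) eq))))
                       (E-sym e)

  -- `edgeList` orients an edge by the numbers of its ends and `ys` by their ranks; sorting the two
  -- ranks is injective on `edgeList` because an edge is listed in one orientation only.
  count-edges : ∀ {ys} → (∀ {u v} → E u v → rank u < rank v → (rank u , rank v) ∈ ys) → #edges ≤ length ys
  count-edges {ys} listed = inject-length sorted (edgeList-unique G) (λ m → sorted-∈ (proj₂ (∈-edgeList⁻ G m))) inj
    where
    sorted : Fin n × Fin n → ℕ × ℕ
    sorted (u , v) = rank u ⊓ rank v , rank u ⊔ rank v
    sorted-∈ : ∀ {u v} → E u v → sorted (u , v) ∈ ys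
    sorted-∈ e = sort-∈ (λ eq → E-irr (rank-injective eq) e) (listed e) (listed (E-sym e))
    inj : ∀ {e e′} → e ∈ edgeList G → e′ ∈ edgeList G → sorted e ≡ sorted e′ → e ≡ e′
    inj {u , v} {u′ , v′} m m′ eq with unsort (cong proj₁ eq) (cong proj₂ eq)
    ... | inj₁ (p , q) = cong₂ _,_ (rank-injective p) (rank-injective q)
    ... | inj₂ (p , q) = contradiction (subst₂ (λ x y → toℕ x < toℕ y) (rank-injective p) (rank-injective q) (proj₁ (∈-edgeList⁻ G m)))
                           (<-asym (proj₁ (∈-edgeList⁻ G m′)))

outerplanar-bound : ∀ w t′ (3≤k : 3 ≤ 3 + t′) (G : Graph (2 + w)) → Outerplanar G → Free (cycle (3 + t′) 3≤k) G →
  ∃₂ λ ℓ h → Graph.#edges G + ℓ ≤ 2 * suc w × suc t′ * h + 1 ≤ ℓ × suc w ≤ suc t′ * ℓ + (suc t′ + t′) * h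
outerplanar-bound w t′ 3≤k G op free = ℓ , h , ≤-trans (+-monoˡ-≤ ℓ edges≤) (≤-reflexive count) , loss , size
  where
  open Graph G
  open Plane op using (key; key-injective; noncrossing)
  open Rank key key-injective
  P = RankAdj G rank rank-injective
  nc : Noncrossing P
  nc a<b b<c c<d (_ , _ , refl , refl , ac) (_ , _ , refl , refl , bd) =
    noncrossing (rank-reflects a<b) (rank-reflects b<c) (rank-reflects c<d) ac bd
  open UpperBound P (RankAdj? G rank rank-injective) nc t′
    (λ p path → free (close-path G rank rank-injective (2 + t′) 3≤k p path))
  open Total (total w)
  edges≤ : #edges ≤ length list
  edges≤ = count-edges G rank rank-injective λ {_} {v} e lt → covers lt (≤-pred (rank<n v)) (_ , v , refl , refl , e)

leastFin : ∀ {n} {P : Fin n → Set} → Decidable P →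
           (∃ λ w → P w × (∀ {x} → P x → toℕ w ≤ toℕ x)) ⊎ (∀ x → ¬ P x)
leastFin {zero} P? = inj₂ λ ()
leastFin {suc n} {P} P? with P? zero | leastFin (P? ∘ suc)
... | yes p | _ = inj₁ (zero , p , λ _ → z≤n)
... | no ¬p | inj₁ (w , p , min) = inj₁ (suc w , p , λ { {zero} q → contradiction q ¬p ; {suc x} q → s≤s (min q) })
... | no ¬p | inj₂ none = inj₂ λ { zero → ¬p ; (suc x) → none x }

-- Outerplanar drawings

-- The path 0, 1, …, n − 1 is drawn on a line and the other edges above it.
module Drawing {m : ℕ} (G : Graph (2 + m))
  (nc : ∀ {a b c d} → toℕ a < toℕ b → toℕ b < toℕ c → toℕ c < toℕ d → Graph.E G a c → Graph.E G b d → ⊥)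
  (spine : ∀ {u v} → toℕ v ≡ suc (toℕ u) → Graph.E G u v) where
  open Graph G

  private
    n : ℕ
    n = 2 + m

  up : {u x : Fin n} → toℕ u < toℕ x → ∃ λ (v : Fin n) → toℕ v ≡ suc (toℕ u)
  up {u} {x} u<x = fromℕ< lt , Finₚ.toℕ-fromℕ< lt
    where lt = ≤-<-trans u<x (Finₚ.toℕ<n x)

  down : {u x : Fin n} → toℕ x < toℕ u → ∃ λ (v : Fin n) → toℕ u ≡ suc (toℕ v)
  down {suc u} _ = inject₁ u , cong suc (sym (Finₚ.toℕ-inject₁ u))

  above : (v u : Fin n) → (∃ λ (w : Fin n) → (toℕ u < toℕ w × E v w) × (∀ {x} → toℕ u < toℕ x × E v x → toℕ w ≤ toℕ x))
                  ⊎ (∀ x → ¬ (toℕ u < toℕ x × E v x))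
  above v u = leastFin (λ w → (toℕ u <? toℕ w) ×-dec E? v w)

  neighbour : (u : Fin n) → ∃ λ (v : Fin n) → E u v
  neighbour zero = 1F , spine {zero} {1F} refl
  neighbour (suc u) = inject₁ u , E-sym (spine {inject₁ u} {suc u} (cong suc (sym (Finₚ.toℕ-inject₁ u))))

  abstract
    lowest : (v : Fin n) → ∃ λ (w : Fin n) → E v w × (∀ {x : Fin n} → E v x → toℕ w ≤ toℕ x)
    lowest v with leastFin (E? v)
    ... | inj₁ found = found
    ... | inj₂ none = contradiction (proj₂ (neighbour v)) (none _)

    low : Fin n → Fin n
    low v = proj₁ (lowest v)
    low-E : ∀ v → E v (low v)
    low-E v = proj₁ (proj₂ (lowest v))
    low-min : ∀ v {x} → E v x → toℕ (low v) ≤ toℕ x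
    low-min v = proj₂ (proj₂ (lowest v))

    -- The neighbours of v in cyclically increasing order.
    rot : Fin n → Fin n → Fin n
    rot v u with E? v u | above v u
    ... | yes _ | inj₁ (w , _) = w
    ... | yes _ | inj₂ _ = low v
    ... | no _ | _ = u

  data Rot (v u : Fin n) : Fin n → Set where
    higher : ∀ {w} → toℕ u < toℕ w → E v w → (∀ {x} → toℕ u < toℕ x → E v x → toℕ w ≤ toℕ x) → Rot v u w
    wrap   : (∀ {x} → E v x → toℕ x ≤ toℕ u) → Rot v u (low v)

  abstract
    rot-spec : ∀ {v u} → E v u → Rot v u (rot v u)
    rot-spec {v} {u} e with E? v u | above v u
    ... | yes _ | inj₁ (w , (lt , e′) , min) = higher lt e′ (λ lt e → min (lt , e))
    ... | yes _ | inj₂ none = wrap λ {x} e → ≮⇒≥ λ lt → none x (lt , e)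
    ... | no ¬e | _ = contradiction e ¬e

    rot-nonadjacent : ∀ {v u} → ¬ E v u → rot v u ≡ u
    rot-nonadjacent {v} {u} ¬e with E? v u | above v u
    ... | yes e | _ = contradiction e ¬e
    ... | no _ | inj₁ _ = refl
    ... | no _ | inj₂ _ = refl

  rot-closed : ∀ {v u} → E v u → E v (rot v u)
  rot-closed {v} {u} e = go (rot-spec e)
    where
    go : ∀ {w} → Rot v u w → E v w
    go (higher _ e′ _) = e′
    go (wrap _) = low-E v

  rot-cyclic : ∀ {v x y} → E v x → E v y → Star (λ x y → rot v x ≡ y) x y
  rot-cyclic {v} {x} {y} ex ey = to-low n ex (m≤n+m n _) ◅◅ climb n (low-E v) ey (low-min v ey) (m≤n⇒m≤n+o _ (<⇒≤ (Finₚ.toℕ<n y)))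
    where
    climb : ∀ f {x y} → E v x → E v y → toℕ x ≤ toℕ y → toℕ y ≤ f + toℕ x → Star (λ x y → rot v x ≡ y) x y
    climb f {x} {y} ex ey x≤y y≤ with m≤n⇒m<n∨m≡n x≤y
    ... | inj₂ eq = subst (Star _ x) (Finₚ.toℕ-injective eq) ε
    climb zero ex ey x≤y y≤ | inj₁ lt = contradiction y≤ (<⇒≱ lt)
    climb (suc f) {x} {y} ex ey x≤y y≤ | inj₁ lt = go (rot-spec ex) refl
      where
      go : ∀ {w} → Rot v x w → rot v x ≡ w → Star (λ x y → rot v x ≡ y) x y
      go (higher {w} x<w ew min) eq = eq ◅ climb f ew ey (min lt ey)
        (≤-trans y≤ (≤-trans (≤-reflexive (sym (+-suc f (toℕ x)))) (+-monoʳ-≤ f x<w)))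
      go (wrap max) eq = contradiction (max ey) (<⇒≱ lt)
    to-low : ∀ f {x} → E v x → n ≤ toℕ x + f → Star (λ x y → rot v x ≡ y) x (low v)
    to-low zero {x} ex le = contradiction (≤-trans le (≤-reflexive (+-identityʳ _))) (<⇒≱ (Finₚ.toℕ<n x))
    to-low (suc f) {x} ex le = go (rot-spec ex) refl
      where
      go : ∀ {w} → Rot v x w → rot v x ≡ w → Star (λ x y → rot v x ≡ y) x (low v)
      go (higher {w} x<w ew _) eq = eq ◅ to-low f ew (≤-trans le (≤-trans (≤-reflexive (+-suc (toℕ x) f)) (+-monoˡ-≤ f x<w)))
      go (wrap _) eq = eq ◅ ε

  rotation : RotationSystem G
  rotation = record { rot = rot ; closed = rot-closed ; cyclic = rot-cyclic }

  open RotationSystem rotation using (next; SameFace)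

  Encloses : (c x a b : Fin n) → Set
  Encloses c x a b = toℕ a ≤ toℕ c × toℕ x ≤ toℕ b × E a b × ¬ (a ≡ c × b ≡ x)

  -- This identifies the face above the edge `c x`: it lies directly below the innermost enclosing
  -- edge, and for `nothing` it is the outer face.
  Innermost : (c x : Fin n) → Maybe (Fin n × Fin n) → Set
  Innermost c x nothing = ∀ {a b} → ¬ Encloses c x a b
  Innermost c x (just (a , b)) = Encloses c x a b × (∀ {a′ b′} → Encloses c x a′ b′ → toℕ a′ ≤ toℕ a × toℕ b ≤ toℕ b′)

  Innermost-unique : ∀ {c x ℓ ℓ′} → Innermost c x ℓ → Innermost c x ℓ′ → ℓ ≡ ℓ′
  Innermost-unique {ℓ = nothing} {nothing} p q = refl
  Innermost-unique {ℓ = nothing} {just _} p (q , _) = contradiction q p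
  Innermost-unique {ℓ = just _} {nothing} (p , _) q = contradiction p q
  Innermost-unique {ℓ = just (a , b)} {just (a′ , b′)} (p , p-min) (q , q-min) =
    cong₂ (λ x y → just (x , y))
      (Finₚ.toℕ-injective (≤-antisym (proj₁ (q-min p)) (proj₁ (p-min q))))
      (Finₚ.toℕ-injective (≤-antisym (proj₂ (p-min q)) (proj₂ (q-min p))))

  Innermost-map : ∀ {c x c′ x′ ℓ} → (∀ {a b} → Encloses c x a b → Encloses c′ x′ a b) →
                  (∀ {a b} → Encloses c′ x′ a b → Encloses c x a b) → Innermost c x ℓ → Innermost c′ x′ ℓ
  Innermost-map {ℓ = nothing} to from p q = p (from q)
  Innermost-map {ℓ = just _} to from (p , min) = to p , min ∘ from

  module _ {c x : Fin n} (c<x : toℕ c < toℕ x) (e : E c x) where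

    enclosed-by-higher : ∀ {d} → toℕ x < toℕ d → E c d → (∀ {y} → toℕ x < toℕ y → E c y → toℕ d ≤ toℕ y) →
                         Innermost c x (just (c , d))
    enclosed-by-higher {d} x<d e′ min = (≤-refl , <⇒≤ x<d , e′ , λ { (_ , refl) → <-irrefl refl x<d })
                                      , λ { {a} {b} (a≤c , x≤b , ab , ne) → a≤c , d≤ a≤c x≤b ab ne }
      where
      d≤ : ∀ {a b} → toℕ a ≤ toℕ c → toℕ x ≤ toℕ b → E a b → ¬ (a ≡ c × b ≡ x) → toℕ d ≤ toℕ b
      d≤ {a} {b} a≤c x≤b ab ne with m≤n⇒m<n∨m≡n a≤c
      ... | inj₁ a<c = ≮⇒≥ λ b<d → nc a<c (<-≤-trans c<x x≤b) b<d ab e′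
      ... | inj₂ eq with Finₚ.toℕ-injective {i = a} {c} eq | m≤n⇒m<n∨m≡n x≤b
      ...   | refl | inj₁ x<b = min x<b ab
      ...   | refl | inj₂ x≡b = contradiction (refl , sym (Finₚ.toℕ-injective x≡b)) ne

    module _ (max : ∀ {y} → E c y → toℕ y ≤ toℕ x) where

      left-end : ∀ {a b} → Encloses c x a b → toℕ a < toℕ c
      left-end {a} {b} (a≤c , x≤b , ab , ne) = ≤∧≢⇒< a≤c λ eq → ne (Finₚ.toℕ-injective eq ,
        Finₚ.toℕ-injective (≤-antisym (max (subst (λ a → E a b) (Finₚ.toℕ-injective eq) ab)) x≤b))

      module _ (low<c : toℕ (low c) < toℕ c) where

        -- When `x` is the largest neighbour of `c`, the edge from `c` to `x` and the edge from
        -- `low c` to `c` lie below the same edges. The search for the innermost one can therefore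
        -- move to a smaller left end.
        outwards : ∀ {a b} → Encloses c x a b → Encloses (low c) c a b
        outwards {a} {b} enc@(a≤c , x≤b , ab , ne) =
            ≮⇒≥ (λ low<a → nc low<a (left-end enc) (<-≤-trans c<x x≤b) (E-sym (low-E c)) ab)
          , ≤-trans (<⇒≤ c<x) x≤b , ab , λ { (_ , refl) → <⇒≱ c<x x≤b }

        inwards : ∀ {a b} → Encloses (low c) c a b → Encloses c x a b
        inwards {a} {b} (a≤low , c≤b , ab , ne) with m≤n⇒m<n∨m≡n c≤b
        ... | inj₂ eq with Finₚ.toℕ-injective eq
        ...   | refl = contradiction (Finₚ.toℕ-injective (≤-antisym a≤low (low-min c (E-sym ab))) , refl) ne
        inwards {a} {b} (a≤low , c≤b , ab , ne) | inj₁ c<b =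
            <⇒≤ a<c , ≮⇒≥ (λ b<x → nc a<c c<b b<x ab e) , ab , λ { (refl , _) → <-irrefl refl a<c }
          where
          a<c = ≤-<-trans a≤low low<c

  low<-or-0 : (c : Fin n) → toℕ (low c) < toℕ c ⊎ (c ≡ zero × toℕ (low c) ≡ 1)
  low<-or-0 (suc c) = inj₁ (s≤s (≤-trans (low-min (suc c) (E-sym (spine (cong suc (sym (Finₚ.toℕ-inject₁ c)))))) (≤-reflexive (Finₚ.toℕ-inject₁ c))))
  low<-or-0 zero = inj₂ (refl , ≤-antisym (low-min zero {1F} (spine refl)) (pos (low-E zero)))
    where
    pos : ∀ {v} → E zero v → 1 ≤ toℕ v
    pos {zero} e = contradiction e (E-irr refl)
    pos {suc v} e = s≤s z≤n

  innermost : ∀ f {c x} → toℕ c < f → toℕ c < toℕ x → E c x → ∃ (Innermost c x)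
  innermost (suc f) {c} {x} c<f c<x e with above c x
  ... | inj₁ (d , (x<d , e′) , min) = just (c , d) , enclosed-by-higher c<x e x<d e′ (λ lt e → min (lt , e))
  ... | inj₂ none with low<-or-0 c
  ...   | inj₁ low<c = let ℓ , inn = innermost f (<-≤-trans low<c (≤-pred c<f)) low<c (E-sym (low-E c)) in
                       ℓ , Innermost-map {ℓ = ℓ} (inwards c<x e max low<c) (outwards c<x e max low<c) inn
    where
    max : ∀ {y} → E c y → toℕ y ≤ toℕ x
    max {y} ey = ≮⇒≥ λ lt → none y (lt , ey)
  ...   | inj₂ (refl , _) = nothing , λ enc → contradiction (left-end c<x e max enc) λ ()
    where
    max : ∀ {y} → E c y → toℕ y ≤ toℕ x
    max {y} ey = ≮⇒≥ λ lt → none y (lt , ey)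

  -- Each edge uv with v > u + 1 has a face below it, and the outer face is labelled nothing.
  data Label (u v : Fin n) : Maybe (Fin n × Fin n) → Set where
    short : toℕ v ≡ suc (toℕ u) → Label u v nothing
    long  : suc (toℕ u) < toℕ v → Label u v (just (u , v))
    back  : ∀ {ℓ} → toℕ v < toℕ u → Innermost v u ℓ → Label u v ℓ

  label : ∀ {u v} → E u v → ∃ (Label u v)
  label {u} {v} e with <-cmp (suc (toℕ u)) (toℕ v)
  ... | tri< lt _ _ = _ , long lt
  ... | tri≈ _ eq _ = _ , short (sym eq)
  ... | tri> _ _ gt with m≤n⇒m<n∨m≡n (≤-pred gt)
  ...   | inj₁ v<u = let ℓ , inn = innermost (suc (toℕ v)) ≤-refl v<u (E-sym e) in ℓ , back v<u inn
  ...   | inj₂ eq = contradiction e (E-irr (sym (Finₚ.toℕ-injective eq)))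

  Label-unique : ∀ {u v ℓ ℓ′} → Label u v ℓ → Label u v ℓ′ → ℓ ≡ ℓ′
  Label-unique (short _) (short _) = refl
  Label-unique (short p) (long q) = contradiction (sym p) (<⇒≢ q)
  Label-unique (short p) (back q _) = contradiction (≤-trans (n≤1+n _) (≤-reflexive (sym p))) (<⇒≱ q)
  Label-unique (long p) (short q) = contradiction (sym q) (<⇒≢ p)
  Label-unique (long _) (long _) = refl
  Label-unique (long p) (back q _) = contradiction (<-trans (n<1+n _) p) (<-asym q)
  Label-unique (back p _) (short q) = contradiction (≤-trans (n≤1+n _) (≤-reflexive (sym q))) (<⇒≱ p)
  Label-unique (back p _) (long q) = contradiction (<-trans (n<1+n _) q) (<-asym p)
  Label-unique (back _ p) (back _ q) = Innermost-unique p q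

  -- The spine decides the turns. A spine edge is followed by the next one, or at the last vertex by
  -- a return over the top. Under a long edge the walk turns to a neighbour of `v` inside it, as
  -- `v − 1` is one. On the way back it either finds the innermost enclosing edge at `v` itself or
  -- goes on to `low v`.
  Label-next : ∀ {u v ℓ} → E u v → Label u v ℓ → Label v (rot v u) ℓ
  Label-next {u} {v} e lab = go lab (rot-spec (E-sym e))
    where
    go : ∀ {ℓ w} → Label u v ℓ → Rot v u w → Label v w ℓ
    go (short eq) (higher {w} u<w e′ min) = short (≤-antisym
        (let z , eq-z = up {v} {w} v<w in ≤-trans (min (≤-trans (≤-reflexive (sym eq)) (≤-trans (n≤1+n _) (≤-reflexive (sym eq-z)))) (spine {v} {z} eq-z)) (≤-reflexive eq-z))
        v<w)
      where
      v<w : toℕ v < toℕ w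
      v<w = ≤∧≢⇒< (≤-trans (≤-reflexive eq) u<w) λ p → E-irr (Finₚ.toℕ-injective p) e′
    go (short eq) (wrap max) = back (≤-<-trans (max (low-E v)) u<v) λ { {a} {b} (a≤ , v≤b , ab , ne) → bad a≤ v≤b ab ne }
      where
      u<v : toℕ u < toℕ v
      u<v = ≤-reflexive (sym eq)
      bad : ∀ {a b} → toℕ a ≤ toℕ (low v) → toℕ v ≤ toℕ b → E a b → ¬ (a ≡ low v × b ≡ v) → ⊥
      bad {a} {b} a≤ v≤b ab ne with m≤n⇒m<n∨m≡n v≤b
      ... | inj₁ v<b = let z , eq-z = up {v} {b} v<b in <⇒≱ u<v (≤-trans (≤-trans (n≤1+n _) (≤-reflexive (sym eq-z))) (max (spine {v} {z} eq-z)))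
      ... | inj₂ v≡b with Finₚ.toℕ-injective v≡b
      ...   | refl = ne (Finₚ.toℕ-injective (≤-antisym a≤ (low-min v (E-sym ab))) , refl)
    go (long lt) (higher {w} u<w e′ min) = back w<v ((<⇒≤ u<w , ≤-refl , e , λ { (refl , _) → <-irrefl refl u<w })
                                                , λ { {a} {b} (a≤w , v≤b , ab , ne) → a≤u a≤w v≤b ab ne , v≤b })
      where
      w<v : toℕ w < toℕ v
      w<v = let z , eq-z = down {v} {u} (<-trans (n<1+n _) lt) in
        ≤-trans (s≤s (min (≤-pred (≤-trans lt (≤-reflexive eq-z))) (E-sym (spine {z} {v} eq-z)))) (≤-reflexive (sym eq-z))
      a≤u : ∀ {a b} → toℕ a ≤ toℕ w → toℕ v ≤ toℕ b → E a b → ¬ (a ≡ w × b ≡ v) → toℕ a ≤ toℕ u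
      a≤u {a} {b} a≤w v≤b ab ne = ≮⇒≥ λ u<a → [ (λ v<b → nc u<a (≤-<-trans a≤w w<v) v<b e ab)
                , (λ v≡b → bad u<a (Finₚ.toℕ-injective v≡b)) ]′ (m≤n⇒m<n∨m≡n v≤b)
        where
        bad : toℕ u < toℕ a → v ≡ b → ⊥
        bad u<a refl = ne (Finₚ.toℕ-injective (≤-antisym a≤w (min u<a (E-sym ab))) , refl)
    go (long lt) (wrap max) = let z , eq-z = down {v} {u} (<-trans (n<1+n _) lt) in
      contradiction (max (E-sym (spine {z} {v} eq-z))) (<⇒≱ (≤-pred (≤-trans lt (≤-reflexive eq-z))))
    go {ℓ} (back v<u inn) (higher {d} u<d e′ min) = subst (Label v d) (Innermost-unique {ℓ = just (v , d)} {ℓ} (enclosed-by-higher v<u (E-sym e) u<d e′ min) inn)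
      (long (≤-trans (s≤s v<u) u<d))
    go {ℓ} (back v<u inn) (wrap max) with low<-or-0 v
    ... | inj₁ low<v = back low<v (Innermost-map {ℓ = ℓ} (outwards v<u (E-sym e) max low<v) (inwards v<u (E-sym e) max low<v) inn)
    ... | inj₂ (refl , low≡1) = subst (Label v (low v)) (Innermost-unique {ℓ = nothing} {ℓ}
            (λ enc → contradiction (left-end v<u (E-sym e) max enc) λ ()) inn) (short low≡1)

  -- One dart per label; since every dart walks to that of its label, equal labels mean equal faces.
  canonical : Maybe (Fin n × Fin n) → Fin n × Fin n
  canonical nothing = zero , 1F
  canonical (just d) = d

  Walk : Fin n × Fin n → Fin n × Fin n → Set
  Walk = Star (λ d e → next d ≡ e)

  back-short : ∀ {u v} → toℕ v < toℕ u → E u v → toℕ (rot v u) ≡ suc (toℕ v) → v ≡ zero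
  back-short {u} {v} v<u e eq = go (rot-spec (E-sym e)) refl
    where
    go : ∀ {w} → Rot v u w → rot v u ≡ w → v ≡ zero
    go (higher u<w _ _) refl = contradiction (≤-trans u<w (≤-reflexive eq)) (<⇒≱ (s≤s v<u))
    go (wrap _) eq′ with low<-or-0 v
    ... | inj₁ low<v = contradiction (≤-trans (n≤1+n _) (≤-reflexive (sym (trans (cong toℕ (sym eq′)) eq)))) (<⇒≱ low<v)
    ... | inj₂ (eq″ , _) = eq″

  walk-back : ∀ f {u v ℓ} → toℕ v < f → toℕ v < toℕ u → E u v → Label v (rot v u) ℓ → Walk (u , v) (canonical ℓ)
  walk-back (suc f) {u} {v} v<f v<u e (short eq) with back-short v<u e eq
  ... | refl = cong (zero ,_) (Finₚ.toℕ-injective eq) ◅ ε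
  walk-back (suc f) v<f v<u e (long lt) = refl ◅ ε
  walk-back (suc f) {u} {v} v<f v<u e (back lt inn) = refl ◅ walk-back f (<-≤-trans lt (≤-pred v<f)) lt e′ (Label-next e′ (back lt inn))
    where
    e′ : E v (rot v u)
    e′ = rot-closed (E-sym e)

  walk-up : ∀ f {u v} → n ≤ toℕ u + f → toℕ v ≡ suc (toℕ u) → E u v → Walk (u , v) (canonical nothing)
  walk-up zero {u} le eq e = contradiction (≤-trans le (≤-reflexive (+-identityʳ _))) (<⇒≱ (Finₚ.toℕ<n u))
  walk-up (suc f) {u} {v} le eq e = go refl (Label-next e (short eq))
    where
    e′ : E v (rot v u)
    e′ = rot-closed (E-sym e)
    go : ∀ {ℓ} → nothing ≡ ℓ → Label v (rot v u) ℓ → Walk (u , v) (canonical nothing)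
    go _ (short eq′) = refl ◅ walk-up f (≤-trans le (≤-reflexive (trans (+-suc (toℕ u) f) (cong (_+ f) (sym eq))))) eq′ e′
    go () (long lt)
    go refl lab@(back lt _) = refl ◅ walk-back (suc (toℕ (rot v u))) ≤-refl lt e′ (Label-next e′ lab)

  walk : ∀ {u v ℓ} → E u v → Label u v ℓ → Walk (u , v) (canonical ℓ)
  walk {u} e (short eq) = walk-up n (m≤n+m n (toℕ u)) eq e
  walk e (long _) = ε
  walk {v = v} e (back lt inn) = walk-back (suc (toℕ v)) ≤-refl lt e (Label-next e (back lt inn))

  Label-walk : ∀ {d d′ ℓ} → E (proj₁ d) (proj₂ d) → Label (proj₁ d) (proj₂ d) ℓ → Walk d d′ → Label (proj₁ d′) (proj₂ d′) ℓ
  Label-walk e lab ε = lab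
  Label-walk {u , v} e lab (refl ◅ w) = Label-walk (rot-closed (E-sym e)) (Label-next e lab) w

  -- As `rot` fixes the nonneighbours, `next` permutes all pairs, and a facial walk can be reversed
  -- by going around its orbit.
  rot-injective′ : ∀ {v u w} → rot v u ≡ rot v w → u ≡ w
  rot-injective′ {v} {u} {w} eq with E? v u | E? v w
  ... | yes e | yes e′ = rot-injective rotation e e′ eq
  ... | yes e | no ¬e′ = contradiction (subst (E v) (trans eq (rot-nonadjacent ¬e′)) (rot-closed e)) ¬e′
  ... | no ¬e | yes e′ = contradiction (subst (E v) (trans (sym eq) (rot-nonadjacent ¬e)) (rot-closed e′)) ¬e
  ... | no ¬e | no ¬e′ = trans (sym (rot-nonadjacent ¬e)) (trans eq (rot-nonadjacent ¬e′))

  next-injective : Injective _≡_ _≡_ next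
  next-injective {u , v} {u′ , v′} eq with cong proj₁ eq
  ... | refl = cong (_, v) (rot-injective′ (cong proj₂ eq))

  walk-sym : ∀ {d e} → Walk d e → Walk e d
  walk-sym w = from-reach (reach-sym next-injective (to-reach w))
    where
    to-reach : ∀ {d e} → Walk d e → Reaches next d e
    to-reach ε = 0 , refl
    to-reach (refl ◅ w) = reach-trans (1 , refl) (to-reach w)
    from-iter : ∀ j d → Walk d (iter next j d)
    from-iter zero d = ε
    from-iter (suc j) d = from-iter j d ◅◅ (refl ◅ ε)
    from-reach : ∀ {d e} → Reaches next d e → Walk d e
    from-reach {d} (j , eq) = subst (Walk d) eq (from-iter j d)

  long? : Decidable {A = Fin n × Fin n} (λ (u , v) → suc (toℕ u) < toℕ v)
  long? (u , v) = suc (toℕ u) <? toℕ v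

  longEdges : List (Fin n × Fin n)
  longEdges = filter long? (edgeList G)

  ∈-longEdges : ∀ {u v} → suc (toℕ u) < toℕ v → E u v → (u , v) ∈ longEdges
  ∈-longEdges lt e = ∈-filter⁺ long? (∈-edgeList⁺ G (<-trans (n<1+n _) lt) e) lt

  F : ℕ
  F = suc (length longEdges)

  Inner : Maybe (Fin n × Fin n) → Set
  Inner nothing = ⊤
  Inner (just d) = d ∈ longEdges

  number : ∀ ℓ → Inner ℓ → Fin F
  number nothing _ = zero
  number (just d) p = suc (index p)

  number-injective : ∀ {ℓ ℓ′} (p : Inner ℓ) (q : Inner ℓ′) → number ℓ p ≡ number ℓ′ q → ℓ ≡ ℓ′
  number-injective {nothing} {nothing} p q eq = refl
  number-injective {just d} {just e} p q eq = cong just (trans (lookup-index p)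
    (trans (cong (lookup longEdges) (Finₚ.suc-injective eq)) (sym (lookup-index q))))

  number-cong : ∀ {ℓ ℓ′} (p : Inner ℓ) (q : Inner ℓ′) → ℓ ≡ ℓ′ → number ℓ p ≡ number ℓ′ q
  number-cong {nothing} p q refl = refl
  number-cong {just d} p q refl = cong suc (lookup-injective (Uniqueₚ.filter⁺ long? (edgeList-unique G))
    (trans (sym (lookup-index p)) (lookup-index q)))

  Label-inner : ∀ {u v ℓ} → E u v → Label u v ℓ → Inner ℓ
  Label-inner e (short _) = _
  Label-inner e (long lt) = ∈-longEdges lt e
  Label-inner {ℓ = nothing} e (back _ _) = _
  Label-inner {u} {v} {just (a , b)} e (back v<u ((a≤v , u≤b , ab , ne) , _)) = ∈-longEdges (≤∧≢⇒< (≤-<-trans a≤v (<-≤-trans v<u u≤b)) λ eq →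
    ne ( Finₚ.toℕ-injective (≤-antisym a≤v (≤-pred (≤-trans v<u (≤-trans u≤b (≤-reflexive (sym eq))))))
       , Finₚ.toℕ-injective (≤-antisym (≤-trans (≤-reflexive (sym eq)) (≤-trans (s≤s a≤v) v<u)) u≤b))) ab

  faceLabel : (d : Dart) → ∃ (Label (proj₁ (proj₁ d)) (proj₂ (proj₁ d)))
  faceLabel (_ , e) = label e

  face : Dart → Fin F
  face d = number (proj₁ (faceLabel d)) (Label-inner (proj₂ d) (proj₂ (faceLabel d)))

  face-≡ : ∀ {u v ℓ} (e : E u v) → Label u v ℓ → (p : Inner ℓ) → face ((u , v) , e) ≡ number ℓ p
  face-≡ e lab p = number-cong _ p (Label-unique (proj₂ (label e)) lab)

  faces : Classes SameFace F
  faces = record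
    { class = face
    ; onto = onto
    ; exact = λ {d} {e} → mk⇔ (to {d} {e}) (from {d} {e}) }
    where
    first : E zero 1F
    first = spine {zero} {1F} refl
    onto : StrictlySurjective _≡_ face
    onto zero = ((zero , 1F) , first) , face-≡ first (short refl) _
    onto (suc i) = ((proj₁ d , proj₂ d) , proj₂ (∈-edgeList⁻ G (proj₁ spec))) ,
        trans (face-≡ _ (long (proj₂ spec)) (∈-lookup i)) (cong suc (lookup-injective (Uniqueₚ.filter⁺ long? (edgeList-unique G))
          (sym (lookup-index (∈-lookup {xs = longEdges} i)))))
      where
      d = lookup longEdges i
      spec = ∈-filter⁻ long? {xs = edgeList G} (∈-lookup {xs = longEdges} i)
    to : ∀ {d e} → face d ≡ face e → SameFace d e
    to {d , p} {e , q} eq = walk p (proj₂ (label p)) ◅◅ walk-sym (subst (λ ℓ → Walk e (canonical ℓ))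
      (sym (number-injective (Label-inner p (proj₂ (label p))) (Label-inner q (proj₂ (label q))) eq)) (walk q (proj₂ (label q))))
    from : ∀ {d e} → SameFace d e → face d ≡ face e
    from {d , p} {e , q} w = number-cong (Label-inner p (proj₂ (label p))) (Label-inner q (proj₂ (label q)))
      (Label-unique (Label-walk p (proj₂ (label p)) w) (proj₂ (label q)))

  connected : ∀ u v → Connected u v
  connected u v = reverse E-sym (from-0 u) ◅◅ from-0 v
    where
    from-0′ : ∀ i (i<n : i < n) → Connected zero (fromℕ< i<n)
    from-0′ zero i<n = ε
    from-0′ (suc i) i<n = from-0′ i i<n′ ◅◅ (spine (trans (Finₚ.toℕ-fromℕ< i<n) (cong suc (sym (Finₚ.toℕ-fromℕ< i<n′)))) ◅ ε)
      where i<n′ = <-trans (n<1+n i) i<n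
    from-0 : ∀ v → Connected zero v
    from-0 v = subst (Connected zero) (Finₚ.fromℕ<-toℕ v (Finₚ.toℕ<n v)) (from-0′ (toℕ v) (Finₚ.toℕ<n v))

  components : Classes Connected 1
  components = record { class = λ _ → zero ; onto = λ { zero → zero , refl }
                      ; exact = λ {u} {v} → mk⇔ (λ _ → connected u v) (λ _ → refl) }

  shortEdge : Fin (suc m) → Fin n × Fin n
  shortEdge i = inject₁ i , suc i

  shortEdge-injective : Injective _≡_ _≡_ shortEdge
  shortEdge-injective eq = Finₚ.suc-injective (cong proj₂ eq)

  edges≡ : #edges ≡ suc m + length longEdges
  edges≡ = trans (≤-antisym (inject-length id (edgeList-unique G) to (λ _ _ eq → eq)) (inject-length id unique′ from (λ _ _ eq → eq)))
                 (trans (length-++ (map shortEdge (allFin (suc m)))) (cong (_+ length longEdges)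
                   (trans (length-map shortEdge (allFin (suc m))) (length-tabulate {n = suc m} id))))
    where
    shorts = map shortEdge (allFin (suc m))
    to : ∀ {d} → d ∈ edgeList G → d ∈ shorts ++ longEdges
    to {u , v} d∈ with ∈-edgeList⁻ G d∈
    ... | u<v , e with m≤n⇒m<n∨m≡n u<v
    ...   | inj₁ lt = ∈-++⁺ʳ shorts (∈-longEdges lt e)
    to {u , suc v} d∈ | u<v , e | inj₂ eq = ∈-++⁺ˡ (subst (λ u → (u , suc v) ∈ shorts)
              (Finₚ.toℕ-injective (trans (Finₚ.toℕ-inject₁ v) (sym (suc-injective eq)))) (∈-map⁺ shortEdge (∈-allFin v)))
    from : ∀ {d} → d ∈ shorts ++ longEdges → d ∈ edgeList G
    from d∈ with ∈-++⁻ shorts d∈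
    ... | inj₂ d∈ = proj₁ (∈-filter⁻ long? {xs = edgeList G} d∈)
    ... | inj₁ d∈ with ∈-map⁻ shortEdge d∈
    ...   | i , _ , refl = ∈-edgeList⁺ G (≤-reflexive (cong suc (Finₚ.toℕ-inject₁ i))) (spine (cong suc (sym (Finₚ.toℕ-inject₁ i))))
    unique′ : Unique (shorts ++ longEdges)
    unique′ = Uniqueₚ.++⁺ (Uniqueₚ.map⁺ shortEdge-injective (Uniqueₚ.allFin⁺ (suc m))) (Uniqueₚ.filter⁺ long? (edgeList-unique G)) disjoint
      where
      disjoint : ∀ {d} → d ∈ shorts × d ∈ longEdges → ⊥
      disjoint (p , q) with ∈-map⁻ shortEdge p
      ... | i , _ , refl = <-irrefl (cong suc (Finₚ.toℕ-inject₁ i)) (proj₂ (∈-filter⁻ long? {xs = edgeList G} q))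

  isolated≡ : #isolated ≡ 0
  isolated≡ = cong length (filter-none (λ u → Finₚ.all? (λ v → ¬? (E? u v))) {xs = allFin n}
    (All.tabulate λ {u} _ iso → iso _ (proj₂ (neighbour u))))

  outerplanar : Outerplanar G
  outerplanar = record
    { embedding = record
      { rotation = rotation ; faces = faces ; components = components
      ; euler = trans (cong (λ i → n + (F + i)) isolated≡) (trans (arith m (length longEdges)) (cong (_+ 2 * 1) (sym edges≡))) }
    ; outer = ⁅ zero ⁆
    ; unique = λ d d′ _ p q → trans (x∈⁅y⁆⇒x≡y zero p) (sym (x∈⁅y⁆⇒x≡y zero q))
    ; incident = λ u → inj₂ (incident u) }
    where
    arith : ∀ m l → 2 + m + (suc l + 0) ≡ suc m + l + 2 * 1
    arith = solve-∀
    on-outer : ∀ {u v} (e : E u v) → Label u v nothing → face ((u , v) , e) ∈ˢ ⁅ zero ⁆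
    on-outer e lab = subst (_∈ˢ ⁅ zero ⁆) (sym (face-≡ e lab _)) (x∈⁅x⁆ zero)
    incident : ∀ u → ∃ λ v → Σ (E u v) λ d → face ((u , v) , d) ∈ˢ ⁅ zero ⁆
    incident zero = 1F , first , on-outer first (short refl)
      where
      first : E zero 1F
      first = spine {zero} {1F} refl
    incident (suc u) = rot (suc u) (inject₁ u) , rot-closed (E-sym e) , on-outer (rot-closed (E-sym e)) (Label-next e (short eq))
      where
      eq : suc (toℕ u) ≡ suc (toℕ (inject₁ u))
      eq = cong suc (sym (Finₚ.toℕ-inject₁ u))
      e : E (inject₁ u) (suc u)
      e = spine {inject₁ u} {suc u} eq

-- Cycles in noncrossing graphs

module Cycles (P : ℕ → ℕ → Set) (P⇒< : ∀ {i j} → P i j → i < j) (nc : Noncrossing P) where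

  Adj : ℕ → ℕ → Set
  Adj i j = P i j ⊎ P j i

  Adj-< : ∀ {i j} → Adj i j → i < j → P i j
  Adj-< (inj₁ p) _ = p
  Adj-< (inj₂ p) lt = contradiction (P⇒< p) (<-asym lt)

  record Cyclic (q : ℕ) (d : ℕ → ℕ) : Set where
    field
      adj  : ∀ {x} → x < q → Adj (d x) (d (suc x))
      last : Adj (d q) (d 0)
      inj  : ∀ {x y} → x ≤ q → y ≤ q → d x ≡ d y → x ≡ y
      min  : ∀ {x} → x ≤ q → d 0 ≤ d x

  module _ {q d} (C : Cyclic q d) (0<q : 0 < q) (forward : d 1 < d q) where
    open Cyclic C

    -- The rest of the cycle cannot cross the edge from d x to d (x + 1).
    increasing : ∀ x {y} → x < y → y ≤ q → d x < d y
    increasing zero {y} x<y y≤q = ≤∧≢⇒< (min y≤q) λ eq → contradiction (inj z≤n y≤q eq) (<⇒≢ x<y)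
    increasing (suc x) {y} x<y y≤q = descend (q ∸ y) (trans (+-comm y (q ∸ y)) (m∸n+n≡m y≤q)) x<y
      where
      x<q : x < q
      x<q = <-≤-trans (<-trans (n<1+n x) x<y) y≤q
      1+x≤q = x<q
      edge : P (d x) (d (suc x))
      edge = Adj-< (adj x<q) (increasing x ≤-refl 1+x≤q)
      below : ∀ {y} → suc x < y → y ≤ q → ¬ (d y < d (suc x)) → d (suc x) < d y
      below x<y y≤q ≮ = ≤∧≢⇒< (≮⇒≥ ≮) λ eq → contradiction (inj 1+x≤q y≤q eq) (<⇒≢ x<y)
      start : ∀ z → z ≡ x → suc x < q → d (suc x) < d q
      start zero refl _ = forward
      start (suc z) refl x<q′ = below x<q′ ≤-refl λ lt →
        nc (increasing 0 z<s (<⇒≤ x<q)) (increasing x x<q ≤-refl) lt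
           (Adj-< (swap last) (increasing 0 0<q ≤-refl)) edge
      descend : ∀ f {y} → y + f ≡ q → suc x < y → d (suc x) < d y
      descend zero {y} eq x<y with trans (sym (+-identityʳ y)) eq
      ... | refl = start x refl x<y
      descend (suc f) {y} eq x<y = below x<y (<⇒≤ y<q) λ lt →
          nc (increasing x (<-trans (n<1+n x) x<y) (<⇒≤ y<q)) lt later edge (Adj-< (adj y<q) (<-trans lt later))
        where
        y<q : y < q
        y<q = subst (y <_) eq (m<m+n y z<s)
        later : d (suc x) < d (suc y)
        later = descend f (trans (sym (+-suc y f)) eq) (m≤n⇒m≤1+n x<y)

    cyclic-path : Path P (d 0) (d q) q
    cyclic-path = go q 0 (+-identityʳ q)
      where
      go : ∀ f x → f + x ≡ q → Path P (d x) (d q) f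
      go zero x refl = []
      go (suc f) x eq = step lt (Adj-< (adj x<q) lt) (go f (suc x) (trans (+-suc f x) eq))
        where
        x<q : x < q
        x<q = subst (x <_) eq (m<n+m x z<s)
        lt = increasing x ≤-refl x<q

    cyclic-closed : P (d 0) (d q)
    cyclic-closed = Adj-< (swap last) (increasing 0 0<q ≤-refl)

  reversed : (ℕ → ℕ) → ℕ → ℕ → ℕ
  reversed d q zero = d zero
  reversed d q (suc x) = d (q ∸ x)

  reverse-cyclic : ∀ {q d} → Cyclic (suc q) d → Cyclic (suc q) (reversed d (suc q))
  reverse-cyclic {q} {d} C = record
    { adj = adj′ ; last = subst (λ z → Adj (d z) (d 0)) (sym (m+n∸n≡m 1 q)) (swap (adj z<s))
    ; inj = inj′ ; min = λ { {zero} _ → ≤-refl ; {suc x} _ → min (m∸n≤m (suc q) x) } }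
    where
    open Cyclic C
    adj′ : ∀ {x} → x < suc q → Adj (reversed d (suc q) x) (d (suc q ∸ x))
    adj′ {zero} _ = swap last
    adj′ {suc x} x<q = swap (subst (λ z → Adj (d (q ∸ x)) (d z)) (sym (+-∸-assoc 1 {q} {x} (<⇒≤ (≤-pred x<q)))) (adj (s≤s (m∸n≤m q x))))
    positive : ∀ {x} → suc x ≤ suc q → suc q ∸ x ≢ 0
    positive x≤q eq = <⇒≱ x≤q (m∸n≡0⇒m≤n eq)
    inj′ : ∀ {x y} → x ≤ suc q → y ≤ suc q → reversed d (suc q) x ≡ reversed d (suc q) y → x ≡ y
    inj′ {zero} {zero} _ _ _ = refl
    inj′ {zero} {suc y} _ y≤ eq = contradiction (sym (inj z≤n (m∸n≤m (suc q) y) eq)) (positive y≤)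
    inj′ {suc x} {zero} x≤ _ eq = contradiction (inj (m∸n≤m (suc q) x) z≤n eq) (positive x≤)
    inj′ {suc x} {suc y} x≤ y≤ eq = cong suc (∸-cancelˡ-≡ (<⇒≤ x≤) (<⇒≤ y≤) (inj (m∸n≤m (suc q) x) (m∸n≤m (suc q) y) eq))

  -- From its smallest vertex a cycle can be traversed in two directions; the one that leaves
  -- towards the smaller neighbour is increasing.
  cyclic⇒path : ∀ q {d} → Cyclic (2 + q) d → ∃₂ λ i j → P i j × Path P i j (2 + q)
  cyclic⇒path q {d} C with <-cmp (d 1) (d (2 + q))
  ... | tri< lt _ _ = _ , _ , cyclic-closed C z<s lt , cyclic-path C z<s lt
  ... | tri≈ _ eq _ = contradiction (Cyclic.inj C (s≤s z≤n) ≤-refl eq) λ ()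
  ... | tri> _ _ gt = _ , _ , cyclic-closed R z<s lt , cyclic-path R z<s lt
    where
    R = reverse-cyclic C
    lt : d (2 + q) < d (suc q ∸ q)
    lt = subst (λ z → d (2 + q) < d z) (sym (m+n∸n≡m 1 q)) gt

  %-absorb : ∀ m n k .{{_ : NonZero k}} → (m % k + n) % k ≡ (m + n) % k
  %-absorb m n k = trans (%-distribˡ-+ (m % k) n k) (trans (cong (λ z → (z + n % k) % k) (m%n%n≡m%n m k)) (sym (%-distribˡ-+ m n k)))

  minimum : ∀ {k} (h : Fin (suc k) → ℕ) → ∃ λ i → ∀ j → h i ≤ h j
  minimum {zero} h = zero , λ { zero → ≤-refl }
  minimum {suc k} h with minimum (h ∘ suc)
  ... | i , min with ≤-total (h zero) (h (suc i))
  ...   | inj₁ le = zero , λ { zero → ≤-refl ; (suc j) → ≤-trans le (min j) }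
  ...   | inj₂ ge = suc i , λ { zero → ge ; (suc j) → min j }

  module _ {q n} (3≤k : 3 ≤ 3 + q) (G : Graph n)
    (E⇒Adj : ∀ {u v} → Graph.E G u v → Adj (toℕ u) (toℕ v)) where
    private k = 3 + q

    cycle⇒path : Contains (cycle k 3≤k) G → ∃₂ λ i j → P i j × Path P i j (2 + q)
    cycle⇒path (h , h-inj , h-E) = cyclic⇒path q {d} record
      { adj = λ _ → adj-d _
      ; last = subst (Adj (d (2 + q))) d-k (adj-d (2 + q))
      ; inj = λ x≤ y≤ eq → d-inj (s≤s x≤) (s≤s y≤) eq
      ; min = λ {x} _ → subst (λ z → toℕ (h z) ≤ d x) (sym at-a) (proj₂ (minimum (toℕ ∘ h)) (at (a + x))) }
      where
      start = proj₁ (minimum (toℕ ∘ h))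
      a = toℕ start
      at : ℕ → Fin k
      at x = fromℕ< (m%n<n x k)
      toℕ-at : ∀ x → toℕ (at x) ≡ x % k
      toℕ-at x = Finₚ.toℕ-fromℕ< (m%n<n x k)
      at-a : at (a + 0) ≡ start
      at-a = Finₚ.toℕ-injective (trans (toℕ-at (a + 0)) (trans (cong (_% k) (+-identityʳ a)) (m<n⇒m%n≡m (Finₚ.toℕ<n start))))
      d : ℕ → ℕ
      d x = toℕ (h (at (a + x)))
      d-k : d k ≡ d 0
      d-k = cong (toℕ ∘ h) (Finₚ.toℕ-injective (trans (toℕ-at (a + k)) (trans ([m+n]%n≡m%n a k)
              (trans (cong (_% k) (sym (+-identityʳ a))) (sym (toℕ-at (a + 0)))))))
      adj-d : ∀ x → Adj (d x) (d (suc x))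
      adj-d x = E⇒Adj (h-E (inj₁ (begin
        suc (toℕ (at (a + x))) % k ≡⟨ cong (λ z → suc z % k) (toℕ-at (a + x)) ⟩
        suc ((a + x) % k) % k ≡⟨ cong (_% k) (+-comm 1 ((a + x) % k)) ⟩
        ((a + x) % k + 1) % k ≡⟨ %-absorb (a + x) 1 k ⟩
        (a + x + 1) % k ≡⟨ cong (_% k) (arith a x) ⟩
        (a + suc x) % k ≡⟨ toℕ-at (a + suc x) ⟨
        toℕ (at (a + suc x)) ∎)))
        where
        open ≡-Reasoning
        arith : ∀ a x → a + x + 1 ≡ a + suc x
        arith = solve-∀
      -- Adding `k ∸ a` undoes the rotation of the indices that moved the smallest vertex to the
      -- front.
      back : ∀ {x} → x < k → ((a + x) % k + (k ∸ a)) % k ≡ x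
      back {x} x<k = begin
        ((a + x) % k + (k ∸ a)) % k ≡⟨ %-absorb (a + x) (k ∸ a) k ⟩
        (a + x + (k ∸ a)) % k ≡⟨ cong (_% k) (arith a x (k ∸ a)) ⟩
        (x + (a + (k ∸ a))) % k ≡⟨ cong (λ z → (x + z) % k) (m+[n∸m]≡n (<⇒≤ (Finₚ.toℕ<n start))) ⟩
        (x + k) % k ≡⟨ [m+n]%n≡m%n x k ⟩
        x % k ≡⟨ m<n⇒m%n≡m x<k ⟩
        x ∎
        where
        open ≡-Reasoning
        arith : ∀ a x b → a + x + b ≡ x + (a + b)
        arith = solve-∀
      d-inj : ∀ {x y} → x < k → y < k → d x ≡ d y → x ≡ y
      d-inj {x} {y} x<k y<k eq = trans (sym (back x<k)) (trans (cong (λ z → (z + (k ∸ a)) % k)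
        (trans (sym (toℕ-at (a + x))) (trans (cong toℕ (h-inj (Finₚ.toℕ-injective eq))) (toℕ-at (a + y))))) (back y<k))

-- Trees of faces

Edges : Set
Edges = List (ℕ × ℕ)

Adjacent : Edges → ℕ → ℕ → Set
Adjacent es i j = (i , j) ∈ es

-- What `Drawing` requires, in a form that survives joining two pieces at a common vertex and adding
-- an edge on top.
record Strip (o e : ℕ) (es : Edges) : Set where
  field
    o<e    : o < e
    within : ∀ {i j} → (i , j) ∈ es → o ≤ i × i < j × j ≤ e
    nc     : Noncrossing (Adjacent es)
    unique : Unique es
    spine  : ∀ {i} → o ≤ i → i < e → (i , suc i) ∈ es

strip-leaf : ∀ o → Strip o (suc o) [ (o , suc o) ]
strip-leaf o = record
  { o<e = ≤-refl
  ; within = λ { (here refl) → ≤-refl , ≤-refl , ≤-refl }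
  ; nc = λ { a<b b<c c<d (here refl) (here refl) → <-irrefl refl a<b }
  ; unique = All.[] ∷ []
  ; spine = λ o≤i i<e → here (cong (λ i → i , suc i) (≤-antisym (≤-pred i<e) o≤i)) }

module _ {o m e L R} (l : Strip o m L) (r : Strip m e R) where
  private
    module l = Strip l
    module r = Strip r

  strip-join : Strip o e (L ++ R)
  strip-join = record
    { o<e = <-trans l.o<e r.o<e
    ; within = [ (λ p → let a , b , c = l.within p in a , b , ≤-trans c (<⇒≤ r.o<e))
               , (λ p → let a , b , c = r.within p in ≤-trans (<⇒≤ l.o<e) a , b , c) ]′ ∘ ∈-++⁻ L
    ; nc = λ a<b b<c c<d p q → crossing a<b b<c c<d (∈-++⁻ L p) (∈-++⁻ L q)
    ; unique = Uniqueₚ.++⁺ l.unique r.unique λ (p , q) →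
        <⇒≱ (proj₁ (proj₂ (l.within p))) (≤-trans (proj₂ (proj₂ (l.within p))) (proj₁ (r.within q)))
    ; spine = spine }
    where
    crossing : ∀ {a b c d} → a < b → b < c → c < d → (a , c) ∈ L ⊎ (a , c) ∈ R → (b , d) ∈ L ⊎ (b , d) ∈ R → ⊥
    crossing a<b b<c c<d (inj₁ p) (inj₁ q) = l.nc a<b b<c c<d p q
    crossing a<b b<c c<d (inj₁ p) (inj₂ q) = <⇒≱ b<c (≤-trans (proj₂ (proj₂ (l.within p))) (proj₁ (r.within q)))
    crossing a<b b<c c<d (inj₂ p) (inj₁ q) = <⇒≱ (<-trans a<b (<-trans b<c c<d)) (≤-trans (proj₂ (proj₂ (l.within q))) (proj₁ (r.within p)))
    crossing a<b b<c c<d (inj₂ p) (inj₂ q) = r.nc a<b b<c c<d p q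
    spine : ∀ {i} → o ≤ i → i < e → (i , suc i) ∈ L ++ R
    spine {i} o≤i i<e with i <? m
    ... | yes i<m = ∈-++⁺ˡ (l.spine o≤i i<m)
    ... | no i≮m = ∈-++⁺ʳ L (r.spine (≮⇒≥ i≮m) i<e)

  strip-root : Strip o e ((o , e) ∷ L ++ R)
  strip-root = record
    { o<e = j.o<e
    ; within = λ { (here refl) → ≤-refl , j.o<e , ≤-refl ; (there p) → j.within p }
    ; nc = λ { a<b b<c c<d (here refl) (here refl) → <-irrefl refl a<b
             ; a<b b<c c<d (here refl) (there q) → <⇒≱ c<d (proj₂ (proj₂ (j.within q)))
             ; a<b b<c c<d (there p) (here refl) → <⇒≱ a<b (proj₁ (j.within p))
             ; a<b b<c c<d (there p) (there q) → j.nc a<b b<c c<d p q }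
    ; unique = All.tabulate (λ p → λ { refl → root∉ (∈-++⁻ L p) }) ∷ j.unique
    ; spine = λ o≤i i<e → there (j.spine o≤i i<e) }
    where
    module j = Strip strip-join
    root∉ : (o , e) ∈ L ⊎ (o , e) ∈ R → ⊥
    root∉ (inj₁ p) = <⇒≱ r.o<e (proj₂ (proj₂ (l.within p)))
    root∉ (inj₂ p) = <⇒≱ l.o<e (proj₁ (r.within p))

  path-right : ∀ {x y q} → m ≤ x → Path (Adjacent (L ++ R)) x y q → Path (Adjacent R) x y q
  path-right m≤x [] = []
  path-right m≤x (step lt p path) with ∈-++⁻ L p
  ... | inj₁ p∈L = contradiction (≤-trans (proj₂ (proj₂ (l.within p∈L))) m≤x) (<⇒≱ lt)
  ... | inj₂ p∈R = step lt p∈R (path-right (≤-trans m≤x (<⇒≤ lt)) path)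

  path-left : ∀ {x y q} → y ≤ m → Path (Adjacent (L ++ R)) x y q → Path (Adjacent L) x y q
  path-left y≤m [] = []
  path-left y≤m (step lt p path) with ∈-++⁻ L p
  ... | inj₁ p∈L = step lt p∈L (path-left y≤m path)
  ... | inj₂ p∈R = contradiction (≤-trans (≤-trans (m≤m+n _ _) (path-≤ path)) y≤m)
                     (<⇒≱ (≤-<-trans (proj₁ (r.within p∈R)) lt))

  -- No edge of `L ++ R` passes over the cut vertex `m`, so the path visits it.
  path-split : ∀ {x y q} → x ≤ m → m ≤ y → Path (Adjacent (L ++ R)) x y q →
               ∃₂ λ q₁ q₂ → q ≡ q₁ + q₂ × Path (Adjacent L) x m q₁ × Path (Adjacent R) m y q₂
  path-split {x} x≤m m≤y [] with ≤-antisym x≤m m≤y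
  ... | refl = 0 , 0 , refl , [] , []
  path-split x≤m m≤y (step lt p path) with ∈-++⁻ L p
  ... | inj₁ p∈L = let q₁ , q₂ , eq , p₁ , p₂ = path-split (proj₂ (proj₂ (l.within p∈L))) m≤y path in
                   suc q₁ , q₂ , cong suc eq , step lt p∈L p₁ , p₂
  ... | inj₂ p∈R with ≤-antisym x≤m (proj₁ (r.within p∈R))
  ...   | refl = 0 , _ , refl , [] , step lt p∈R (path-right (<⇒≤ lt) path)

  path-inner : ∀ {x y q} → o < x → Path (Adjacent ((o , e) ∷ L ++ R)) x y q → Path (Adjacent (L ++ R)) x y q
  path-inner o<x [] = []
  path-inner o<x (step lt (here refl) path) = contradiction o<x (<-irrefl refl)
  path-inner o<x (step lt (there p) path) = step lt p (path-inner (<-trans o<x lt) path)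

  -- A path that uses the edge from `o` to `e` has no room before or after it.
  path-root : ∀ {x y q} → o ≤ x → y ≤ e → Path (Adjacent ((o , e) ∷ L ++ R)) x y q →
              q ≡ 1 ⊎ Path (Adjacent (L ++ R)) x y q
  path-root o≤x y≤e [] = inj₂ []
  path-root o≤x y≤e (step {q = zero} lt (here refl) path) = inj₁ refl
  path-root o≤x y≤e (step {q = suc q} lt (here refl) path) = contradiction (≤-trans (path-≤ path) y≤e) (<⇒≱ (m<m+n _ z<s))
  path-root o≤x y≤e (step lt (there p) path) = inj₂ (step lt p (path-inner (≤-<-trans o≤x lt) path))

mutual
  data Tree : Set where
    leaf : Tree
    node : Tree → Forest → Tree

  data Forest : Set where
    one  : Tree → Forest
    cons : Tree → Forest → Forest

mutual
  width : Tree → ℕ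
  width leaf = 1
  width (node t f) = width t + widths f

  widths : Forest → ℕ
  widths (one t) = width t
  widths (cons t f) = width t + widths f

-- A node is an inner face; it lies below the edge o, o + width, and its
-- other edges are those above its children.
mutual
  edges : Tree → ℕ → Edges
  edges leaf o = [ (o , suc o) ]
  edges (node t f) o = (o , o + (width t + widths f)) ∷ edges t o ++ edgess f (o + width t)

  edgess : Forest → ℕ → Edges
  edgess (one t) o = edges t o
  edgess (cons t f) o = edges t o ++ edgess f (o + width t)

strip-cong : ∀ {o e e′ es} → e ≡ e′ → Strip o e es → Strip o e′ es
strip-cong refl S = S

mutual
  strip : ∀ t o → Strip o (o + width t) (edges t o)
  strip leaf o = strip-cong (+-comm 1 o) (strip-leaf o)
  strip (node t f) o = strip-root (strip t o) (strips′ t f o)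

  strips : ∀ f o → Strip o (o + widths f) (edgess f o)
  strips (one t) o = strip t o
  strips (cons t f) o = strip-join (strip t o) (strips′ t f o)

  strips′ : ∀ t f o → Strip (o + width t) (o + (width t + widths f)) (edgess f (o + width t))
  strips′ t f o = strip-cong (+-assoc o (width t) (widths f)) (strips f (o + width t))

mutual
  -- The possible lengths of paths from one end of the root edge to the other: the edge itself, or a
  -- detour through all children. They turn the absence of a cycle into a condition on the tree
  -- alone.
  Len : Tree → ℕ → Set
  Len leaf q = q ≡ 1
  Len (node t f) q = q ≡ 1 ⊎ Len⁺ t f q

  Lens : Forest → ℕ → Set
  Lens (one t) q = Len t q
  Lens (cons t f) q = Len⁺ t f q

  Len⁺ : Tree → Forest → ℕ → Set
  Len⁺ t f q = ∃₂ λ q₁ q₂ → q ≡ q₁ + q₂ × Len t q₁ × Lens f q₂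

mutual
  path-len : ∀ t {o q} → Path (Adjacent (edges t o)) o (o + width t) q → Len t q
  path-len leaf {o} path = leaf-len path (+-comm o 1)
    where
    leaf-len : ∀ {o e q} → Path (Adjacent [ (o , suc o) ]) o e q → e ≡ suc o → q ≡ 1
    leaf-len [] eq = contradiction eq (<⇒≢ ≤-refl)
    leaf-len (step _ (here refl) []) eq = refl
    leaf-len (step _ (here refl) (step _ (here ()) _)) eq
  path-len (node t f) {o} path with path-root (strip t o) (strips′ t f o) ≤-refl ≤-refl path
  ... | inj₁ eq = inj₁ eq
  ... | inj₂ path′ = inj₂ (path-len⁺ t f path′)

  path-lens : ∀ f {o q} → Path (Adjacent (edgess f o)) o (o + widths f) q → Lens f q
  path-lens (one t) path = path-len t path
  path-lens (cons t f) path = path-len⁺ t f path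

  path-len⁺ : ∀ t f {o q} → Path (Adjacent (edges t o ++ edgess f (o + width t))) o (o + (width t + widths f)) q → Len⁺ t f q
  path-len⁺ t f {o} path with path-split (strip t o) (strips′ t f o) (m≤m+n o _) (+-monoʳ-≤ o (m≤m+n _ _)) path
  ... | q₁ , q₂ , eq , p₁ , p₂ = q₁ , q₂ , eq , path-len t p₁ ,
        path-lens f (subst (λ e → Path (Adjacent (edgess f (o + width t))) (o + width t) e q₂) (sym (+-assoc o (width t) (widths f))) p₂)

module _ (K : ℕ) where

  mutual
    -- With `K = k − 1`: a `k`-cycle consists of its longest edge and an increasing path of `K`
    -- edges below, so it suffices to exclude such detours under each node.
    Good : Tree → Set
    Good leaf = ⊤
    Good (node t f) = Good t × Goods f × ¬ Len⁺ t f K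

    Goods : Forest → Set
    Goods (one t) = Good t
    Goods (cons t f) = Good t × Goods f

  module _ (2≤K : 2 ≤ K) where

    mutual
      acyclic : ∀ t {o i j} → Good t → (i , j) ∈ edges t o → Path (Adjacent (edges t o)) i j K → ⊥
      acyclic leaf {o} _ (here refl) path =
        contradiction (≤-trans (path-≤ path) (≤-reflexive (+-comm 1 o))) (<⇒≱ (+-monoʳ-< o 2≤K))
      acyclic (node t f) {o} (good-t , goods-f , ¬len) p path with path-root l r (proj₁ (within p)) (proj₂ (proj₂ (within p))) path
        where
        l = strip t o
        r = strips′ t f o
        open Strip (strip-root l r)
      ... | inj₁ eq = contradiction 2≤K (<⇒≱ (≤-reflexive (cong suc eq)))
      ... | inj₂ path′ with p
      ...   | here refl = ¬len (path-len⁺ t f path′)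
      ...   | there p′ = acyclic⁺ t f good-t goods-f p′ path′

      acyclics : ∀ f {o i j} → Goods f → (i , j) ∈ edgess f o → Path (Adjacent (edgess f o)) i j K → ⊥
      acyclics (one t) good p path = acyclic t good p path
      acyclics (cons t f) (good , goods) p path = acyclic⁺ t f good goods p path

      acyclic⁺ : ∀ t f {o i j} → Good t → Goods f → (i , j) ∈ edges t o ++ edgess f (o + width t) →
                 Path (Adjacent (edges t o ++ edgess f (o + width t))) i j K → ⊥
      acyclic⁺ t f {o} good goods p path with ∈-++⁻ (edges t o) p
      ... | inj₁ p∈ = acyclic t good p∈ (path-left (strip t o) (strips′ t f o) (proj₂ (proj₂ (Strip.within (strip t o) p∈))) path)
      ... | inj₂ p∈ = acyclics f goods p∈ (path-right (strip t o) (strips′ t f o) (proj₁ (Strip.within (strips f (o + width t)) p∈)) path)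

-- Graphs from strips

module Realise {m : ℕ} {es : Edges} (S : Strip 0 (suc m) es) where
  open Strip S

  private
    n : ℕ
    n = 2 + m

  graph : Graph n
  graph = record
    { E = λ u v → (toℕ u , toℕ v) ∈ es ⊎ (toℕ v , toℕ u) ∈ es
    ; E? = λ u v → ((toℕ u , toℕ v) ∈? es) ⊎-dec ((toℕ v , toℕ u) ∈? es)
    ; E-sym = swap
    ; E-irr = λ { refl → [ irr , irr ]′ } }
    where
    open import Data.List.Membership.DecPropositional (≡-dec ℕₚ._≟_ ℕₚ._≟_) using (_∈?_)
    irr : ∀ {i} → (i , i) ∈ es → ⊥
    irr p = <-irrefl refl (proj₁ (proj₂ (within p)))

  open Graph graph

  E-< : ∀ {u v} → E u v → toℕ u < toℕ v → (toℕ u , toℕ v) ∈ es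
  E-< (inj₁ p) lt = p
  E-< (inj₂ p) lt = contradiction (proj₁ (proj₂ (within p))) (<-asym lt)

  graph-outerplanar : Outerplanar graph
  graph-outerplanar = Drawing.outerplanar graph
    (λ {a} {b} {c} {d} a<b b<c c<d p q → nc a<b b<c c<d (E-< p (<-trans a<b b<c)) (E-< q (<-trans b<c c<d)))
    (λ {u} {v} eq → inj₁ (subst (λ j → (toℕ u , j) ∈ es) (sym eq) (spine z≤n (≤-trans (≤-reflexive (sym eq)) (≤-pred (Finₚ.toℕ<n v))))))

  graph-free : ∀ {q} (3≤k : 3 ≤ 3 + q) → (∀ {i j} → (i , j) ∈ es → Path (Adjacent es) i j (2 + q) → ⊥) → Free (cycle (3 + q) 3≤k) graph
  graph-free 3≤k none C = let _ , _ , p , path = Cycles.cycle⇒path (Adjacent es) (proj₁ ∘ proj₂ ∘ within) nc 3≤k graph id C in none p path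

  clip : ℕ → Fin n
  clip i with i <? n
  ... | yes lt = fromℕ< lt
  -- A default that is never reached, since `within` bounds both ends of an edge by `suc m`.
  ... | no _ = zero

  toℕ-clip : ∀ {i} → i < n → toℕ (clip i) ≡ i
  toℕ-clip {i} lt with i <? n
  ... | yes lt′ = Finₚ.toℕ-fromℕ< lt′
  ... | no ≮ = contradiction lt ≮

  -- The reverse inequality will come from the upper bound, applied to this graph.
  graph-edges : length es ≤ #edges
  graph-edges = inject-length (λ (i , j) → clip i , clip j) unique
    (λ { {i , j} p → let _ , i<j , j≤ = within p in ∈-edgeList⁺ graph
          (subst₂ _<_ (sym (toℕ-clip (<-trans i<j (s≤s j≤)))) (sym (toℕ-clip (s≤s j≤))) i<j)
          (inj₁ (subst₂ (λ i j → (i , j) ∈ es) (sym (toℕ-clip (<-trans i<j (s≤s j≤)))) (sym (toℕ-clip (s≤s j≤))) p)) })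
    (λ { {i , j} {i′ , j′} p p′ eq → let _ , i<j , j≤ = within p ; _ , i<j′ , j≤′ = within p′ in cong₂ _,_
          (trans (sym (toℕ-clip (<-trans i<j (s≤s j≤)))) (trans (cong (toℕ ∘ proj₁) eq) (toℕ-clip (<-trans i<j′ (s≤s j≤′)))))
          (trans (sym (toℕ-clip (s≤s j≤))) (trans (cong (toℕ ∘ proj₂) eq) (toℕ-clip (s≤s j≤′)))) })

-- Extremal graphs

mutual
  size : Tree → ℕ
  size leaf = 1
  size (node t f) = suc (size t + sizes f)

  sizes : Forest → ℕ
  sizes (one t) = size t
  sizes (cons t f) = size t + sizes f

mutual
  length-edges : ∀ t o → length (edges t o) ≡ size t
  length-edges leaf o = refl
  length-edges (node t f) o = cong suc (trans (length-++ (edges t o)) (cong₂ _+_ (length-edges t o) (length-edgess f (o + width t))))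

  length-edgess : ∀ f o → length (edgess f o) ≡ sizes f
  length-edgess (one t) o = length-edges t o
  length-edgess (cons t f) o = trans (length-++ (edges t o)) (cong₂ _+_ (length-edges t o) (length-edgess f (o + width t)))

-- All triangles share the left end of `x`. Each adds 1 to the width and 2 to the size, so the loss
-- stays that of `x`.
fan : ℕ → Tree → Tree
fan zero x = x
fan (suc s) x = node (fan s x) (one leaf)

copies : ℕ → Tree → Forest
copies zero x = one x
copies (suc c) x = cons x (copies c x)

width-fan : ∀ s x → width (fan s x) ≡ s + width x
width-fan zero x = refl
width-fan (suc s) x = trans (+-comm (width (fan s x)) 1) (cong suc (width-fan s x))

size-fan : ∀ s x → size (fan s x) ≡ 2 * s + size x
size-fan zero x = refl
size-fan (suc s) x = trans (cong (λ z → suc (z + 1)) (size-fan s x)) (arith s (size x))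
  where
  arith : ∀ s z → suc (2 * s + z + 1) ≡ 2 * suc s + z
  arith = solve-∀

widths-copies : ∀ c x → widths (copies c x) ≡ suc c * width x
widths-copies zero x = sym (*-identityˡ (width x))
widths-copies (suc c) x = cong (λ z → width x + z) (widths-copies c x)

sizes-copies : ∀ c x → sizes (copies c x) ≡ suc c * size x
sizes-copies zero x = sym (*-identityˡ (size x))
sizes-copies (suc c) x = cong (λ z → size x + z) (sizes-copies c x)

module Extremal (t′ : ℕ) where

  private
    t K M : ℕ
    t = suc t′
    K = suc t
    M = t * t + t + t′

  full : Tree
  full = fan t′ leaf

  -- A face with k + 1 edges: its upper edge, t + 2 = k children.
  heavy : ℕ → Tree → Tree
  heavy s x = node (fan t′ x) (cons (fan s leaf) (copies t′ full))

  -- Each storey raises the width by `M = t² + 2 t − 1 = k² − 2 k − 1` and the loss by `t`, which is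
  -- the rate of the upper bound.
  tower : ℕ → Tree
  tower zero = leaf
  tower (suc b) = heavy t′ (tower b)

  blocks : ℕ → ℕ → Forest
  blocks zero b = one (fan b leaf)
  blocks (suc a) b = cons full (blocks a b)

  width-heavy : ∀ s x → width (heavy s x) ≡ (t′ + width x) + ((s + 1) + t * (t′ + 1))
  width-heavy s x = cong₂ _+_ (width-fan t′ x) (cong₂ _+_ (width-fan s leaf)
    (trans (widths-copies t′ full) (cong (λ z → t * z) (width-fan t′ leaf))))

  size-heavy : ∀ s x → size (heavy s x) ≡ suc ((2 * t′ + size x) + ((2 * s + 1) + t * (2 * t′ + 1)))
  size-heavy s x = cong suc (cong₂ _+_ (size-fan t′ x) (cong₂ _+_ (size-fan s leaf)
    (trans (sizes-copies t′ full) (cong (λ z → t * z) (size-fan t′ leaf)))))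

  width-tower : ∀ b → width (tower b) ≡ 1 + b * M
  width-tower zero = refl
  width-tower (suc b) = trans (width-heavy t′ (tower b)) (trans (cong (λ z → (t′ + z) + ((t′ + 1) + t * (t′ + 1))) (width-tower b)) (arith t′ (b * M)))
    where
    arith : ∀ t′ z → (t′ + suc z) + ((t′ + 1) + suc t′ * (t′ + 1)) ≡ suc ((suc t′ * suc t′ + suc t′ + t′) + z)
    arith = solve-∀

  loss-heavy : ∀ s x ℓ → size x + ℓ ≡ 2 * width x → size (heavy s x) + (t + ℓ) ≡ 2 * width (heavy s x)
  loss-heavy s x ℓ eq = trans (cong (_+ (t + ℓ)) (size-heavy s x)) (trans (arith t′ s (size x) ℓ) (trans (cong (λ z → z + 2 * (t′ + ((s + 1) + t * (t′ + 1)))) eq)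
    (trans (arith′ t′ s (width x)) (cong (λ z → 2 * z) (sym (width-heavy s x))))))
    where
    arith : ∀ t′ s x ℓ → suc ((2 * t′ + x) + ((2 * s + 1) + suc t′ * (2 * t′ + 1))) + (suc t′ + ℓ)
            ≡ (x + ℓ) + 2 * (t′ + ((s + 1) + suc t′ * (t′ + 1)))
    arith = solve-∀
    arith′ : ∀ t′ s w → 2 * w + 2 * (t′ + ((s + 1) + suc t′ * (t′ + 1))) ≡ 2 * ((t′ + w) + ((s + 1) + suc t′ * (t′ + 1)))
    arith′ = solve-∀

  loss-fan : ∀ s x ℓ → size x + ℓ ≡ 2 * width x → size (fan s x) + ℓ ≡ 2 * width (fan s x)
  loss-fan s x ℓ eq = trans (cong (_+ ℓ) (size-fan s x)) (trans (+-assoc (2 * s) (size x) ℓ) (trans (cong (λ z → 2 * s + z) eq)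
    (trans (sym (*-distribˡ-+ 2 s (width x))) (cong (λ z → 2 * z) (sym (width-fan s x))))))

  loss-tower : ∀ b → size (tower b) + (t * b + 1) ≡ 2 * width (tower b)
  loss-tower zero = cong (λ z → 1 + (z + 1)) (*-zeroʳ t)
  loss-tower (suc b) = trans (cong (λ z → size (tower (suc b)) + z) (arith t b)) (loss-heavy t′ (tower b) (t * b + 1) (loss-tower b))
    where
    arith : ∀ t b → t * suc b + 1 ≡ t + (t * b + 1)
    arith = solve-∀

  width-blocks : ∀ a b → widths (blocks a b) ≡ t * a + (b + 1)
  width-blocks zero b = trans (width-fan b leaf) (cong (_+ (b + 1)) (sym (*-zeroʳ t)))
  width-blocks (suc a) b = trans (cong₂ _+_ (width-fan t′ leaf) (width-blocks a b)) (arith t′ a b)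
    where
    arith : ∀ t′ a b → t′ + 1 + (suc t′ * a + (b + 1)) ≡ suc t′ * suc a + (b + 1)
    arith = solve-∀

  loss-blocks : ∀ a b → sizes (blocks a b) + suc a ≡ 2 * widths (blocks a b)
  loss-blocks zero b = loss-fan b leaf 1 refl
  loss-blocks (suc a) b = trans (arith (size full) (sizes (blocks a b)) a) (trans (cong₂ _+_ (loss-fan t′ leaf 1 refl) (loss-blocks a b))
    (sym (*-distribˡ-+ 2 (width full) (widths (blocks a b)))))
    where
    arith : ∀ x y a → x + y + suc (suc a) ≡ (x + 1) + (y + suc a)
    arith = solve-∀

  -- Detours below the root edge are too long to take part in a path of `K` edges, so in a fan the
  -- tree behaves like a leaf.
  Extreme : Tree → Set
  Extreme x = ∀ {q} → Len x q → q ≡ 1 ⊎ K < q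

  mutual
    len-pos : ∀ x {q} → Len x q → 1 ≤ q
    len-pos leaf refl = ≤-refl
    len-pos (node t f) (inj₁ refl) = ≤-refl
    len-pos (node t f) (inj₂ (q₁ , q₂ , refl , l , _)) = ≤-trans (len-pos t l) (m≤m+n q₁ q₂)

  lens-copies : ∀ c x {q} → Lens (copies c x) q → suc c ≤ q
  lens-copies zero x l = len-pos x l
  lens-copies (suc c) x (q₁ , q₂ , refl , l , ls) = +-mono-≤ (len-pos x l) (lens-copies c x ls)

  len-fan : ∀ s {x} → Extreme x → ∀ {q} → Len (fan s x) q → q ≤ suc s ⊎ K < q
  len-fan zero ext l = [ inj₁ ∘ ≤-reflexive , inj₂ ]′ (ext l)
  len-fan (suc s) ext (inj₁ refl) = inj₁ (s≤s z≤n)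
  len-fan (suc s) ext (inj₂ (q₁ , _ , refl , l , refl)) =
    [ (λ q≤ → inj₁ (≤-trans (≤-reflexive (+-comm q₁ 1)) (s≤s q≤))) , (λ K< → inj₂ (≤-trans K< (m≤m+n q₁ 1))) ]′ (len-fan s ext l)

  good-fan : ∀ s {x} → s ≤ t′ → Extreme x → Good K x → Good K (fan s x)
  good-fan zero s≤ ext good = good
  good-fan (suc s) s≤ ext good = good-fan s (≤-trans (n≤1+n s) s≤) ext good , tt , λ { (q₁ , _ , eq , l , refl) →
    [ (λ q≤ → <⇒≱ (s≤s (s≤s s≤)) (≤-trans (≤-reflexive (trans eq (+-comm q₁ 1))) (s≤s q≤)))
    , (λ K< → <⇒≱ K< (≤-trans (m≤m+n q₁ 1) (≤-reflexive (sym eq)))) ]′ (len-fan s ext l) }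

  extreme-leaf : Extreme leaf
  extreme-leaf = inj₁

  good-copies : ∀ c {x} → Good K x → Goods K (copies c x)
  good-copies zero good = good
  good-copies (suc c) good = good , good-copies c good

  good-full : Good K full
  good-full = good-fan t′ ≤-refl extreme-leaf tt

  -- The face has `t + 2 = K + 1` children, and a path uses at least one edge in each.
  len-heavy : ∀ s x {q} → Len⁺ (fan t′ x) (cons (fan s leaf) (copies t′ full)) q → K < q
  len-heavy s x (q₁ , _ , refl , l , (q₂ , q₃ , refl , l′ , ls)) =
    +-mono-≤ (len-pos (fan t′ x) l) (+-mono-≤ (len-pos (fan s leaf) l′) (lens-copies t′ full ls))

  extreme-heavy : ∀ s x → Extreme (heavy s x)
  extreme-heavy s x (inj₁ eq) = inj₁ eq
  extreme-heavy s x (inj₂ l) = inj₂ (len-heavy s x l)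

  good-heavy : ∀ s {x} → s ≤ t′ → Extreme x → Good K x → Good K (heavy s x)
  good-heavy s {x} s≤ ext good = good-fan t′ ≤-refl ext good , (good-fan s s≤ extreme-leaf tt , good-copies t′ good-full)
    , λ l → <-irrefl refl (len-heavy s x l)

  extreme-tower : ∀ b → Extreme (tower b)
  extreme-tower zero = extreme-leaf
  extreme-tower (suc b) = extreme-heavy t′ (tower b)

  good-tower : ∀ b → Good K (tower b)
  good-tower zero = tt
  good-tower (suc b) = good-heavy t′ ≤-refl (extreme-tower b) (good-tower b)

  good-blocks : ∀ a {b} → b ≤ t′ → Goods K (blocks a b)
  good-blocks zero b≤ = good-fan _ b≤ extreme-leaf tt
  good-blocks (suc a) b≤ = good-full , good-blocks a b≤

  record Optimal (w L : ℕ) : Set where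
    field
      forest : Forest
      good   : Goods K forest
      wide   : widths forest ≡ w
      loss   : sizes forest + L ≡ 2 * w

  -- All fans around the `q` heavy faces are full; the remaining vertices go into `a` full blocks
  -- and a last one with `b` triangles, each of which costs a loss of 1.
  many-blocks : ∀ q a {b} → b ≤ t′ → Optimal (suc t + (q * M + (t * a + b))) (t * q + a + 2)
  many-blocks q a {b} b≤ = record
    { forest = cons root (blocks a b)
    ; good = good-fan t′ ≤-refl (extreme-tower q) (good-tower q) , good-blocks a b≤
    ; wide = wide
    ; loss = trans (arith (size root) (sizes (blocks a b)) (t * q) a) (trans (cong₂ _+_ (loss-fan t′ (tower q) (t * q + 1) (loss-tower q)) (loss-blocks a b))
        (trans (sym (*-distribˡ-+ 2 (width root) (widths (blocks a b)))) (cong (λ z → 2 * z) wide))) }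
    where
    root = fan t′ (tower q)
    arith : ∀ x y z a → x + y + (z + a + 2) ≡ (x + (z + 1)) + (y + suc a)
    arith = solve-∀
    arith′ : ∀ t′ z y b → t′ + (1 + z) + (y + (b + 1)) ≡ suc (suc t′) + (z + (y + b))
    arith′ = solve-∀
    wide : width root + widths (blocks a b) ≡ suc t + (q * M + (t * a + b))
    wide = trans (cong₂ _+_ (trans (width-fan t′ (tower q)) (cong (λ z → t′ + z) (width-tower q))) (width-blocks a b)) (arith′ t′ (q * M) (t * a) b)

  -- Once `t * t` vertices remain, another heavy face is cheaper than further blocks. Two of its
  -- fans are shortened, to `a` triangles on top and `b` at one side, and all others are full.
  one-block : ∀ q {a b} → a ≤ t′ → b ≤ t′ → Optimal (suc t + (q * M + (t * t + (a + b)))) (t * suc q + 1)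
  one-block q {a} {b} a≤ b≤ = record
    { forest = one (fan a (heavy b (tower q)))
    ; good = good-fan a a≤ (extreme-heavy b (tower q)) (good-heavy b b≤ (extreme-tower q) (good-tower q))
    ; wide = wide
    ; loss = trans (cong (λ z → size (fan a (heavy b (tower q))) + z) (arith t q))
        (trans (loss-fan a (heavy b (tower q)) (t + (t * q + 1)) (loss-heavy b (tower q) (t * q + 1) (loss-tower q))) (cong (λ z → 2 * z) wide)) }
    where
    arith : ∀ t q → t * suc q + 1 ≡ t + (t * q + 1)
    arith = solve-∀
    arith′ : ∀ t′ z a b → a + ((t′ + (1 + z)) + ((b + 1) + suc t′ * (t′ + 1))) ≡ suc (suc t′) + (z + (suc t′ * suc t′ + (a + b)))
    arith′ = solve-∀
    wide : width (fan a (heavy b (tower q))) ≡ suc t + (q * M + (t * t + (a + b)))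
    wide = trans (width-fan a (heavy b (tower q))) (trans (cong (λ z → a + z) (trans (width-heavy b (tower q))
      (cong (λ z → (t′ + z) + ((b + 1) + t * (t′ + 1))) (width-tower q)))) (arith′ t′ (q * M) a b))

-- The formula

/-unique : ∀ {A B} .{{_ : NonZero B}} Q r → A ≡ r + Q * B → r < B → A / B ≡ Q
/-unique {B = B} Q r refl r<B = trans (+-distrib-/-∣ʳ r (divides-refl Q)) (cong₂ _+_ (m<n⇒m/n≡0 r<B) (m*n/n≡m Q B))

pos-balance : ∀ e l N q c → e + l + c ≡ N + q → + e ≡ + N ℤ.- + l ℤ.+ + q ℤ.- + c
pos-balance e l N q c eq = begin
  + e                                             ≡⟨ cancel (+ e) (+ l) (+ c) ⟩
  (+ e ℤ.+ + l ℤ.+ + c) ℤ.- + l ℤ.- + c  ≡⟨ cong (λ z → z ℤ.- + l ℤ.- + c) (cong (+_) eq) ⟩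
  (+ N ℤ.+ + q) ℤ.- + l ℤ.- + c           ≡⟨ swap-terms (+ N) (+ q) (+ l) (+ c) ⟩
  + N ℤ.- + l ℤ.+ + q ℤ.- + c             ∎
  where
  open ≡-Reasoning
  cancel : ∀ x y z → x ≡ (x ℤ.+ y ℤ.+ z) ℤ.- y ℤ.- z
  cancel = ℤSolver.solve-∀
  swap-terms : ∀ x y z w → (x ℤ.+ y) ℤ.- z ℤ.- w ≡ x ℤ.- z ℤ.+ y ℤ.- w
  swap-terms = ℤSolver.solve-∀

-- The body of `f` with its test abstracted, so that the outcome of the test can be replaced by
-- `cong`.
branch : (n l k : ℕ) .{{_ : NonZero k}} → Bool → ℤ.ℤ
branch n l k b = if b then + (2 * n) ℤ.- + l ℤ.+ + (2 * (l / k)) ℤ.- + 3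
                      else + (2 * n) ℤ.- + l ℤ.+ + (2 * (l / k)) ℤ.- + 2

f-divisible : ∀ {n k} 3≤k Q e → lam n k 3≤k ≡ Q * k → e + Q * k + 3 ≡ 2 * n + 2 * Q → + e ≡ f n k 3≤k
f-divisible {n} {k@(suc _)} 3≤k Q e eq bal =
  trans (pos-balance e l (2 * n) (2 * (l / k)) 3
          (trans (cong (λ z → e + z + 3) eq) (trans bal (cong (λ z → 2 * n + 2 * z) (sym (/-unique Q 0 eq (s≤s z≤n)))))))
        (cong (branch n l k) (sym (dec-true (k ∣? l) (divides Q eq))))
  where
  l = lam n k 3≤k

f-indivisible : ∀ {n k} 3≤k Q r e → lam n k 3≤k ≡ r + Q * k → 0 < r → r < k →
                e + (r + Q * k) + 2 ≡ 2 * n + 2 * Q → + e ≡ f n k 3≤k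
f-indivisible {n} {k@(suc _)} 3≤k Q r e eq 0<r r<k bal =
  trans (pos-balance e l (2 * n) (2 * (l / k)) 2
          (trans (cong (λ z → e + z + 2) eq) (trans bal (cong (λ z → 2 * n + 2 * z) (sym (/-unique Q r eq r<k))))))
        (cong (branch n l k) (sym (dec-false (k ∣? l) λ d → <⇒≢ 0<r
          (trans (sym (n∣m⇒m%n≡0 l k d)) (trans (cong (_% k) eq) (trans ([m+kn]%n≡m%n r Q k) (m<n⇒m%n≡m r<k)))))))
  where
  l = lam n k 3≤k

module Formula (t′ : ℕ) (3≤k : 3 ≤ 3 + t′) where

  private
    t k M : ℕ
    t = suc t′
    k = 3 + t′
    M = t * t + t + t′

  denominator : k * k ∸ (2 * k + 1) ≡ M
  denominator = trans (cong (_∸ (2 * k + 1)) (arith t′)) (m+n∸n≡m M (2 * k + 1))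
    where
    arith : ∀ t′ → (3 + t′) * (3 + t′) ≡ suc t′ * suc t′ + suc t′ + t′ + (2 * (3 + t′) + 1)
    arith = solve-∀

  numerator : ∀ x → k * (k + x) ∸ (2 * k + 1) ≡ M + k * x
  numerator x = trans (cong (_∸ (2 * k + 1)) (arith t′ x)) (m+n∸n≡m (M + k * x) (2 * k + 1))
    where
    arith : ∀ t′ x → (3 + t′) * (3 + t′ + x) ≡ suc t′ * suc t′ + suc t′ + t′ + (3 + t′) * x + (2 * (3 + t′) + 1)
    arith = solve-∀

  -- For `n = k + x` the numerator is `M + k * x`, so λ is 2 plus the quotient of `k * x` by `M`.
  lam-≡ : ∀ {x} Q r → k * x ≡ r + Q * M → r < M → lam (k + x) k 3≤k ≡ 2 + Q
  lam-≡ {x} Q r eq r<M = trans (cong (_+ 1) (/-unique {{subst NonZero (sym denominator) _}} (suc Q) r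
      (trans (numerator x) (trans (cong (λ z → M + z) eq) (trans (arith M r Q) (cong (λ z → r + suc Q * z) (sym denominator)))))
      (subst (r <_) (sym denominator) r<M)))
    (+-comm (suc Q) 1)
    where
    arith : ∀ M r Q → M + (r + Q * M) ≡ r + suc Q * M
    arith = solve-∀

  vertices : ∀ x q → 2 * (suc t + x) + (2 * q + 2) ≡ 2 * (k + x) + 2 * q
  vertices = arith t′
    where
    arith : ∀ t′ x q → 2 * (suc (suc t′) + x) + (2 * q + 2) ≡ 2 * (3 + t′ + x) + 2 * q
    arith = solve-∀

  module Small (q a b : ℕ) (a≤ : a ≤ t′) (b≤ : b ≤ t′) where
    x = q * M + (t * a + b)
    L = t * q + a + 2

    -- From `k * t = M + 1` one gets `k * x = (k * q + a) * M + (a + k * b)`, where the last summand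
    -- is less than `M`. Hence λ is `k * q + (2 + a)`, with `2 + a < k`.
    small-f : ∀ e → e + L ≡ 2 * (suc t + x) → + e ≡ f (k + x) k 3≤k
    small-f e eq = f-indivisible {k + x} 3≤k q (2 + a) e
      (trans (lam-≡ {x} (k * q + a) (a + k * b) (arith t′ q a b) r<M) (cong (λ z → 2 + z) (trans (+-comm (k * q) a) (cong (λ z → a + z) (*-comm k q)))))
      (s≤s z≤n) (s≤s (s≤s (s≤s a≤)))
      (trans (arith₁ e t′ q a) (trans (cong (_+ (2 * q + 2)) eq) (vertices x q)))
      where
      arith : ∀ t′ q a b → (3 + t′) * (q * (suc t′ * suc t′ + suc t′ + t′) + (suc t′ * a + b))
              ≡ a + (3 + t′) * b + ((3 + t′) * q + a) * (suc t′ * suc t′ + suc t′ + t′)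
      arith = solve-∀
      arith₁ : ∀ e t′ q a → e + (2 + a + q * (3 + t′)) + 2 ≡ e + (suc t′ * q + a + 2) + (2 * q + 2)
      arith₁ = solve-∀
      r<M : a + k * b < M
      r<M = ≤-trans (s≤s (+-mono-≤ a≤ (*-monoʳ-≤ k b≤))) (≤-trans (m≤m+n _ 1) (≤-reflexive (arith₃ t′)))
        where
        arith₃ : ∀ t′ → suc (t′ + (3 + t′) * t′) + 1 ≡ suc t′ * suc t′ + suc t′ + t′
        arith₃ = solve-∀

    -- A smaller `ℓ` is at most `t * suc q`, which forces `h ≤ q`; the right side of `size` then
    -- falls short by at least `b + 1`.
    small-bound : ∀ {ℓ h} → t * h + 1 ≤ ℓ → suc t + x ≤ t * ℓ + (t + t′) * h → L ≤ ℓ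
    small-bound {ℓ} {h} loss size = ≮⇒≥ λ ℓ<L → <-irrefl refl (too-big (≤-pred (subst (suc ℓ ≤_) (+-suc (t * q + a) 1) ℓ<L)))
      where
      too-big : ℓ ≤ t * q + a + 1 → suc (b + (q * M + (t * a + suc t′))) ≤ b + (q * M + (t * a + suc t′))
      too-big ℓ≤ = ≤-trans (≤-reflexive (arith t′ q a b)) (≤-trans size (≤-trans (+-mono-≤ (*-monoʳ-≤ t ℓ≤) (*-monoʳ-≤ (t + t′) h≤))
          (≤-trans (≤-reflexive (arith′ t′ q a)) (m≤n+m _ b))))
        where
        arith : ∀ t′ q a b → suc (b + (q * (suc t′ * suc t′ + suc t′ + t′) + (suc t′ * a + suc t′)))
                ≡ suc (suc t′) + (q * (suc t′ * suc t′ + suc t′ + t′) + (suc t′ * a + b))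
        arith = solve-∀
        arith′ : ∀ t′ q a → suc t′ * (suc t′ * q + a + 1) + (suc t′ + t′) * q ≡ q * (suc t′ * suc t′ + suc t′ + t′) + (suc t′ * a + suc t′)
        arith′ = solve-∀
        h≤ : h ≤ q
        h≤ = ≤-pred (*-cancelˡ-< t h (suc q) (≤-trans (≤-reflexive (+-comm 1 (t * h))) (≤-trans (≤-trans loss ℓ≤)
               (≤-trans (+-monoˡ-≤ 1 (+-monoʳ-≤ (t * q) a≤)) (≤-reflexive (arith″ t′ q))))))
          where
          arith″ : ∀ t′ q → suc t′ * q + t′ + 1 ≡ suc t′ * suc q
          arith″ = solve-∀

  module Large (q c : ℕ) (c≤ : c ≤ t′ + t′) where
    x = q * M + (t * t + c)
    L = t * suc q + 1

    expand : k * x ≡ t + k * c + (k * q + t) * M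
    expand = arith t′ q c
      where
      arith : ∀ t′ q c → (3 + t′) * (q * (suc t′ * suc t′ + suc t′ + t′) + (suc t′ * suc t′ + c))
              ≡ suc t′ + (3 + t′) * c + ((3 + t′) * q + suc t′) * (suc t′ * suc t′ + suc t′ + t′)
      arith = solve-∀

    -- Now `k * x = (k * q + t) * M + (t + k * c)`, and `t + k * c` may or may not reach `M`. So λ
    -- is `k * suc q` or one more; the extra 1 in λ is offset by the constant 2 in place of 3, and
    -- the loss is the same.
    large-f : ∀ e → e + L ≡ 2 * (suc t + x) → + e ≡ f (k + x) k 3≤k
    large-f e eq with t + k * c <? M
    ... | yes r<M = f-divisible {k + x} 3≤k (suc q) e
      (trans (lam-≡ {x} (k * q + t) (t + k * c) expand r<M) (arith₀ t′ q))
      (trans (arith₁ e t′ q) (trans (cong (_+ (2 * suc q + 2)) eq) (vertices x (suc q))))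
      where
      arith₀ : ∀ t′ q → 2 + ((3 + t′) * q + suc t′) ≡ suc q * (3 + t′)
      arith₀ = solve-∀
      arith₁ : ∀ e t′ q → e + suc q * (3 + t′) + 3 ≡ e + (suc t′ * suc q + 1) + (2 * suc q + 2)
      arith₁ = solve-∀
    ... | no r≮M with m≤n⇒∃[o]m+o≡n (≮⇒≥ r≮M)
    ...   | r , M+r≡ = f-indivisible {k + x} 3≤k (suc q) 1 e
      (trans (lam-≡ {x} (k * q + suc t) r (trans expand (trans (cong (_+ (k * q + t) * M) (sym M+r≡)) (arith₃ M r (k * q) t))) r<M) (arith₀ t′ q))
      (s≤s z≤n) (s≤s (s≤s z≤n))
      (trans (arith₁ e t′ q) (trans (cong (_+ (2 * suc q + 2)) eq) (vertices x (suc q))))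
      where
      arith₃ : ∀ M r z t → M + r + (z + t) * M ≡ r + (z + suc t) * M
      arith₃ = solve-∀
      arith₀ : ∀ t′ q → 2 + ((3 + t′) * q + suc (suc t′)) ≡ 1 + suc q * (3 + t′)
      arith₀ = solve-∀
      arith₁ : ∀ e t′ q → e + (1 + suc q * (3 + t′)) + 2 ≡ e + (suc t′ * suc q + 1) + (2 * suc q + 2)
      arith₁ = solve-∀
      r<M : r < M
      r<M = +-cancelˡ-< M r M (≤-trans (s≤s (≤-reflexive M+r≡)) (≤-trans (s≤s (+-monoʳ-≤ t (*-monoʳ-≤ k c≤)))
              (≤-trans (m≤m+n _ (t′ + 2)) (≤-reflexive (arith₄ t′)))))
        where
        arith₄ : ∀ t′ → suc (suc t′ + (3 + t′) * (t′ + t′)) + (t′ + 2) ≡ suc t′ * suc t′ + suc t′ + t′ + (suc t′ * suc t′ + suc t′ + t′)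
        arith₄ = solve-∀

    large-bound : ∀ {ℓ h} → t * h + 1 ≤ ℓ → suc t + x ≤ t * ℓ + (t + t′) * h → L ≤ ℓ
    large-bound {ℓ} {h} loss size = ≮⇒≥ λ ℓ<L → <-irrefl refl (too-big (≤-pred (subst (suc ℓ ≤_) (+-comm (t * suc q) 1) ℓ<L)))
      where
      too-big : ℓ ≤ t * suc q → suc (t + (c + (q * M + t * t))) ≤ t + (c + (q * M + t * t))
      too-big ℓ≤ = ≤-trans (≤-reflexive (arith t (q * M) c)) (≤-trans size (≤-trans (+-mono-≤ (*-monoʳ-≤ t ℓ≤) (*-monoʳ-≤ (t + t′) h≤))
          (≤-trans (≤-reflexive (arith′ t′ q)) (≤-trans (m≤n+m _ c) (m≤n+m _ t)))))
        where
        arith : ∀ t z c → suc (t + (c + (z + t * t))) ≡ suc t + (z + (t * t + c))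
        arith = solve-∀
        arith′ : ∀ t′ q → suc t′ * (suc t′ * suc q) + (suc t′ + t′) * q ≡ q * (suc t′ * suc t′ + suc t′ + t′) + suc t′ * suc t′
        arith′ = solve-∀
        h≤ : h ≤ q
        h≤ = ≤-pred (*-cancelˡ-< t h (suc q) (≤-trans (≤-reflexive (+-comm 1 (t * h))) (≤-trans loss ℓ≤)))

-- The value of the Turán number

module _ (t′ : ℕ) (3≤k : 3 ≤ 3 + t′) where
  private
    t k M : ℕ
    t = suc t′
    k = 3 + t′
    M = t * t + t + t′

  open Extremal t′
  open Formula t′ 3≤k

  extremal-number : ∀ {x} L → Optimal (suc t + x) L →
    (∀ {ℓ h} → t * h + 1 ≤ ℓ → suc t + x ≤ t * ℓ + (t + t′) * h → L ≤ ℓ) →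
    (∀ e → e + L ≡ 2 * (suc t + x) → + e ≡ f (k + x) k 3≤k) →
    Σ ℕ (λ m → IsExOP (k + x) (cycle k 3≤k) m × + m ≡ f (k + x) k 3≤k)
  extremal-number {x} L opt minimal formula = sizes forest , record
      { attained = graph , graph-outerplanar , free , ≤-antisym (maximal graph graph-outerplanar free)
                     (subst (_≤ Graph.#edges graph) (length-edgess forest 0) graph-edges)
      ; maximal = maximal } , formula (sizes forest) loss
    where
    open Optimal opt
    open Realise {m = t + x} (strip-cong {o = 0} wide (strips forest 0))
    free : Free (cycle k 3≤k) graph
    free = graph-free 3≤k (acyclics (suc t) (s≤s (s≤s z≤n)) forest good)
    maximal : ∀ (G : Graph (k + x)) → Outerplanar G → Free (cycle k 3≤k) G → Graph.#edges G ≤ sizes forest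
    maximal G op fr = let ℓ , h , count , th<ℓ , w≤ = outerplanar-bound (t + x) t′ 3≤k G op fr in
      +-cancelʳ-≤ L _ _ (≤-trans (+-monoʳ-≤ (Graph.#edges G) (minimal {ℓ} {h} th<ℓ w≤)) (≤-trans count (≤-reflexive (sym loss))))

  turán-number : ∀ x → Σ ℕ (λ m → IsExOP (k + x) (cycle k 3≤k) m × + m ≡ f (k + x) k 3≤k)
  turán-number x with x / M | x % M | m%n<n x M | m≡m%n+[m/n]*n x M
  -- Below `t * t` the quotient and the remainder of `p` by `t` are at most `t′`, as `many-blocks`
  -- wants. From `t * t` on, `M = t * t + (2 t − 1)` leaves an excess of at most `2 t′`, which two
  -- shortened fans share.
  ... | q | p | p<M | eq with p <? t * t
  ...   | yes p<t² with trans eq (trans (+-comm p (q * M)) (cong (λ z → q * M + z) (trans (m≡m%n+[m/n]*n p t)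
                          (trans (+-comm (p % t) (p / t * t)) (cong (_+ p % t) (*-comm (p / t) t))))))
  ...     | refl = extremal-number (t * q + p / t + 2) (many-blocks q (p / t) b≤) (λ {ℓ} {h} → small-bound {ℓ} {h}) small-f
    where
    a≤ : p / t ≤ t′
    a≤ = ≤-pred (m<n*o⇒m/o<n p<t²)
    b≤ : p % t ≤ t′
    b≤ = ≤-pred (m%n<n p t)
    open Small q (p / t) (p % t) a≤ b≤
  turán-number x | q | p | p<M | eq | no p≮t² with m≤n⇒∃[o]m+o≡n (≮⇒≥ p≮t²)
  ...     | c , refl with trans eq (+-comm (t * t + c) (q * M))
  ...       | refl with ≤-split t′ (≤-pred (+-cancelˡ-< (t * t) c (suc (t′ + t′)) (≤-trans p<M (≤-reflexive (arith t′)))))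
    where
    arith : ∀ t′ → suc t′ * suc t′ + suc t′ + t′ ≡ suc t′ * suc t′ + suc (t′ + t′)
    arith = solve-∀
  ...         | a , b , a≤ , b≤ , refl = extremal-number (t * suc q + 1) (one-block q a≤ b≤) (λ {ℓ} {h} → large-bound {ℓ} {h}) large-f
    where
    open Large q (a + b) (+-mono-≤ a≤ b≤)

theorem2p1 : (n k : ℕ) (3≤k : 3 ≤ k) → k ≤ n →
    Σ ℕ (λ m → IsExOP n (cycle k 3≤k) m × + m ≡ f n k 3≤k)
theorem2p1 n k@(suc (suc (suc t′))) 3≤k k≤n with m≤n⇒∃[o]m+o≡n k≤n
... | x , refl = turán-number t′ 3≤k x
theorem2p1 n 1 (s≤s ()) _
theorem2p1 n 2 (s≤s (s≤s ())) _
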